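{- Let $\Gamma=(X,Y,s,t,J,L)$ be a finite abstract isogeny graph. Let $A$ and $D$ be its adjacency and degree operators on $\mathbb{C}^X$, let $Q=D-\mathrm{id}_{\mathbb{C}^X}$, and assume that $D$ commutes with $L$ (as operators on $\mathbb{C}^X$). Then $$\zeta_\Gamma(u)=\frac{(1-u^2)^{C_1(L)}(1+u)^{ -C_1(J)}\prod_{k>1}(1-(-1)^ku^{2k})^{C_k(L)}\,(1-u^k)^{ -C_k(J)}}{\det(\mathrm{id}_{\mathbb{C}^X}-Au+u^2QL)}.$$
   Context: An abstract isogeny graph $\Gamma=(X,Y,s,t,J,L)$ consists of a set $X$ (vertices), a set $Y$ (edges), functions $s,t\colon Y\to X$ (source, target), $J\colon Y\to Y$ and $L\colon X\to X$ such that $s(Jy)=t(y)$ and $t(Jy)=L(s(y))$ for all $y\in Y$ ($J$ and $L$ are arbitrary functions otherwise). It is finite if $X$ and $Y$ are finite. The degree of $x\in X$ is $d(x)=\#\{y\in Y: s(y)=x\}$. A path is a sequence of edges $y_1\cdots y_n$ ($n\ge1$) with $s(y_{i+1})=t(y_i)$ for $1\le i<n$; its length is $\nu=n$. It is non-backtracking if $y_{i+1}\ne Jy_i$ for $1\le i<n$. A cycle is a path with $t(y_n)=s(y_1)$; a cycle has a tail if $y_1=Jy_n$. A cycle $C$ is primitive if it is non-backtracking, has no tail, and is not of the form $C'^f$ (concatenation of $f$ copies) for a cycle $C'$ and $f>1$. A prime of $\Gamma$ is an equivalence class $[C]$ of primitive cycles under cyclic permutation of the edges. The Ihara zeta function is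 $\zeta_\Gamma(u)=\prod_{[P]}(1-u^{\nu(P)})^{ -1}$, the product over all primes of $\Gamma$. $\mathbb{C}^X$ is the vector space with basis $X$. The operators $A,D,L$ on $\mathbb{C}^X$ are defined on the basis by $Ax=\sum_{y: s(y)=x}t(y)$, $Dx=d(x)x$, and $x\mapsto Lx$. For a finite set $B$ and a function $F\colon B\to B$, let $Z\subseteq B$ be the largest subset such that $F|_Z$ is a permutation of $Z$; $C_k(F)$ denotes the number of cycles of length $k$ in the cycle decomposition of $F|_Z$ (fixed points being cycles of length 1).
   Formalization: The printed factors for k>1 are wrong for odd k (three vertices, no edges, L a 3-cycle: zeta is 1, not (1+u^6)/(1-u^6)); what is proved has (1-u^{2k})^{C_k(L)} (1-(-1)^k u^k)^{ -C_k(J)} instead, over any commutative ring without additive torsion, such as the complex numbers. -}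

module Defs where

open import Algebra.Bundles using (CommutativeRing)
open import Algebra.Bundles.Raw using (RawRing)
import Algebra.Definitions.RawMonoid as RawMonoidDefs
import Algebra.Definitions.RawSemiring as RawSemiringDefs
open import Data.Bool.Base using (if_then_else_)
open import Data.Fin.Base as Fin using (Fin; toℕ; punchIn)
import Data.Fin.Properties as Fin
open import Data.Fin.Subset using (Subset; _∈_)
open import Data.Fin.Subset.Properties using (_∈?_; anySubset?)
open import Data.List.Base
  using (List; []; _∷_; _++_; map; foldr; filter; length; take; drop; replicate;
         concat; allFin; deduplicate; cartesianProductWith)
open import Data.List.NonEmpty.Base as List⁺ using (List⁺; _∷_; toList; head; last)
import Data.List.Properties as List
open import Data.List.Relation.Unary.Linked using (Linked; linked?)
open import Data.Nat.Base as ℕ using (ℕ; zero; suc; _∸_; _<_; _≤_; s≤s)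
open import Data.Nat.GeneralisedArithmetic using (fold)
import Data.Nat.Properties as ℕ
open import Data.Product.Base using (Σ; ∃; ∃₂; _×_; _,_)
open import Function.Base using (_∘_)
open import Function.Bundles using (_↔_; Inverse)
open import Function.Properties.Inverse using (Inverse⇒Injection)
open import Level using (Level; _⊔_) renaming (suc to lsuc)
open import Relation.Binary.Definitions using (DecidableEquality)
open import Relation.Binary.PropositionalEquality
  using (_≡_; _≢_; refl; sym; trans; cong; subst)
open import Relation.Nullary.Decidable as Dec
  using (Dec; does; ¬?; _×-dec_; _→-dec_; map′)
open import Relation.Nullary.Negation.Core using (¬_)

------------------------------------------------------------------------
-- Abstract isogeny graphs

record AbstractIsogenyGraph (a b : Level) : Set (lsuc (a ⊔ b)) where
  field
    X   : Set a
    Y   : Set b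
    s t : Y → X
    J   : Y → Y
    L   : X → X
    s∘J : ∀ y → s (J y) ≡ t y
    t∘J : ∀ y → t (J y) ≡ L (s y)

record Finite {a b} (Γ : AbstractIsogenyGraph a b) : Set (a ⊔ b) where
  open AbstractIsogenyGraph Γ
  field
    {∣X∣ ∣Y∣} : ℕ
    enumX : X ↔ Fin ∣X∣
    enumY : Y ↔ Fin ∣Y∣

module Enumeration {b} {B : Set b} {n : ℕ} (enum : B ↔ Fin n) where
  open Inverse enum public using () renaming (to to index; from to elem)

  elements : List B
  elements = map elem (allFin n)

  infix 4 _≟_
  _≟_ : DecidableEquality B
  _≟_ = Fin.inj⇒≟ (Inverse⇒Injection enum)

------------------------------------------------------------------------
-- Paths, cycles and primes

module Paths {a b} (Γ : AbstractIsogenyGraph a b) where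
  open AbstractIsogenyGraph Γ

  -- Nonempty sequences y₁ ⋯ yₙ of edges; the length ν is List⁺.length.
  EdgeSeq : Set b
  EdgeSeq = List⁺ Y

  IsPath : EdgeSeq → Set (a ⊔ b)
  IsPath c = Linked (λ y y′ → s y′ ≡ t y) (toList c)

  NonBacktracking : EdgeSeq → Set b
  NonBacktracking c = Linked (λ y y′ → y′ ≢ J y) (toList c)

  IsCycle : EdgeSeq → Set (a ⊔ b)
  IsCycle c = IsPath c × t (last c) ≡ s (head c)

  HasTail : EdgeSeq → Set b
  HasTail c = head c ≡ J (last c)

  _IsCopies_Of_ : EdgeSeq → ℕ → EdgeSeq → Set b
  c IsCopies f Of c′ = toList c ≡ concat (replicate f (toList c′))

  IsProperPower : EdgeSeq → Set (a ⊔ b)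
  IsProperPower c = ∃₂ λ c′ f → IsCycle c′ × 1 < f × c IsCopies f Of c′

  Primitive : EdgeSeq → Set (a ⊔ b)
  Primitive c = IsCycle c × NonBacktracking c × ¬ HasTail c × ¬ IsProperPower c

  infix 4 _∼_
  _∼_ : EdgeSeq → EdgeSeq → Set b
  c ∼ c′ = ∃ λ (i : Fin (List⁺.length c)) →
    toList c′ ≡ drop (toℕ i) (toList c) ++ take (toℕ i) (toList c)

module Primes {a b} (Γ : AbstractIsogenyGraph a b) (fin : Finite Γ) where
  open AbstractIsogenyGraph Γ
  open Finite fin
  open Paths Γ public
  private
    module EX = Enumeration enumX
    module EY = Enumeration enumY

  isCycle? : ∀ c → Dec (IsCycle c)
  isCycle? c = linked? (λ y y′ → s y′ EX.≟ t y) (toList c)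
         ×-dec t (last c) EX.≟ s (head c)

  isProperPower? : ∀ c → Dec (IsProperPower c)
  isProperPower? c@(y ∷ ys) =
    map′ sound complete
      (ℕ.anyUpTo? (λ p → ℕ.anyUpTo? (λ f →
          isCycle? (prefix p) ×-dec 1 ℕ.<? f ×-dec
          List.≡-dec EY._≟_ (toList c) (concat (replicate f (toList (prefix p)))))
        (suc ν)) ν)
    where
    ν = List⁺.length c

    prefix : ℕ → EdgeSeq
    prefix p = y ∷ take p ys

    Bounded : Set _
    Bounded = ∃ λ p → p < ν × ∃ λ f → f < suc ν ×
      IsCycle (prefix p) × 1 < f × c IsCopies f Of prefix p

    sound : Bounded → IsProperPower c
    sound (p , _ , f , _ , cyc , 1<f , eq) = prefix p , f , cyc , 1<f , eq

    take-++ : ∀ (us vs : List Y) → take (length us) (us ++ vs) ≡ us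
    take-++ []       vs = refl
    take-++ (u ∷ us) vs = cong (u ∷_) (take-++ us vs)

    f≤length : ∀ f (u : Y) us → f ≤ length (concat (replicate f (u ∷ us)))
    f≤length zero    u us = ℕ.z≤n
    f≤length (suc f) u us = s≤s (ℕ.≤-trans (f≤length f u us)
      (subst (length (concat (replicate f (u ∷ us))) ≤_)
        (sym (List.length-++ us)) (ℕ.m≤n+m _ (length us))))

    complete : IsProperPower c → Bounded
    complete (u ∷ us , suc f , cyc , 1<f , eq)
      with refl ← List.∷-injectiveˡ eq =
      length us , s≤s len , suc f ,
      s≤s (subst (suc f ≤_) (sym (cong length eq)) (f≤length (suc f) u us)) ,
      subst IsCycle (sym pre) cyc , 1<f ,
      trans eq (cong (λ c′ → concat (replicate (suc f) (toList c′))) (sym pre))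
      where
      rest = concat (replicate f (u ∷ us))
      tl : ys ≡ us ++ rest
      tl = List.∷-injectiveʳ eq
      pre : prefix (length us) ≡ u ∷ us
      pre = cong (u ∷_) (trans (cong (take (length us)) tl) (take-++ us rest))
      len : length us ≤ length ys
      len = subst (length us ≤_)
        (sym (trans (cong length tl) (List.length-++ us))) (ℕ.m≤m+n _ _)

  primitive? : ∀ c → Dec (Primitive c)
  primitive? c = isCycle? c
           ×-dec linked? (λ y y′ → ¬? (y′ EY.≟ J y)) (toList c)
           ×-dec ¬? (head c EY.≟ J (last c))
           ×-dec ¬? (isProperPower? c)

  _∼?_ : ∀ c c′ → Dec (c ∼ c′)
  c ∼? c′ = Fin.any? λ i → List.≡-dec EY._≟_ (toList c′) _

  words : ℕ → List (List Y)
  words zero    = [] ∷ []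
  words (suc n) = cartesianProductWith _∷_ EY.elements (words n)

  edgeSeqs : ℕ → List EdgeSeq
  edgeSeqs zero    = []
  edgeSeqs (suc n) = cartesianProductWith _∷_ EY.elements (words n)

  -- One representative of each prime [C] with ν(C) = n.
  primes : ℕ → List EdgeSeq
  primes n = deduplicate _∼?_ (filter primitive? (edgeSeqs n))

------------------------------------------------------------------------
-- C_k(F)

module SelfMap {n : ℕ} (F : Fin n → Fin n) where

  IsPermutationOn : Subset n → Set
  IsPermutationOn S = (∀ i → i ∈ S → F i ∈ S)
                    × (∀ i j → i ∈ S → j ∈ S → F i ≡ F j → i ≡ j)
                    × (∀ i → i ∈ S → ∃ λ j → j ∈ S × F j ≡ i)

  isPermutationOn? : ∀ S → Dec (IsPermutationOn S)
  isPermutationOn? S =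
          Fin.all? (λ i → i ∈? S →-dec F i ∈? S)
    ×-dec Fin.all? (λ i → Fin.all? λ j →
            i ∈? S →-dec j ∈? S →-dec F i Fin.≟ F j →-dec i Fin.≟ j)
    ×-dec Fin.all? (λ i → i ∈? S →-dec Fin.any? λ j → j ∈? S ×-dec F j Fin.≟ i)

  -- The subsets permuted by F are closed under union (the underlying set is
  -- finite), so the largest one is the union of all of them.
  InZ : Fin n → Set
  InZ i = ∃ λ S → IsPermutationOn S × i ∈ S

  inZ? : ∀ i → Dec (InZ i)
  inZ? i = anySubset? λ S → isPermutationOn? S ×-dec i ∈? S

  infixr 8 F^_
  F^_ : ℕ → Fin n → Fin n
  (F^ k) i = fold i F k

  OnCycleOfLength : ℕ → Fin n → Set
  OnCycleOfLength k i = InZ i × 0 < k × (F^ k) i ≡ i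
    × (∀ {j} → j < k → 0 < j → (F^ j) i ≢ i)

  onCycleOfLength? : ∀ k i → Dec (OnCycleOfLength k i)
  onCycleOfLength? k i = inZ? i ×-dec 0 ℕ.<? k ×-dec (F^ k) i Fin.≟ i
    ×-dec ℕ.allUpTo? (λ j → 0 ℕ.<? j →-dec ¬? ((F^ j) i Fin.≟ i)) k

  SameCycle : ℕ → Fin n → Fin n → Set
  SameCycle k i j = ∃ λ (m : Fin k) → j ≡ (F^ toℕ m) i

  sameCycle? : ∀ k i j → Dec (SameCycle k i j)
  sameCycle? k i j = Fin.any? λ m → j Fin.≟ (F^ toℕ m) i

  cycleCount : ℕ → ℕ
  cycleCount k = length (deduplicate (sameCycle? k)
                          (filter (onCycleOfLength? k) (allFin n)))

C : ∀ {b} {B : Set b} {n} → B ↔ Fin n → (B → B) → ℕ → ℕ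
C enum F = SelfMap.cycleCount (index ∘ F ∘ elem)
  where open Enumeration enum

------------------------------------------------------------------------
-- Linear operators on K^X

module RingOps {c ℓ} (K : RawRing c ℓ) where
  open RawRing K public hiding (_≉_)
  open RawSemiringDefs rawSemiring public using (_^_; sum; product)
  open RawMonoidDefs +-rawMonoid public using () renaming (_×_ to _×ₙ_)

  infixl 6 _-_
  _-_ : Carrier → Carrier → Carrier
  x - y = x + - y

  sumList productList : List Carrier → Carrier
  sumList     = foldr _+_ 0#
  productList = foldr _*_ 1#

  det : ∀ {n} → (Fin n → Fin n → Carrier) → Carrier
  det {zero}  M = 1#
  det {suc n} M = sum λ j → (- 1#) ^ toℕ j * M Fin.zero j
                          * det (λ i k → M (Fin.suc i) (punchIn j k))

module Operators {c ℓ x} (K : RawRing c ℓ)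
                 {X : Set x} {n : ℕ} (enum : X ↔ Fin n) where
  open RingOps K
  open Enumeration enum

  Vect : Set (x ⊔ c)
  Vect = X → Carrier

  basis : X → Vect
  basis p q = if does (p ≟ q) then 1# else 0#

  -- An operator is given by the images of the basis vectors:
  -- F p q is the q-coordinate of the image of p.
  Op : Set (x ⊔ c)
  Op = X → Vect

  infix 4 _≈ₒ_
  _≈ₒ_ : Op → Op → Set (x ⊔ ℓ)
  F ≈ₒ G = ∀ p q → F p q ≈ G p q

  idₒ : Op
  idₒ = basis

  infixl 6 _+ₒ_ _-ₒ_
  infixr 7 _·ₒ_
  infixr 8 _∘ₒ_

  _+ₒ_ _-ₒ_ _∘ₒ_ : Op → Op → Op
  (F +ₒ G) p q = F p q + G p q
  (F -ₒ G) p q = F p q - G p q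
  (F ∘ₒ G) p q = sum λ i → G p (elem i) * F (elem i) q

  _·ₒ_ : Carrier → Op → Op
  (k ·ₒ F) p q = k * F p q

  detₒ : Op → Carrier
  detₒ F = det λ i j → F (elem j) (elem i)

module GraphOperators {a b c ℓ} (K : RawRing c ℓ)
                      (Γ : AbstractIsogenyGraph a b) (fin : Finite Γ) where
  open AbstractIsogenyGraph Γ
  open Finite fin
  open RingOps K
  open Operators K enumX
  private
    module EX = Enumeration enumX
    module EY = Enumeration enumY

  outEdges : X → List Y
  outEdges x = filter (λ y → s y EX.≟ x) EY.elements

  d : X → ℕ
  d x = length (outEdges x)

  𝐀 𝐃 𝐋 𝐐 : Op
  𝐀 x q = sumList (map (λ y → basis (t y) q) (outEdges x))
  𝐃 x q = d x ×ₙ basis x q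
  𝐋 x   = basis (L x)
  𝐐     = 𝐃 -ₒ idₒ

------------------------------------------------------------------------
-- Formal power series

module _ {c ℓ} (K : RawRing c ℓ) where
  open RingOps K

  PowerSeries : RawRing c ℓ
  PowerSeries = record
    { Carrier = ℕ → Carrier
    ; _≈_     = λ f g → ∀ n → f n ≈ g n
    ; _+_     = λ f g n → f n + g n
    ; _*_     = λ f g n → sum {suc n} λ i → f (toℕ i) * g (n ∸ toℕ i)
    ; -_      = λ f n → - f n
    ; 0#      = λ _ → 0#
    ; 1#      = λ { zero → 1# ; (suc _) → 0# }
    }

module Series {c ℓ} (K : RawRing c ℓ) where
  private
    module K = RingOps K
  open RingOps (PowerSeries K) public

  const : K.Carrier → Carrier
  const r zero    = r
  const r (suc _) = K.0#

  u : Carrier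
  u 1 = K.1#
  u _ = K.0#

  -- The inverse of a series f with constant term 1, as the geometric series
  -- Σₖ (1 - f)ᵏ; the terms with k > n do not contribute to the n-th coefficient.
  infix 9 _⁻¹
  _⁻¹ : Carrier → Carrier
  (f ⁻¹) n = K.sum {suc n} λ k → ((1# - f) ^ toℕ k) n

  -- The infinite product of the F k over k ≥ m, for factors with
  -- F k ≡ 1 mod uᵏ: the factors with k > n do not affect the n-th coefficient.
  ∏≥ : ℕ → (ℕ → Carrier) → Carrier
  ∏≥ m F n = product {suc n} (λ i → F (m ℕ.+ toℕ i)) n

  -- ζ_Γ, the primes being grouped by their length.
  ζ : ∀ {a b} (Γ : AbstractIsogenyGraph a b) → Finite Γ → Carrier
  ζ Γ fin = ∏≥ 1 λ n → productList
    (map (λ P → (1# - u ^ List⁺.length P) ⁻¹) (primes n))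
    where open Primes Γ fin

------------------------------------------------------------------------

-- Satisfied by ℂ, for which the standard library has no construction.
TorsionFree : ∀ {c ℓ} → CommutativeRing c ℓ → Set (c ⊔ ℓ)
TorsionFree R = ∀ n x → suc n ×ₙ x ≈ 0# → x ≈ 0#
  where open RingOps (CommutativeRing.rawRing R)

module Setting {a b c ℓ} (R : CommutativeRing c ℓ)
               (Γ : AbstractIsogenyGraph a b) (fin : Finite Γ) where
  private K = CommutativeRing.rawRing R
  open AbstractIsogenyGraph Γ public using (J; L)
  open Finite fin public using (enumX; enumY)
  open Operators K enumX public using (_≈ₒ_; _∘ₒ_)
  open GraphOperators K Γ fin public using (𝐀; 𝐃; 𝐋; 𝐐)
  open Series K public
    using (ζ; u; _≈_; _+_; _-_; -_; _*_; _^_; _⁻¹; 1#; ∏≥)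
  open Operators (PowerSeries K) enumX public
    using (idₒ; _-ₒ_; _+ₒ_; _·ₒ_; detₒ)

  -- Extension of scalars from R^X to R[[u]]^X.
  ⟪_⟫ : Operators.Op K enumX → Operators.Op (PowerSeries K) enumX
  ⟪ F ⟫ p q = Series.const K (F p q)

{-# OPTIONS --safe #-}
module Submission where

-- Let B be the operator y ↦ Σ y′ over the edges y′ with s(y′) = t(y) and y′ ≠ Jy. A
-- closed walk that is non-backtracking and tailless is a power of exactly one
-- primitive cycle, and a prime of length k contains k primitive cycles; hence
-- u ζ′/ζ = Σ tr(Bⁿ) uⁿ. Two power series with constant term 1 and equal logarithmic
-- derivatives agree because the coefficients are torsion-free, so it suffices to
-- compute the logarithmic derivative of the right-hand side. The cycle factors give
-- traces of powers of J and L, since Σ_{k ∣ n} k C_k(F) is the number of fixed points of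
-- Fⁿ. The determinant is treated by Jacobi's formula θ(det Δ) = tr(θΔ Δ⁻¹) det Δ with
-- θ = u d/du and Bass's argument: write σ x for the sum of the edges with source x, so
-- that tσ = A, sσ = D and σt = B + J. As sJ = t and tJ = Ls,
--   (t - u L s)(1 + uJ) = (1 - u² L) t,
-- so that, D commuting with L,
--   1 - uA + u² Q L = (1 - u² L) - u (t - u L s) σ = (1 - u² L) (1 - u t (1 + uJ)⁻¹ σ),
-- whose last factor is inverted by 1 + u t (1 - uB)⁻¹ σ.

open import Defs
open import Algebra.Bundles using (CommutativeRing; Semiring)
open import Algebra.Bundles.Raw using (RawRing)
import Algebra.Properties.CommutativeSemigroup as CommutativeSemigroupProperties
import Algebra.Properties.Ring as RingProperties
import Algebra.Properties.Semiring.Mult as SemiringMult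
import Algebra.Properties.Semiring.Exp as SemiringExp
import Algebra.Properties.Semiring.Sum as SemiringSum
import Algebra.Properties.CommutativeMonoid.Mult as CommutativeMonoidMult
open import Data.Fin.Base as Fin using (Fin; zero; suc; toℕ; punchIn; fromℕ<)
import Data.Fin.Properties as Fin
open import Data.Nat.Base as ℕ using (ℕ; zero; suc; _∸_; _≤_; _<_; z≤n; s≤s)
import Data.Nat.Properties as ℕ
open import Data.Product.Base using (Σ; ∃; _×_; _,_; proj₁; proj₂)
open import Data.Sum.Base using (_⊎_; inj₁; inj₂)
open import Function.Base using (_∘_; id; _$_)
open import Level using (_⊔_)
open import Relation.Binary.PropositionalEquality as ≡ using (_≡_; _≢_)
import Relation.Binary.Reasoning.Setoid as SetoidReasoning
import Algebra.Solver.Ring.NaturalCoefficients.Default as RingSolver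
open import Relation.Nullary.Negation using (contradiction; ¬_)
open import Relation.Binary.Bundles using (Setoid)
open import Relation.Nullary.Decidable using (Dec; does; yes; no)
open import Data.Bool.Base using (true; false; if_then_else_)
open import Data.List.Base as List using (List; []; _∷_; _++_; map; filter; length; allFin; deduplicate; lookup; take; drop; concat; replicate; cartesianProductWith)
open import Data.List.NonEmpty.Base as List⁺ using (List⁺; _∷_; toList)
import Data.List.Properties as List
open import Data.List.Membership.Propositional using (_∈_)
open import Data.List.Membership.Propositional.Properties using (∈-filter⁺; ∈-filter⁻; ∈-map⁺; ∈-map⁻; ∈-allFin; ∈-lookup; ∈-deduplicate⁻; ∈-cartesianProductWith⁺; ∈-cartesianProductWith⁻)
open import Data.List.Membership.Propositional.Properties.WithK using (unique∧set⇒bag)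
open import Data.List.Relation.Binary.BagAndSetEquality using (∼bag⇒↭)
open import Data.List.Relation.Binary.Permutation.Propositional.Properties using (↭-length)
open import Data.List.Relation.Unary.All as All using (All; []; _∷_)
import Data.List.Relation.Unary.All.Properties as All
open import Data.List.Relation.Unary.AllPairs as AllPairs using (AllPairs; []; _∷_)
import Data.List.Relation.Unary.AllPairs.Properties as AllPairs
open import Data.List.Relation.Unary.Any as Any using (Any; here; there)
import Data.List.Relation.Unary.Any.Properties as Any
open import Data.List.Relation.Unary.Unique.Propositional using (Unique)
import Data.List.Relation.Unary.Unique.Propositional.Properties as Unique
open import Data.Nat.Divisibility using (_∣_; divides; _∣?_; ∣-antisym; ∣⇒≤; m%n≡0⇒n∣m; ∣-trans; ∣-refl; ∣m+n∣m⇒∣n)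
open import Data.Nat.DivMod using (_%_; _/_; m≡m%n+[m/n]*n; m%n<n)
open import Data.Nat.GeneralisedArithmetic using (fold; fold-+)
open import Data.Nat.Induction using (<-rec)
import Data.Vec.Base as Vec
import Data.Vec.Properties as Vec
open import Function.Bundles using (mk⇔; Inverse)
open import Relation.Binary.Definitions using (DecidableEquality) renaming (Decidable to Decidable₂)
open import Relation.Nullary.Decidable using (¬?; _×-dec_; _→-dec_; dec-true; dec-false)
open import Relation.Unary using (Decidable)
import Data.Fin.Subset as Subset
open import Data.List.Relation.Unary.Linked using ([]; [-]; _∷_)
open import Relation.Nullary.Decidable using (map′)
import Algebra.Properties.CommutativeSemiring.Exp as CommutativeSemiringExp
open import Data.Nat.Divisibility using (∣m+n∣m⇒∣n; ∣m∣n⇒∣m+n; >⇒∤; *-monoʳ-∣; *-cancelˡ-∣)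

-- Formal power series and logarithmic derivatives

-- Underneath lies det Δ det(1 + uJ) = det(1 - u²L) det(1 - uB), with ζ = 1 / det(1 - uB).
-- Logarithmic derivatives replace the multiplicativity of determinants, and the evaluation of det(1
-- + uJ) and det(1 - u²L), by cyclicity of the trace and counting; the price is that factors n must
-- be cancelled from coefficients. Counting also copes with J and L being arbitrary maps: a point
-- outside Z is fixed by no iterate with n ≥ 1, so only the cycles contribute. A k-cycle contributes
-- 1 - (-u)ᵏ to det(1 + uJ) and 1 - u²ᵏ to det(1 - u²L). So for every k, as for k = 1, the sign
-- (-1)ᵏ belongs to the factor of J and none to that of L. This is the form proved here; for odd k >
-- 1 its signs differ from those of the displayed English formula.

module SumProperties {c ℓ} (S : Semiring c ℓ) where
  open Semiring S hiding (zero)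
  open SemiringSum S
  open SemiringMult S using () renaming (_×_ to _·_)
  open SetoidReasoning setoid

  sum-zero : ∀ {n} (h : Fin n → Carrier) → (∀ i → h i ≈ 0#) → sum h ≈ 0#
  sum-zero {n} h h≈0 = trans (sum-cong-≋ h≈0) (sum-replicate-zero n)

  sum-truncate : ∀ (h : ℕ → Carrier) m d → (∀ k → m ≤ k → h k ≈ 0#) →
                 sum {m ℕ.+ d} (h ∘ toℕ) ≈ sum {m} (h ∘ toℕ)
  sum-truncate h zero    d h≈0 = sum-zero {d} _ (λ i → h≈0 _ z≤n)
  sum-truncate h (suc m) d h≈0 =
    +-congˡ (sum-truncate (h ∘ suc) m d (λ k m≤k → h≈0 _ (s≤s m≤k)))

  sum-truncate-≤ : ∀ (h : ℕ → Carrier) {m n} → m ≤ n → (∀ k → m ≤ k → h k ≈ 0#) →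
                   sum {n} (h ∘ toℕ) ≈ sum {m} (h ∘ toℕ)
  sum-truncate-≤ h {m} {n} m≤n h≈0 =
    ≡.subst (λ k → sum {k} (h ∘ toℕ) ≈ sum {m} (h ∘ toℕ)) (ℕ.m+[n∸m]≡n m≤n)
      (sum-truncate h m (n ∸ m) h≈0)

  sum-single : ∀ {n} (r : Fin n) (h : Fin n → Carrier) → (∀ i → i ≢ r → h i ≈ 0#) → sum h ≈ h r
  sum-single {suc n} zero    h h≈0 =
    trans (+-congˡ (sum-zero (h ∘ suc) (λ i → h≈0 (suc i) λ ()))) (+-identityʳ _)
  sum-single {suc n} (suc r) h h≈0 = trans (+-cong (h≈0 zero λ ())
    (sum-single r (h ∘ suc) (λ i i≢r → h≈0 (suc i) (i≢r ∘ Fin.suc-injective)))) (+-identityˡ _)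

  ·-zero : ∀ n {x} → x ≈ 0# → n · x ≈ 0#
  ·-zero zero    x≈0 = refl
  ·-zero (suc n) x≈0 = trans (+-cong x≈0 (·-zero n x≈0)) (+-identityˡ 0#)

  ·-distrib-+ : ∀ n x y → n · (x + y) ≈ n · x + n · y
  ·-distrib-+ n x y = CommutativeMonoidMult.×-distrib-+ +-commutativeMonoid x y n

  ·-distrib-sum : ∀ n {m} (h : Fin m → Carrier) → n · sum h ≈ sum (λ i → n · h i)
  ·-distrib-sum n {zero}  h = ·-zero n refl
  ·-distrib-sum n {suc m} h =
    trans (·-distrib-+ n _ _) (+-congˡ (·-distrib-sum n (h ∘ suc)))

-- Abstract, so that determinants and matrices can be differentiated over an arbitrary commutative
-- ring; coefficients of series enter only through `θ-derivation`.
record Derivation {c ℓ} (S : CommutativeRing c ℓ) : Set (c ⊔ ℓ) where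
  open CommutativeRing S
  open RingProperties ring using (+-identityˡ-unique; +-inverseʳ-unique)
  open CommutativeSemigroupProperties *-commutativeSemigroup using (x∙yz≈y∙xz)
  open SetoidReasoning setoid
  field
    θ      : Carrier → Carrier
    θ-cong : ∀ {f g} → f ≈ g → θ f ≈ θ g
    θ-+    : ∀ f g → θ (f + g) ≈ θ f + θ g
    θ-*    : ∀ f g → θ (f * g) ≈ θ f * g + f * θ g

  θ-0 : θ 0# ≈ 0#
  θ-0 = +-identityˡ-unique _ _ (trans (sym (θ-+ 0# 0#)) (θ-cong (+-identityʳ 0#)))

  θ-1 : θ 1# ≈ 0#
  θ-1 = +-identityˡ-unique _ _ (trans (sym (+-cong (*-identityʳ _) (*-identityˡ _)))
    (trans (sym (θ-* 1# 1#)) (θ-cong (*-identityʳ 1#))))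

  θ-neg : ∀ f → θ (- f) ≈ - θ f
  θ-neg f = +-inverseʳ-unique _ _ (trans (sym (θ-+ f (- f))) (trans (θ-cong (-‿inverseʳ f)) θ-0))

  θ-sum : ∀ {n} (h : Fin n → Carrier) → θ (SemiringSum.sum semiring h) ≈ SemiringSum.sum semiring (θ ∘ h)
  θ-sum {zero}  h = θ-0
  θ-sum {suc n} h = trans (θ-+ _ _) (+-congˡ (θ-sum (h ∘ suc)))

  -- Logarithmic derivatives appear as equations θ f = a f, so that no quotient θ f / f has to be
  -- formed.
  logDeriv-*-≈ : ∀ {f g a b} → θ f ≈ a * f → θ g ≈ b * g → θ (f * g) ≈ (a + b) * (f * g)
  logDeriv-*-≈ {f} {g} {a} {b} θf θg = begin
    θ (f * g)                 ≈⟨ θ-* f g ⟩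
    θ f * g + f * θ g         ≈⟨ +-cong (*-congʳ θf) (*-congˡ θg) ⟩
    a * f * g + f * (b * g)   ≈⟨ +-cong (*-assoc a f g) (x∙yz≈y∙xz f b g) ⟩
    a * (f * g) + b * (f * g) ≈⟨ distribʳ (f * g) a b ⟨
    (a + b) * (f * g)         ∎

  logDeriv-inverse-≈ : ∀ {f g a} → f * g ≈ 1# → θ f ≈ a * f → θ g ≈ - a * g
  logDeriv-inverse-≈ {f} {g} {a} fg≈1 θf = begin
    θ g            ≈⟨ *-identityˡ (θ g) ⟨
    1# * θ g       ≈⟨ *-congʳ (trans (*-comm g f) fg≈1) ⟨
    g * f * θ g    ≈⟨ *-assoc g f (θ g) ⟩
    g * (f * θ g)  ≈⟨ *-congˡ (+-inverseʳ-unique a (f * θ g) (trans (+-congʳ (sym θf*g)) θfg)) ⟩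
    g * - a        ≈⟨ *-comm g (- a) ⟩
    - a * g        ∎
    where
    θfg : θ f * g + f * θ g ≈ 0#
    θfg = trans (sym (θ-* f g)) (trans (θ-cong fg≈1) θ-1)
    θf*g : θ f * g ≈ a
    θf*g = trans (*-congʳ θf) (trans (*-assoc a f g) (trans (*-congˡ fg≈1) (*-identityʳ a)))

module InverseByUnrolling {c ℓ} (S : CommutativeRing c ℓ) where
  open CommutativeRing S
  open SetoidReasoning setoid

  -- The hypothesis is the equation that the geometric series Σ (1 - f)ᵏ satisfies once its first
  -- term is split off; f g = 1 is the same equation rearranged.
  inverseʳ-by-unrolling : ∀ f g → g ≈ 1# + (1# - f) * g → f * g ≈ 1#
  inverseʳ-by-unrolling f g unroll = begin
    f * g                              ≈⟨ cancel (f * g) (h * g) ⟨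
    f * g + h * g - h * g              ≈⟨ +-congʳ (distribʳ g f h) ⟨
    (f + h) * g - h * g                ≈⟨ +-congʳ (*-congʳ f+h≈1) ⟩
    1# * g - h * g                     ≈⟨ +-congʳ (trans (*-identityˡ g) unroll) ⟩
    1# + h * g - h * g                 ≈⟨ cancel 1# (h * g) ⟩
    1#                                 ∎
    where
    h = 1# - f
    cancel : ∀ x y → x + y - y ≈ x
    cancel x y = trans (+-assoc x y (- y)) (trans (+-congˡ (-‿inverseʳ y)) (+-identityʳ x))
    f+h≈1 : f + h ≈ 1#
    f+h≈1 = trans (+-comm f h) (trans (+-assoc 1# (- f) f) (trans (+-congˡ (-‿inverseˡ f)) (+-identityʳ 1#)))

-- The ring of formal power series and its derivation

module SeriesRing {c ℓ} (R : CommutativeRing c ℓ) where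
  open CommutativeRing R hiding (zero)
  open SemiringSum semiring
  open SumProperties semiring
  open SemiringMult semiring using (×-homo-+; ×-assoc-*; ×-comm-*; ×-congʳ) renaming (_×_ to _·_)
  open CommutativeSemigroupProperties +-commutativeSemigroup using (x∙yz≈y∙xz)
  open SetoidReasoning setoid
  open RawRing (PowerSeries rawRing) using () renaming
    (Carrier to Series; _≈_ to _≋_; _+_ to _⊕_; _*_ to _⊛_; -_ to ⊖_; 0# to 𝟘; 1# to 𝟙)

  -- The coefficient (f ⊛ g)ₙ₊₁ unfolds definitionally to f₀ gₙ₊₁ + (tail f ⊛ g)ₙ. Commutativity and
  -- associativity are proved by induction on the degree through this recursion.
  tail : Series → Series
  tail f n = f (suc n)

  scale : Carrier → Series → Series
  scale a f n = a * f n

  ⊛-cong : ∀ {f f′ g g′} → f ≋ f′ → g ≋ g′ → (f ⊛ g) ≋ (f′ ⊛ g′)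
  ⊛-cong {f} {f′} {g} {g′} f≋f′ g≋g′ n = sum-cong-≋ {suc n}
    (λ i → *-cong {f (toℕ i)} {f′ (toℕ i)} {g (n ∸ toℕ i)} {g′ (n ∸ toℕ i)} (f≋f′ (toℕ i)) (g≋g′ (n ∸ toℕ i)))

  ⊛-distribʳ : ∀ h f g → ((f ⊕ g) ⊛ h) ≋ ((f ⊛ h) ⊕ (g ⊛ h))
  ⊛-distribʳ h f g n =
    trans (sum-cong-≋ {suc n} (λ i → distribʳ (h (n ∸ toℕ i)) (f (toℕ i)) (g (toℕ i))))
      (∑-distrib-+ {suc n} (λ i → f (toℕ i) * h (n ∸ toℕ i)) (λ i → g (toℕ i) * h (n ∸ toℕ i)))

  ⊛-scale : ∀ a f g → (scale a f ⊛ g) ≋ scale a (f ⊛ g)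
  ⊛-scale a f g n = trans (sum-cong-≋ {suc n} (λ i → *-assoc a (f (toℕ i)) (g (n ∸ toℕ i))))
    (sym (*-distribˡ-sum {suc n} a (λ i → f (toℕ i) * g (n ∸ toℕ i))))

  -- The mirror image of the definitional recursion, splitting off the constant coefficient of the
  -- right factor; commutativity compares the two.
  ⊛-tailʳ : ∀ f g n → (f ⊛ g) (suc n) ≈ f (suc n) * g 0 + (f ⊛ tail g) n
  ⊛-tailʳ f g zero    = x∙yz≈y∙xz _ _ _
  ⊛-tailʳ f g (suc n) = trans (+-congˡ (⊛-tailʳ (tail f) g n)) (x∙yz≈y∙xz _ _ _)

  ⊛-comm : ∀ f g → (f ⊛ g) ≋ (g ⊛ f)
  ⊛-comm f g zero    = +-congʳ (*-comm _ _)
  ⊛-comm f g (suc n) =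
    trans (+-cong (*-comm _ _) (⊛-comm (tail f) g n)) (sym (⊛-tailʳ g f n))

  ⊛-assoc : ∀ f g h → ((f ⊛ g) ⊛ h) ≋ (f ⊛ (g ⊛ h))
  ⊛-assoc f g h zero    = +-congʳ (begin
    (f 0 * g 0 + 0#) * h 0  ≈⟨ *-congʳ (+-identityʳ _) ⟩
    f 0 * g 0 * h 0         ≈⟨ *-assoc _ _ _ ⟩
    f 0 * (g 0 * h 0)       ≈⟨ *-congˡ (+-identityʳ _) ⟨
    f 0 * (g 0 * h 0 + 0#)  ∎)
  ⊛-assoc f g h (suc n) = begin
    (f 0 * g 0 + 0#) * h (suc n) + ((scale (f 0) (tail g) ⊕ (tail f ⊛ g)) ⊛ h) n
      ≈⟨ +-cong (trans (*-congʳ (+-identityʳ _)) (*-assoc _ _ _))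
          (trans (⊛-distribʳ h (scale (f 0) (tail g)) (tail f ⊛ g) n)
            (+-cong (⊛-scale (f 0) (tail g) h n) (⊛-assoc (tail f) g h n))) ⟩
    f 0 * (g 0 * h (suc n)) + (f 0 * (tail g ⊛ h) n + (tail f ⊛ (g ⊛ h)) n)
      ≈⟨ +-assoc _ _ _ ⟨
    f 0 * (g 0 * h (suc n)) + f 0 * (tail g ⊛ h) n + (tail f ⊛ (g ⊛ h)) n
      ≈⟨ +-congʳ (distribˡ _ _ _) ⟨
    f 0 * (g 0 * h (suc n) + (tail g ⊛ h) n) + (tail f ⊛ (g ⊛ h)) n ∎

  ⊛-suc-0 : ∀ f g → f 0 ≈ 0# → ∀ n → (f ⊛ g) (suc n) ≈ (tail f ⊛ g) n
  ⊛-suc-0 f g f₀≈0 n = trans (+-congʳ (trans (*-congʳ f₀≈0) (zeroˡ _))) (+-identityˡ _)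

  ⊛-zeroˡ : ∀ f → (𝟘 ⊛ f) ≋ 𝟘
  ⊛-zeroˡ f n = sum-zero {suc n} (λ i → 0# * f (n ∸ toℕ i)) (λ i → zeroˡ (f (n ∸ toℕ i)))

  ⊛-identityˡ : ∀ f → (𝟙 ⊛ f) ≋ f
  ⊛-identityˡ f zero    = trans (+-identityʳ _) (*-identityˡ _)
  ⊛-identityˡ f (suc n) = trans (+-cong (*-identityˡ _) (⊛-zeroˡ f n)) (+-identityʳ _)

  seriesRing : CommutativeRing c ℓ
  seriesRing = record
    { Carrier = Series ; _≈_ = _≋_ ; _+_ = _⊕_ ; _*_ = _⊛_ ; -_ = ⊖_ ; 0# = 𝟘 ; 1# = 𝟙
    ; isCommutativeRing = record
      { isRing = record
        { +-isAbelianGroup = record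
          { isGroup = record
            { isMonoid = record
              { isSemigroup = record
                { isMagma = record
                  { isEquivalence = record
                    { refl  = λ n → refl
                    ; sym   = λ p n → sym (p n)
                    ; trans = λ p q n → trans (p n) (q n) }
                  ; ∙-cong = λ p q n → +-cong (p n) (q n) }
                ; assoc = λ f g h n → +-assoc _ _ _ }
              ; identity = (λ f n → +-identityˡ _) , (λ f n → +-identityʳ _) }
            ; inverse = (λ f n → -‿inverseˡ _) , (λ f n → -‿inverseʳ _)
            ; ⁻¹-cong = λ p n → -‿cong (p n) }
          ; comm = λ f g n → +-comm _ _ }
        ; *-cong = ⊛-cong
        ; *-assoc = ⊛-assoc
        ; *-identity = ⊛-identityˡ , λ f n → trans (⊛-comm f 𝟙 n) (⊛-identityˡ f n)
        ; distrib = (λ h f g n → trans (⊛-comm h (f ⊕ g) n)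
                        (trans (⊛-distribʳ h f g n) (+-cong (⊛-comm f h n) (⊛-comm g h n))))
                  , ⊛-distribʳ }
      ; *-comm = ⊛-comm } }

  -- The operator u d/du rather than d/du: degrees are not shifted, and uᵏ is an eigenvector with
  -- eigenvalue k.
  θ : Series → Series
  θ f n = n · f n

  θ-cong : ∀ {f g} → f ≋ g → θ f ≋ θ g
  θ-cong f≋g n = ×-congʳ n (f≋g n)

  θ-+ : ∀ f g → θ (f ⊕ g) ≋ (θ f ⊕ θ g)
  θ-+ f g n = ·-distrib-+ n _ _

  θ-* : ∀ f g → θ (f ⊛ g) ≋ ((θ f ⊛ g) ⊕ (f ⊛ θ g))
  θ-* f g n = begin
    n · sum {suc n} (λ i → f (toℕ i) * g (n ∸ toℕ i))
      ≈⟨ ·-distrib-sum n {suc n} (λ i → f (toℕ i) * g (n ∸ toℕ i)) ⟩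
    sum {suc n} (λ i → n · (f (toℕ i) * g (n ∸ toℕ i)))
      ≈⟨ sum-cong-≋ {suc n} leibniz ⟩
    sum {suc n} (λ i → θ f (toℕ i) * g (n ∸ toℕ i) + f (toℕ i) * θ g (n ∸ toℕ i))
      ≈⟨ ∑-distrib-+ {suc n} (λ i → θ f (toℕ i) * g (n ∸ toℕ i)) (λ i → f (toℕ i) * θ g (n ∸ toℕ i)) ⟩
    (θ f ⊛ g) n + (f ⊛ θ g) n ∎
    where
    leibniz : ∀ (i : Fin (suc n)) → n · (f (toℕ i) * g (n ∸ toℕ i))
              ≈ θ f (toℕ i) * g (n ∸ toℕ i) + f (toℕ i) * θ g (n ∸ toℕ i)
    leibniz i = begin
      -- The factor n is the sum of the degrees k and l of the two coefficients, one part for each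
      -- term of the Leibniz rule.
      n · (f k * g l)                    ≡⟨ ≡.cong (_· (f k * g l)) (ℕ.m+[n∸m]≡n (Fin.toℕ≤pred[n] i)) ⟨
      (k ℕ.+ l) · (f k * g l)            ≈⟨ ×-homo-+ _ k l ⟩
      k · (f k * g l) + l · (f k * g l)  ≈⟨ +-cong (×-assoc-* k _ _) (×-comm-* l _ _) ⟨
      k · f k * g l + f k * (l · g l)    ∎
      where
      k = toℕ i
      l = n ∸ toℕ i

  θ-derivation : Derivation seriesRing
  θ-derivation = record { θ = θ ; θ-cong = θ-cong ; θ-+ = θ-+ ; θ-* = θ-* }

  infix 4 _≋[_]_
  -- Congruence modulo uⁿ⁺¹.
  _≋[_]_ : Series → ℕ → Series → Set ℓ
  f ≋[ n ] g = ∀ {i} → i ≤ n → f i ≈ g i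

  ⊛-cong-≤ : ∀ {n f f′ g g′} → f ≋[ n ] f′ → g ≋[ n ] g′ → f ⊛ g ≋[ n ] f′ ⊛ g′
  ⊛-cong-≤ {n} {f} {f′} {g} {g′} f≋f′ g≋g′ {i} i≤n = sum-cong-≋ {suc i}
    (λ j → *-cong {f (toℕ j)} {f′ (toℕ j)} {g (i ∸ toℕ j)} {g′ (i ∸ toℕ j)}
    (f≋f′ (ℕ.≤-trans (Fin.toℕ≤pred[n] j) i≤n)) (g≋g′ (ℕ.≤-trans (ℕ.m∸n≤m i (toℕ j)) i≤n)))

module SeriesInverse {c ℓ} (R : CommutativeRing c ℓ) where
  private module K = CommutativeRing R
  open SeriesRing R
  open Series K.rawRing
  private
    module KS = SumProperties K.semiring
    module KΣ = SemiringSum K.semiring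
  open SetoidReasoning K.setoid

  sum-coeff : ∀ {m} (h : Fin m → Carrier) n → sum h n ≡ KΣ.sum (λ i → h i n)
  sum-coeff {zero}  h n = ≡.refl
  sum-coeff {suc m} h n = ≡.cong (h zero n K.+_) (sum-coeff (h ∘ suc) n)

  ^-low : ∀ {g} → g 0 K.≈ K.0# → ∀ k {j} → j < k → (g ^ k) j K.≈ K.0#
  ^-low {g} g₀≈0 (suc k) {j} (s≤s j≤k) = KS.sum-zero {suc j} _ term
    where
    term : ∀ (i : Fin (suc j)) → g (toℕ i) K.* (g ^ k) (j ∸ toℕ i) K.≈ K.0#
    term zero    = K.trans (K.*-congʳ g₀≈0) (K.zeroˡ _)
    term (suc i) = K.trans (K.*-congˡ (^-low g₀≈0 k
      (ℕ.<-≤-trans (ℕ.∸-monoʳ-< {j} ℕ.z<s (Fin.toℕ<n i)) j≤k))) (K.zeroʳ _)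

  -- The term k = 0 of the geometric series is 1 and all others contain the factor g = 1 - f. After
  -- interchanging the sum over k with that of the product, each inner sum runs past the degree at
  -- which the coefficient of f⁻¹ stops; `^-low` removes the excess.
  ⁻¹-unroll : ∀ {f} → f 0 K.≈ K.1# → f ⁻¹ ≈ 1# + (1# - f) * f ⁻¹
  ⁻¹-unroll {f} f₀≈1 zero    = K.+-congˡ (K.sym (K.trans (K.+-identityʳ _)
    (K.trans (K.*-congʳ g₀≈0) (K.zeroˡ _))))
    where g₀≈0 = K.trans (K.+-congʳ (K.sym f₀≈1)) (K.-‿inverseʳ _)
  ⁻¹-unroll {f} f₀≈1 (suc n) = K.+-congˡ (begin
    KΣ.sum {suc n} (λ k → (g * g ^ toℕ k) (suc n))
      ≈⟨ KΣ.sum-cong-≋ {suc n} (λ k → ⊛-suc-0 g (g ^ toℕ k) g₀≈0 n) ⟩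
    KΣ.sum {suc n} (λ k → KΣ.sum {suc n} (λ i → g (suc (toℕ i)) K.* (g ^ toℕ k) (n ∸ toℕ i)))
      ≈⟨ KΣ.∑-comm {suc n} {suc n} (λ k i → g (suc (toℕ i)) K.* (g ^ toℕ k) (n ∸ toℕ i)) ⟩
    KΣ.sum {suc n} (λ i → KΣ.sum {suc n} (λ k → g (suc (toℕ i)) K.* (g ^ toℕ k) (n ∸ toℕ i)))
      ≈⟨ KΣ.sum-cong-≋ {suc n} truncated ⟩
    KΣ.sum {suc n} (λ i → g (suc (toℕ i)) K.* (f ⁻¹) (n ∸ toℕ i))
      ≈⟨ ⊛-suc-0 g (f ⁻¹) g₀≈0 n ⟨
    (g * f ⁻¹) (suc n) ∎)
    where
    g = 1# - f
    g₀≈0 : g 0 K.≈ K.0#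
    g₀≈0 = K.trans (K.+-congʳ (K.sym f₀≈1)) (K.-‿inverseʳ _)
    truncated : ∀ (i : Fin (suc n)) → KΣ.sum {suc n} (λ k → g (suc (toℕ i)) K.* (g ^ toℕ k) (n ∸ toℕ i))
                K.≈ g (suc (toℕ i)) K.* (f ⁻¹) (n ∸ toℕ i)
    truncated i = begin
      KΣ.sum {suc n} (λ k → g (suc (toℕ i)) K.* (g ^ toℕ k) l)
        ≈⟨ KΣ.*-distribˡ-sum {suc n} (g (suc (toℕ i))) (λ k → (g ^ toℕ k) l) ⟨
      g (suc (toℕ i)) K.* KΣ.sum {suc n} (λ k → (g ^ toℕ k) l)
        ≈⟨ K.*-congˡ (KS.sum-truncate-≤ (λ k → (g ^ k) l) (s≤s (ℕ.m∸n≤m n (toℕ i))) (λ k → ^-low {g} g₀≈0 k)) ⟩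
      g (suc (toℕ i)) K.* (f ⁻¹) l ∎
      where l = n ∸ toℕ i

-- Logarithmic derivatives: uniqueness and infinite products

module LogDerivative {c ℓ} (R : CommutativeRing c ℓ) where
  private module K = CommutativeRing R
  open SeriesRing R
  open SeriesInverse R
  private module S = CommutativeRing seriesRing
  open Series K.rawRing
  private
    module KS = SumProperties K.semiring
    module KΣ = SemiringSum K.semiring
    module KP = RingProperties K.ring
    module KM = SemiringMult K.semiring
  private module D = Derivation θ-derivation

  ⁻¹-inverseʳ : ∀ {f} → f 0 K.≈ K.1# → f * f ⁻¹ ≈ 1#
  ⁻¹-inverseʳ {f} f₀≈1 =
    InverseByUnrolling.inverseʳ-by-unrolling seriesRing f (f ⁻¹) (⁻¹-unroll f₀≈1)

  -- The constant term 1 accompanies the equation because it makes f invertible and turns θ f = a f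
  -- into a recursion that determines f from a.
  record HasLogDeriv (f a : Carrier) : Set ℓ where
    constructor _,_
    field
      constantTerm : f 0 K.≈ K.1#
      θ≈           : θ f ≈ a * f
  open HasLogDeriv

  logDeriv-cong : ∀ {f g a b} → f ≈ g → a ≈ b → HasLogDeriv f a → HasLogDeriv g b
  logDeriv-cong {f} {g} {a} {b} f≈g a≈b (f₀ , θf) = K.trans (K.sym (f≈g 0)) f₀ ,
    λ n → K.trans (θ-cong (S.sym {f} {g} f≈g) n) (K.trans (θf n) (⊛-cong {a} {b} {f} {g} a≈b f≈g n))

  logDeriv-1 : HasLogDeriv 1# 0#
  logDeriv-1 = K.refl , λ n → K.trans (D.θ-1 n) (K.sym (⊛-zeroˡ 1# n))

  logDeriv-* : ∀ {f g a b} → HasLogDeriv f a → HasLogDeriv g b → HasLogDeriv (f * g) (a + b)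
  logDeriv-* {f} {g} {a} {b} (f₀ , θf) (g₀ , θg) =
    K.trans (K.+-identityʳ _) (K.trans (K.*-cong f₀ g₀) (K.*-identityˡ _)) ,
    D.logDeriv-*-≈ {f} {g} {a} {b} θf θg

  logDeriv-^ : ∀ {f a} n → HasLogDeriv f a → HasLogDeriv (f ^ n) (n ×ₙ a)
  logDeriv-^ zero    h = logDeriv-1
  logDeriv-^ (suc n) h = logDeriv-* h (logDeriv-^ n h)

  logDeriv-⁻¹ : ∀ {f a} → HasLogDeriv f a → HasLogDeriv (f ⁻¹) (- a)
  logDeriv-⁻¹ {f} {a} (f₀ , θf) =
    K.+-identityʳ _ , D.logDeriv-inverse-≈ {f} {f ⁻¹} {a} (⁻¹-inverseʳ f₀) θf

  logDeriv-product : ∀ {m} (F a : Fin m → Carrier) → (∀ i → HasLogDeriv (F i) (a i)) →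
                     HasLogDeriv (product F) (sum a)
  logDeriv-product {zero}  F a h = logDeriv-1
  logDeriv-product {suc m} F a h = logDeriv-* (h zero) (logDeriv-product (F ∘ suc) (a ∘ suc) (h ∘ suc))

  -- n fₙ = a₀ fₙ + Σ_{i≥1} aᵢ fₙ₋ᵢ with a₀ = 0, so n fₙ depends on lower coefficients only.
  logDeriv-unique-≤ : TorsionFree R → ∀ {f g a b} n → a ≋[ n ] b → HasLogDeriv f a → HasLogDeriv g b → f ≋[ n ] g
  logDeriv-unique-≤ torsionFree zero a≋b (f₀ , θf) (g₀ , θg) z≤n = K.trans f₀ (K.sym g₀)
  logDeriv-unique-≤ torsionFree {f} {g} {a} {b} (suc n) a≋b Lf@(f₀ , θf) Lg@(g₀ , θg) {i} i≤1+n
    with ℕ.m≤n⇒m<n∨m≡n i≤1+n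
  ... | inj₁ (s≤s i≤n) = logDeriv-unique-≤ torsionFree n (λ j≤n → a≋b (ℕ.m≤n⇒m≤1+n j≤n)) Lf Lg i≤n
  ... | inj₂ ≡.refl    = cancel (K.trans (θf (suc n)) (K.trans (K.+-cong
      (K.trans (K.*-congʳ (constant≈0 Lf)) (K.trans (K.zeroˡ _) (K.sym (K.trans (K.*-congʳ (constant≈0 Lg)) (K.zeroˡ _)))))
      (KΣ.sum-cong-≋ {suc n} (λ i → K.*-cong {a (suc (toℕ i))} {b (suc (toℕ i))} (a≋b (s≤s (Fin.toℕ≤pred[n] i)))
        (f≋g (ℕ.m∸n≤m n (toℕ i))))))
      (K.sym (θg (suc n)))))
    where
    f≋g : f ≋[ n ] g
    f≋g = logDeriv-unique-≤ torsionFree n (λ j≤n → a≋b (ℕ.m≤n⇒m≤1+n j≤n)) Lf Lg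

    constant≈0 : ∀ {f a} → HasLogDeriv f a → a 0 K.≈ K.0#
    constant≈0 (f₀ , θf) =
      K.trans (K.sym (K.trans (K.+-identityʳ _) (K.trans (K.*-congˡ f₀) (K.*-identityʳ _)))) (K.sym (θf 0))

    cancel : ∀ {x y} → suc n KM.× x K.≈ suc n KM.× y → x K.≈ y
    cancel {x} {y} eq = KP.x∙y⁻¹≈ε⇒x≈y x y (torsionFree n _ (K.trans (KS.·-distrib-+ (suc n) x (K.- y))
      (K.trans (K.+-congʳ eq) (K.trans (K.sym (KS.·-distrib-+ (suc n) y (K.- y)))
        (KS.·-zero (suc n) (K.-‿inverseʳ y))))))

  logDeriv-unique : TorsionFree R → ∀ {f g a b} → a ≈ b → HasLogDeriv f a → HasLogDeriv g b → f ≈ g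
  logDeriv-unique torsionFree a≈b Lf Lg n = logDeriv-unique-≤ torsionFree n (λ {j} _ → a≈b j) Lf Lg ℕ.≤-refl

  product-≋1 : ∀ {m n} (F : Fin m → Carrier) → (∀ i → F i ≋[ n ] 1#) → product F ≋[ n ] 1#
  product-≋1 {zero}  F h i≤n = K.refl
  product-≋1 {suc m} F h {i} i≤n = K.trans
    (⊛-cong-≤ {f = F zero} {g = product (F ∘ suc)} (h zero) (product-≋1 (F ∘ suc) (h ∘ suc)) i≤n) (⊛-identityˡ 1# i)

  product-truncate : ∀ n (F : ℕ → Carrier) m d → (∀ k → m ≤ k → F k ≋[ n ] 1#) →
                     product {m ℕ.+ d} (F ∘ toℕ) ≋[ n ] product {m} (F ∘ toℕ)
  product-truncate n F zero    d h = product-≋1 {d} (F ∘ toℕ) (λ i → h _ z≤n)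
  product-truncate n F (suc m) d h = ⊛-cong-≤ {f = F 0} (λ _ → K.refl)
    (product-truncate n (F ∘ suc) m d (λ k m≤k → h _ (s≤s m≤k)))

  -- Each coefficient of `∏≥` is taken from a different finite product. Up to degree n all of them
  -- can be replaced by the one with n + 1 factors, to which the product rule applies.
  ∏≥-coeff : ∀ m F → (∀ k {j} → j < k → F k j K.≈ 1# j) → 0 < m →
             ∀ n → ∏≥ m F ≋[ n ] product {suc n} (λ i → F (m ℕ.+ toℕ i))
  ∏≥-coeff m F low 0<m n {j} j≤n = K.sym (≡.subst
    (λ k → product {suc k} (λ i → F (m ℕ.+ toℕ i)) j K.≈ ∏≥ m F j) (ℕ.m+[n∸m]≡n j≤n)
    (product-truncate j (λ k → F (m ℕ.+ k)) (suc j) (n ∸ j)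
      (λ k j<k {i} i≤j → low (m ℕ.+ k) (ℕ.≤-<-trans i≤j (ℕ.<-≤-trans j<k (ℕ.m≤n+m k m))))
      ℕ.≤-refl))

  -- Smallness is required of the logarithmic derivatives only: if a k vanishes below degree k, then
  -- F k and 1 have equal logarithmic derivatives there, and uniqueness gives F k ≡ 1 modulo uᵏ.
  logDeriv-∏≥ : TorsionFree R → ∀ m (F a : ℕ → Carrier) → 0 < m →
    (∀ k {j} → j < k → a k j K.≈ K.0#) → (∀ k → 0 < k → HasLogDeriv (F k) (a k)) →
    HasLogDeriv (∏≥ m F) (λ n → KΣ.sum {suc n} (λ i → a (m ℕ.+ toℕ i) n))
  logDeriv-∏≥ torsionFree m F a 0<m lowa h = constantTerm (partial 0) , λ n → K.trans (θ≈ (partial n) n)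
    (⊛-cong-≤ {f = sum {suc n} (λ i → a (m ℕ.+ toℕ i))} (coeffs n) (λ j≤n → K.sym (∏≥-coeff m F lowF 0<m n j≤n)) ℕ.≤-refl)
    where
    lowF : ∀ k {j} → j < k → F k j K.≈ 1# j
    lowF (suc k) {j} (s≤s j≤k) = logDeriv-unique-≤ torsionFree k (λ j≤k → lowa (suc k) (s≤s j≤k))
      (h (suc k) ℕ.z<s) logDeriv-1 j≤k
    partial : ∀ n → HasLogDeriv (product {suc n} (λ i → F (m ℕ.+ toℕ i))) (sum {suc n} (λ i → a (m ℕ.+ toℕ i)))
    partial n = logDeriv-product {suc n} (λ i → F (m ℕ.+ toℕ i)) (λ i → a (m ℕ.+ toℕ i))
      (λ i → h (m ℕ.+ toℕ i) (ℕ.<-≤-trans 0<m (ℕ.m≤m+n m _)))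
    coeffs : ∀ n → sum {suc n} (λ i → a (m ℕ.+ toℕ i)) ≋[ n ] (λ n → KΣ.sum {suc n} (λ i → a (m ℕ.+ toℕ i) n))
    coeffs n {j} j≤n = K.trans (K.reflexive (sum-coeff {suc n} (λ i → a (m ℕ.+ toℕ i)) j))
      (KS.sum-truncate-≤ (λ i → a (m ℕ.+ i) j) (s≤s j≤n)
        (λ k j<k → lowa (m ℕ.+ k) (ℕ.<-≤-trans j<k (ℕ.m≤n+m k m))))

-- Determinants

module Determinant {c ℓ} (S : CommutativeRing c ℓ) where
  open CommutativeRing S hiding (zero)
  open RingOps rawRing using (det; _^_)
  open SemiringSum semiring using (sum; sum-cong-≋; ∑-distrib-+; ∑-comm; *-distribˡ-sum; *-distribʳ-sum)
  open SumProperties semiring using (sum-zero; sum-single)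
  open RingProperties ring using (-1*x≈-x; -0#≈0#)
  open RingSolver commutativeSemiring
  open SetoidReasoning setoid

  sgn : ∀ {n} → Fin n → Carrier
  sgn i = (- 1#) ^ toℕ i

  minor : ∀ {n} → (Fin (suc n) → Fin (suc n) → Carrier) → Fin (suc n) → Fin n → Fin n → Carrier
  minor M j i k = M (suc i) (punchIn j k)

  det-cong : ∀ {n} {M N : Fin n → Fin n → Carrier} → (∀ i j → M i j ≈ N i j) → det M ≈ det N
  det-cong {zero}  M≈N = refl
  det-cong {suc n} M≈N = sum-cong-≋ {suc n} λ j →
    *-cong (*-congˡ {sgn j} (M≈N zero j)) (det-cong λ i k → M≈N (suc i) (punchIn j k))

  replaceRow : ∀ {m n} → Fin m → (Fin n → Carrier) → (Fin m → Fin n → Carrier) → Fin m → Fin n → Carrier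
  replaceRow zero    v M zero    = v
  replaceRow zero    v M (suc i) = M (suc i)
  replaceRow (suc r) v M zero    = M zero
  replaceRow (suc r) v M (suc i) = replaceRow r v (M ∘ suc) i

  replaceRow-columns : ∀ {m n p} (col : Fin p → Fin n) r v (M : Fin m → Fin n → Carrier) i k →
    replaceRow r v M i (col k) ≡ replaceRow r (v ∘ col) (λ i k → M i (col k)) i k
  replaceRow-columns col zero    v M zero    k = ≡.refl
  replaceRow-columns col zero    v M (suc i) k = ≡.refl
  replaceRow-columns col (suc r) v M zero    k = ≡.refl
  replaceRow-columns col (suc r) v M (suc i) k = replaceRow-columns col r v (M ∘ suc) i k

  replaceRow-self : ∀ {m n} r (v : Fin n → Carrier) (M : Fin m → Fin n → Carrier) → replaceRow r v M r ≡ v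
  replaceRow-self zero    v M = ≡.refl
  replaceRow-self (suc r) v M = replaceRow-self r v (M ∘ suc)

  replaceRow-other : ∀ {m n} r i (v : Fin n → Carrier) (M : Fin m → Fin n → Carrier) → i ≢ r → replaceRow r v M i ≡ M i
  replaceRow-other zero    zero    v M i≢r = contradiction ≡.refl i≢r
  replaceRow-other zero    (suc i) v M i≢r = ≡.refl
  replaceRow-other (suc r) zero    v M i≢r = ≡.refl
  replaceRow-other (suc r) (suc i) v M i≢r = replaceRow-other r i v (M ∘ suc) (i≢r ∘ ≡.cong suc)

  replaceRow-same : ∀ {m n} r (M : Fin m → Fin n → Carrier) i → replaceRow r (M r) M i ≡ M i
  replaceRow-same zero    M zero    = ≡.refl
  replaceRow-same zero    M (suc i) = ≡.refl
  replaceRow-same (suc r) M zero    = ≡.refl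
  replaceRow-same (suc r) M (suc i) = replaceRow-same r (M ∘ suc) i

  det-replaceRow-suc : ∀ {n} r v (M : Fin (suc n) → Fin (suc n) → Carrier) →
    det (replaceRow (suc r) v M)
      ≈ sum (λ j → sgn j * M zero j * det (replaceRow r (v ∘ punchIn j) (minor M j)))
  det-replaceRow-suc {n} r v M = sum-cong-≋ {suc n} λ j →
    *-congˡ {sgn j * M zero j} (det-cong λ i k → reflexive (replaceRow-columns (punchIn j) r v (M ∘ suc) i k))

  -- Linearity in one row, stated for a combination of several rows because Jacobi's formula
  -- replaces row r by Σ N r k times row k.
  det-replaceRow-linear : ∀ {n p} r (a : Fin p → Carrier) (v : Fin p → Fin n → Carrier) (M : Fin n → Fin n → Carrier) →
    det (replaceRow r (λ j → sum (λ k → a k * v k j)) M) ≈ sum (λ k → a k * det (replaceRow r (v k) M))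
  det-replaceRow-linear {suc n} {p} zero a v M = begin
    sum (λ j → sgn j * sum (λ k → a k * v k j) * D j)
      ≈⟨ sum-cong-≋ (λ j → trans (*-congʳ (*-distribˡ-sum (sgn j) (λ k → a k * v k j)))
           (trans (*-distribʳ-sum (D j) (λ k → sgn j * (a k * v k j))) (sum-cong-≋ λ k →
           solve 4 (λ s a v d → s :* (a :* v) :* d := a :* (s :* v :* d)) refl (sgn j) (a k) (v k j) (D j)))) ⟩
    sum (λ j → sum (λ k → a k * (sgn j * v k j * D j)))
      ≈⟨ ∑-comm (λ j k → a k * (sgn j * v k j * D j)) ⟩
    sum (λ k → sum (λ j → a k * (sgn j * v k j * D j)))
      ≈⟨ sum-cong-≋ (λ k → *-distribˡ-sum (a k) (λ j → sgn j * v k j * D j)) ⟨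
    sum (λ k → a k * sum (λ j → sgn j * v k j * D j)) ∎
    where
    D : Fin (suc n) → Carrier
    D j = det (minor M j)
  det-replaceRow-linear {suc n} {p} (suc r) a v M = begin
    det (replaceRow (suc r) (λ j → sum (λ k → a k * v k j)) M)
      ≈⟨ det-replaceRow-suc r (λ j → sum (λ k → a k * v k j)) M ⟩
    sum (λ j → sgn j * M zero j * det (replaceRow r (λ i → sum (λ k → a k * v k (punchIn j i))) (minor M j)))
      ≈⟨ sum-cong-≋ (λ j → trans (*-congˡ (det-replaceRow-linear r a (λ k → v k ∘ punchIn j) (minor M j)))
           (trans (*-distribˡ-sum _ (λ k → a k * D j k)) (sum-cong-≋ λ k →
           solve 3 (λ m a d → m :* (a :* d) := a :* (m :* d)) refl (sgn j * M zero j) (a k) (D j k)))) ⟩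
    sum (λ j → sum (λ k → a k * (sgn j * M zero j * D j k)))
      ≈⟨ ∑-comm (λ j k → a k * (sgn j * M zero j * D j k)) ⟩
    sum (λ k → sum (λ j → a k * (sgn j * M zero j * D j k)))
      ≈⟨ sum-cong-≋ (λ k → trans (*-congˡ (det-replaceRow-suc r (v k) M))
        (*-distribˡ-sum (a k) (λ j → sgn j * M zero j * D j k))) ⟨
    sum (λ k → a k * det (replaceRow (suc r) (v k) M)) ∎
    where
    D : Fin (suc n) → Fin p → Carrier
    D j k = det (replaceRow r (v k ∘ punchIn j) (minor M j))

  -- (j , k) and (j′ , k′) delete the same two columns in opposite orders.
  Opposite : ∀ {n} → Fin (suc n) → Fin n → Fin (suc n) → Fin n → Set
  Opposite j k j′ k′ = punchIn j k ≡ j′ × punchIn j′ k′ ≡ j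

  -- The pairs (0 , k) and (k+1 , 0) are opposite and cancel; the remaining pairs (j+1 , k+1) form a
  -- smaller instance. Showing instead that the sum is its own negative would not suffice in a ring
  -- where 2 is a zero divisor.
  sum-opposite : ∀ {n} (T : Fin (suc n) → Fin n → Carrier) →
    (∀ j k j′ k′ → Opposite j k j′ k′ → T j k + T j′ k′ ≈ 0#) → sum (λ j → sum (T j)) ≈ 0#
  sum-opposite {zero}  T anti = +-identityʳ 0#
  sum-opposite {suc n} T anti = begin
    sum (T zero) + sum (λ j → T (suc j) zero + sum (T (suc j) ∘ suc))
      ≈⟨ +-congˡ (∑-distrib-+ (λ j → T (suc j) zero) (λ j → sum (T (suc j) ∘ suc))) ⟩
    sum (T zero) + (sum (λ j → T (suc j) zero) + sum (λ j → sum (T (suc j) ∘ suc)))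
      ≈⟨ +-assoc _ _ _ ⟨
    sum (T zero) + sum (λ j → T (suc j) zero) + sum (λ j → sum (T (suc j) ∘ suc))
      ≈⟨ +-cong (∑-distrib-+ (T zero) (λ j → T (suc j) zero)) refl ⟨
    sum (λ k → T zero k + T (suc k) zero) + sum (λ j → sum (T (suc j) ∘ suc))
      ≈⟨ +-cong (sum-zero _ λ k → anti zero k (suc k) zero (≡.refl , ≡.refl))
           (sum-opposite (λ j k → T (suc j) (suc k)) λ j k j′ k′ (e , e′) →
             anti (suc j) (suc k) (suc j′) (suc k′) (≡.cong suc e , ≡.cong suc e′)) ⟩
    0# + 0#  ≈⟨ +-identityʳ 0# ⟩
    0#       ∎

  opposite-punchIn : ∀ {n} (j : Fin (2 ℕ.+ n)) k j′ k′ → Opposite j k j′ k′ →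
    ∀ l → punchIn j (punchIn k l) ≡ punchIn j′ (punchIn k′ l)
  opposite-punchIn zero    k       _ zero     (≡.refl , e′) l = ≡.refl
  opposite-punchIn (suc j) zero    _ k′       (≡.refl , ≡.refl) l = ≡.refl
  opposite-punchIn (suc j) (suc k) _ (suc k′) (≡.refl , e′) zero    = ≡.refl
  opposite-punchIn {suc n} (suc j) (suc k) _ (suc k′) (≡.refl , e′) (suc l) =
    ≡.cong suc (opposite-punchIn j k _ k′ (≡.refl , Fin.suc-injective e′) l)

  -- One of the two orders is (j , k) with j ≤ k and the other is (k+1 , j), so the exponents of -1
  -- differ by one.
  opposite-sgn : ∀ {n} (j : Fin (suc n)) k j′ k′ → Opposite j k j′ k′ → sgn j * sgn k + sgn j′ * sgn k′ ≈ 0#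
  opposite-sgn zero k _ zero (≡.refl , e′) = begin
    1# * sgn k + (- 1# * sgn k) * 1#  ≈⟨ +-cong (*-identityˡ _) (trans (*-identityʳ _) (-1*x≈-x _)) ⟩
    sgn k - sgn k                     ≈⟨ -‿inverseʳ _ ⟩
    0#                                ∎
  opposite-sgn (suc j) zero _ _ (≡.refl , ≡.refl) = begin
    (- 1# * sgn j) * 1# + 1# * sgn j  ≈⟨ +-cong (trans (*-identityʳ _) (-1*x≈-x _)) (*-identityˡ _) ⟩
    - sgn j + sgn j                   ≈⟨ -‿inverseˡ _ ⟩
    0#                                ∎
  opposite-sgn {suc n} (suc j) (suc k) _ (suc k′) (≡.refl , e′) = begin
    (- 1# * sgn j) * (- 1# * sgn k) + (- 1# * sgn (punchIn j k)) * (- 1# * sgn k′)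
      ≈⟨ solve 5 (λ m a b c d → (m :* a) :* (m :* b) :+ (m :* c) :* (m :* d) := (m :* m) :* (a :* b :+ c :* d))
           refl (- 1#) (sgn j) (sgn k) (sgn (punchIn j k)) (sgn k′) ⟩
    (- 1# * - 1#) * (sgn j * sgn k + sgn (punchIn j k) * sgn k′)
      ≈⟨ *-congˡ (opposite-sgn j k _ k′ (≡.refl , Fin.suc-injective e′)) ⟩
    (- 1# * - 1#) * 0#  ≈⟨ zeroʳ _ ⟩
    0#                  ∎

  det-expand₂ : ∀ {n} (M : Fin (2 ℕ.+ n) → Fin (2 ℕ.+ n) → Carrier) →
    det M ≈ sum (λ j → sum (λ k → (sgn j * sgn k) * ((M zero j * M (suc zero) (punchIn j k)) * det (minor (minor M j) k))))
  det-expand₂ M = sum-cong-≋ λ j →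
    trans (*-distribˡ-sum (sgn j * M zero j) (λ k → sgn k * M (suc zero) (punchIn j k) * det (minor (minor M j) k)))
      (sum-cong-≋ λ k →
    solve 5 (λ s t a b d → (s :* a) :* (t :* b :* d) := (s :* t) :* ((a :* b) :* d)) refl
      (sgn j) (sgn k) (M zero j) (M (suc zero) (punchIn j k)) (det (minor (minor M j) k)))

  -- Opposite pairs have the same minor and, B being symmetric, the same coefficient, but opposite
  -- signs. It is applied to the product of the first two rows when they agree, and to the
  -- symmetrised product for the exchange of the two rows.
  sum-symmetric : ∀ {n} (B : Fin (2 ℕ.+ n) → Fin (2 ℕ.+ n) → Carrier) → (∀ x y → B x y ≈ B y x) →
    (M : Fin n → Fin (2 ℕ.+ n) → Carrier) →
    sum (λ j → sum (λ k → (sgn j * sgn k) * (B j (punchIn j k) * det (λ i l → M i (punchIn j (punchIn k l)))))) ≈ 0#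
  sum-symmetric B B-sym M = sum-opposite _ λ j k j′ k′ op → begin
    (sgn j * sgn k) * (B j (punchIn j k) * D j k) + (sgn j′ * sgn k′) * (B j′ (punchIn j′ k′) * D j′ k′)
      ≈⟨ +-congˡ (*-congˡ (*-cong (trans (reflexive (≡.cong₂ B (≡.sym (proj₁ op)) (proj₂ op))) (B-sym _ _))
           (det-cong λ i l → reflexive (≡.cong (M i) (≡.sym (opposite-punchIn j k j′ k′ op l)))))) ⟩
    (sgn j * sgn k) * (B j (punchIn j k) * D j k) + (sgn j′ * sgn k′) * (B j (punchIn j k) * D j k)
      ≈⟨ distribʳ _ _ _ ⟨
    (sgn j * sgn k + sgn j′ * sgn k′) * (B j (punchIn j k) * D j k)
      ≈⟨ *-congʳ (opposite-sgn j k j′ k′ op) ⟩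
    0# * (B j (punchIn j k) * D j k)  ≈⟨ zeroˡ _ ⟩
    0# ∎
    where
    D : ∀ j k → Carrier
    D j k = det (λ i l → M i (punchIn j (punchIn k l)))

  swapRows₀₁ : ∀ {m n} → (Fin (2 ℕ.+ m) → Fin n → Carrier) → Fin (2 ℕ.+ m) → Fin n → Carrier
  swapRows₀₁ M zero          = M (suc zero)
  swapRows₀₁ M (suc zero)    = M zero
  swapRows₀₁ M (suc (suc i)) = M (suc (suc i))

  det-swapRows₀₁ : ∀ {n} (M : Fin (2 ℕ.+ n) → Fin (2 ℕ.+ n) → Carrier) → det M + det (swapRows₀₁ M) ≈ 0#
  det-swapRows₀₁ {n} M = begin
    det M + det (swapRows₀₁ M)
      ≈⟨ +-cong (det-expand₂ M) (det-expand₂ (swapRows₀₁ M)) ⟩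
    sum (λ j → sum (T j)) + sum (λ j → sum (T′ j))
      ≈⟨ ∑-distrib-+ (λ j → sum (T j)) (λ j → sum (T′ j)) ⟨
    sum (λ j → sum (T j) + sum (T′ j))
      ≈⟨ sum-cong-≋ (λ j → trans (sym (∑-distrib-+ (T j) (T′ j))) (sum-cong-≋ λ k →
           solve 4 (λ s b b′ d → s :* (b :* d) :+ s :* (b′ :* d) := s :* ((b :+ b′) :* d)) refl
             (sgn j * sgn k) (M zero j * M (suc zero) (punchIn j k)) (M (suc zero) j * M zero (punchIn j k))
               (det (minor (minor M j) k)))) ⟩
    sum (λ j → sum (λ k → (sgn j * sgn k) * (B j (punchIn j k) * det (minor (minor M j) k))))
      ≈⟨ sum-symmetric B (λ x y → trans (+-comm _ _) (+-cong (*-comm _ _) (*-comm _ _))) (λ i → M (suc (suc i))) ⟩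
    0# ∎
    where
    T T′ : Fin (2 ℕ.+ n) → Fin (1 ℕ.+ n) → Carrier
    T  j k = (sgn j * sgn k) * ((M zero j * M (suc zero) (punchIn j k)) * det (minor (minor M j) k))
    T′ j k = (sgn j * sgn k) * ((M (suc zero) j * M zero (punchIn j k)) * det (minor (minor M j) k))
    B : Fin (2 ℕ.+ n) → Fin (2 ℕ.+ n) → Carrier
    B x y = M zero x * M (suc zero) y + M (suc zero) x * M zero y

  det-zero-minors : ∀ {n} (M : Fin (suc n) → Fin (suc n) → Carrier) → (∀ j → det (minor M j) ≈ 0#) → det M ≈ 0#
  det-zero-minors {n} M D≈0 = sum-zero {suc n} (λ j → sgn j * M zero j * det (minor M j)) λ j →
    trans (*-congˡ {sgn j * M zero j} (D≈0 j)) (zeroʳ (sgn j * M zero j))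

  -- Two equal rows below the first stay equal in every minor of the expansion;
  -- `det-alternating-zero` deals with the case that the first row is one of the two.
  det-alternating : ∀ {n} (M : Fin n → Fin n → Carrier) p q → p ≢ q → (∀ j → M p j ≈ M q j) → det M ≈ 0#
  det-alternating-zero : ∀ {n} (M : Fin (suc n) → Fin (suc n) → Carrier) q → (∀ j → M zero j ≈ M (suc q) j) → det M ≈ 0#

  det-alternating {suc n} M zero    zero    p≢q e = contradiction ≡.refl p≢q
  det-alternating {suc n} M zero    (suc q) p≢q e = det-alternating-zero M q e
  det-alternating {suc n} M (suc p) zero    p≢q e = det-alternating-zero M p (λ j → sym (e j))
  det-alternating {suc n} M (suc p) (suc q) p≢q e = det-zero-minors M λ j →
    det-alternating (minor M j) p q (p≢q ∘ ≡.cong suc) (λ k → e (punchIn j k))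

  det-alternating-zero {suc n} M zero e = trans (det-expand₂ M)
    (sum-symmetric (λ x y → M zero x * M (suc zero) y)
      (λ x y → trans (*-cong (e x) (sym (e y))) (*-comm _ _)) (λ i → M (suc (suc i))))
  -- Exchanging rows 0 and 1 changes only the sign and moves the repeated row below the first, so
  -- that every minor has two equal rows.
  det-alternating-zero {suc n} M (suc q) e = begin
    det M                       ≈⟨ +-identityʳ _ ⟨
    det M + 0#                  ≈⟨ +-congˡ (det-zero-minors (swapRows₀₁ M) λ j →
      det-alternating {suc n} (minor (swapRows₀₁ M) j) zero (suc q) (λ ()) (λ k → e (punchIn j k))) ⟨
    det M + det (swapRows₀₁ M)  ≈⟨ det-swapRows₀₁ M ⟩
    0#                          ∎

  module Jacobi (derivation : Derivation S) where
    open Derivation derivation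

    θ-sgn : ∀ k → θ ((- 1#) ^ k) ≈ 0#
    θ-sgn zero    = θ-1
    θ-sgn (suc k) = begin
      θ (- 1# * (- 1#) ^ k)                       ≈⟨ θ-* _ _ ⟩
      θ (- 1#) * (- 1#) ^ k + - 1# * θ ((- 1#) ^ k)
        ≈⟨ +-cong (*-congʳ (trans (θ-neg 1#) (trans (-‿cong θ-1) -0#≈0#))) (*-congˡ (θ-sgn k)) ⟩
      0# * (- 1#) ^ k + - 1# * 0#                 ≈⟨ +-cong (zeroˡ _) (zeroʳ _) ⟩
      0# + 0#                                     ≈⟨ +-identityʳ 0# ⟩
      0#                                          ∎

    -- In the first-row expansion the signs are constants, the derivative of an entry gives the
    -- summand r = 0, and the derivative of a minor gives, by induction, the rows below.
    θ-det : ∀ {n} (M : Fin n → Fin n → Carrier) → θ (det M) ≈ sum (λ r → det (replaceRow r (θ ∘ M r) M))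
    θ-det {zero}  M = θ-1
    θ-det {suc n} M = begin
      θ (sum (λ j → sgn j * M zero j * D j))
        ≈⟨ θ-sum (λ j → sgn j * M zero j * D j) ⟩
      sum (λ j → θ (sgn j * M zero j * D j))
        ≈⟨ sum-cong-≋ {suc n} leibniz ⟩
      sum (λ j → sgn j * θ (M zero j) * D j + sum (λ r → sgn j * M zero j * D′ j r))
        ≈⟨ ∑-distrib-+ (λ j → sgn j * θ (M zero j) * D j) (λ j → sum (λ r → sgn j * M zero j * D′ j r)) ⟩
      det (replaceRow zero (θ ∘ M zero) M) + sum (λ j → sum (λ r → sgn j * M zero j * D′ j r))
        ≈⟨ +-congˡ (trans (∑-comm (λ j r → sgn j * M zero j * D′ j r))
             (sum-cong-≋ λ r → sym (det-replaceRow-suc r (θ ∘ M (suc r)) M))) ⟩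
      det (replaceRow zero (θ ∘ M zero) M) + sum (λ r → det (replaceRow (suc r) (θ ∘ M (suc r)) M)) ∎
      where
      D : Fin (suc n) → Carrier
      D j = det (minor M j)
      D′ : Fin (suc n) → Fin n → Carrier
      D′ j r = det (replaceRow r (θ ∘ minor M j r) (minor M j))
      leibniz : ∀ j → θ (sgn j * M zero j * D j)
                ≈ sgn j * θ (M zero j) * D j + sum (λ r → sgn j * M zero j * D′ j r)
      leibniz j = begin
        θ (sgn j * M zero j * D j)
          ≈⟨ θ-* _ _ ⟩
        θ (sgn j * M zero j) * D j + sgn j * M zero j * θ (D j)
          ≈⟨ +-cong (*-congʳ (trans (θ-* _ _) (trans (+-congʳ (trans (*-congʳ (θ-sgn (toℕ j))) (zeroˡ _))) (+-identityˡ _))))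
               (trans (*-congˡ (θ-det (minor M j))) (*-distribˡ-sum _ (D′ j))) ⟩
        sgn j * θ (M zero j) * D j + sum (λ r → sgn j * M zero j * D′ j r) ∎

    -- Jacobi's formula with N in the role of θM M⁻¹, so that neither inverse nor adjugate occurs.
    -- Row r of θM is Σ N r k times row k of M; the summands with k ≠ r repeat a row and vanish, and
    -- k = r leaves N r r det M.
    θ-det-trace : ∀ {n} (M N : Fin n → Fin n → Carrier) →
      (∀ i j → θ (M i j) ≈ sum (λ k → N i k * M k j)) → θ (det M) ≈ sum (λ i → N i i) * det M
    θ-det-trace {n} M N θM = begin
      θ (det M)
        ≈⟨ θ-det M ⟩
      sum (λ r → det (replaceRow r (θ ∘ M r) M))
        ≈⟨ sum-cong-≋ (λ r → det-cong (replaceRow-cong r (θM r))) ⟩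
      sum (λ r → det (replaceRow r (λ j → sum (λ k → N r k * M k j)) M))
        ≈⟨ sum-cong-≋ (λ r → trans (det-replaceRow-linear r (N r) M M) (diagonal r)) ⟩
      sum (λ r → N r r * det M)
        ≈⟨ *-distribʳ-sum (det M) (λ r → N r r) ⟨
      sum (λ r → N r r) * det M ∎
      where
      replaceRow-cong : ∀ {m p} r {v w : Fin p → Carrier} {M : Fin m → Fin p → Carrier} → (∀ j → v j ≈ w j) →
        ∀ i j → replaceRow r v M i j ≈ replaceRow r w M i j
      replaceRow-cong zero    v≈w zero    j = v≈w j
      replaceRow-cong zero    v≈w (suc i) j = refl
      replaceRow-cong (suc r) v≈w zero    j = refl
      replaceRow-cong (suc r) v≈w (suc i) j = replaceRow-cong r v≈w i j

      other : ∀ r k → k ≢ r → det (replaceRow r (M k) M) ≈ 0#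
      other r k k≢r = det-alternating _ k r k≢r λ j → reflexive (≡.cong (_$ j)
        (≡.trans (replaceRow-other r k (M k) M k≢r) (≡.sym (replaceRow-self r (M k) M))))

      diagonal : ∀ r → sum (λ k → N r k * det (replaceRow r (M k) M)) ≈ N r r * det M
      diagonal r = trans (sum-single r _ λ k k≢r → trans (*-congˡ (other r k k≢r)) (zeroʳ _))
        (*-congˡ (det-cong λ i j → reflexive (≡.cong (_$ j) (replaceRow-same r M i))))

-- Matrices and Bass's identity

module Matrices {c ℓ} (S : CommutativeRing c ℓ) where
  open CommutativeRing S hiding (zero)
  open SemiringSum semiring using (sum; sum-cong-≋; ∑-distrib-+; ∑-comm; *-distribˡ-sum; *-distribʳ-sum)
  open SumProperties semiring using (sum-single)
  open RingProperties ring using (+-cancelʳ)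

  Mat : ℕ → ℕ → Set c
  Mat m n = Fin m → Fin n → Carrier

  infix 4 _≈ᴹ_
  -- A record and not a bare function type, so that M and N can be inferred from a proof of the
  -- equation.
  record _≈ᴹ_ {m n} (M N : Mat m n) : Set ℓ where
    constructor entrywise
    field entry : ∀ i j → M i j ≈ N i j
  open _≈ᴹ_ public

  matSetoid : ∀ m n → Setoid c ℓ
  matSetoid m n = record
    { Carrier = Mat m n ; _≈_ = _≈ᴹ_
    ; isEquivalence = record
      { refl  = entrywise λ i j → refl
      ; sym   = λ p → entrywise λ i j → sym (entry p i j)
      ; trans = λ p q → entrywise λ i j → trans (entry p i j) (entry q i j) } }

  module _ {m n : ℕ} where
    open Setoid (matSetoid m n) public using () renaming (refl to reflᴹ; sym to symᴹ; trans to transᴹ)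

  δ : ∀ {n} → Fin n → Fin n → Carrier
  δ i j = if does (i Fin.≟ j) then 1# else 0#

  δ-refl : ∀ {n} (i : Fin n) → δ i i ≈ 1#
  δ-refl i with i Fin.≟ i
  ... | yes _  = refl
  ... | no i≢i = contradiction ≡.refl i≢i

  δ-≢ : ∀ {n} {i j : Fin n} → i ≢ j → δ i j ≈ 0#
  δ-≢ {i = i} {j} i≢j with i Fin.≟ j
  ... | yes i≡j = contradiction i≡j i≢j
  ... | no _    = refl

  sum-δˡ : ∀ {n} (i : Fin n) (h : Fin n → Carrier) → sum (λ k → δ i k * h k) ≈ h i
  sum-δˡ i h = trans (sum-single i (λ k → δ i k * h k)
    (λ k k≢i → trans (*-congʳ (δ-≢ (k≢i ∘ ≡.sym))) (zeroˡ _))) (trans (*-congʳ (δ-refl i)) (*-identityˡ _))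

  sum-δʳ : ∀ {n} (j : Fin n) (h : Fin n → Carrier) → sum (λ k → h k * δ k j) ≈ h j
  sum-δʳ j h = trans (sum-single j (λ k → h k * δ k j)
    (λ k k≢j → trans (*-congˡ (δ-≢ k≢j)) (zeroʳ _))) (trans (*-congˡ (δ-refl j)) (*-identityʳ _))

  infixr 7 _∙_
  infixl 6 _⊞_
  -- Opaque, so that matrix computations treat products and sums as atoms; the `-entry` lemmas and
  -- `tr-sum` lead back to coefficients.
  opaque
    _∙_ : ∀ {m n p} → Mat m n → Mat n p → Mat m p
    (M ∙ N) i j = sum (λ k → M i k * N k j)

    _⊞_ : ∀ {m n} → Mat m n → Mat m n → Mat m n
    (M ⊞ N) i j = M i j + N i j

    I : ∀ {n} → Mat n n
    I = δ

    tr : ∀ {n} → Mat n n → Carrier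
    tr M = sum (λ i → M i i)

    ∙-entry : ∀ {m n p} (M : Mat m n) (N : Mat n p) i j → (M ∙ N) i j ≈ sum (λ k → M i k * N k j)
    ∙-entry M N i j = refl

    ⊞-entry : ∀ {m n} (M N : Mat m n) i j → (M ⊞ N) i j ≈ M i j + N i j
    ⊞-entry M N i j = refl

    I-entry : ∀ {n} (i j : Fin n) → I i j ≈ δ i j
    I-entry i j = refl

    tr-sum : ∀ {n} (M : Mat n n) → tr M ≈ sum (λ i → M i i)
    tr-sum M = refl

    ∙-cong : ∀ {m n p} {M M′ : Mat m n} {N N′ : Mat n p} → M ≈ᴹ M′ → N ≈ᴹ N′ → M ∙ N ≈ᴹ M′ ∙ N′
    ∙-cong p q = entrywise λ i j → sum-cong-≋ λ k → *-cong (entry p i k) (entry q k j)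

    ⊞-cong : ∀ {m n} {M M′ N N′ : Mat m n} → M ≈ᴹ M′ → N ≈ᴹ N′ → M ⊞ N ≈ᴹ M′ ⊞ N′
    ⊞-cong p q = entrywise λ i j → +-cong (entry p i j) (entry q i j)

    ∙-assoc : ∀ {m n p q} (M : Mat m n) (N : Mat n p) (P : Mat p q) → (M ∙ N) ∙ P ≈ᴹ M ∙ (N ∙ P)
    ∙-assoc M N P = entrywise λ i j → trans
      (sum-cong-≋ λ k → *-distribʳ-sum (P k j) (λ l → M i l * N l k))
      (trans (∑-comm (λ k l → M i l * N l k * P k j)) (sum-cong-≋ λ l → trans
        (sum-cong-≋ λ k → *-assoc (M i l) (N l k) (P k j)) (sym (*-distribˡ-sum (M i l) (λ k → N l k * P k j)))))

    ∙-distribʳ : ∀ {m n p} (P : Mat n p) (M N : Mat m n) → (M ⊞ N) ∙ P ≈ᴹ M ∙ P ⊞ N ∙ P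
    ∙-distribʳ P M N = entrywise λ i j → trans (sum-cong-≋ λ k → distribʳ (P k j) (M i k) (N i k))
      (∑-distrib-+ (λ k → M i k * P k j) (λ k → N i k * P k j))

    ∙-distribˡ : ∀ {m n p} (P : Mat m n) (M N : Mat n p) → P ∙ (M ⊞ N) ≈ᴹ P ∙ M ⊞ P ∙ N
    ∙-distribˡ P M N = entrywise λ i j → trans (sum-cong-≋ λ k → distribˡ (P i k) (M k j) (N k j))
      (∑-distrib-+ (λ k → P i k * M k j) (λ k → P i k * N k j))

    ∙-identityˡ : ∀ {m n} (M : Mat m n) → I ∙ M ≈ᴹ M
    ∙-identityˡ M = entrywise λ i j → sum-δˡ i (λ k → M k j)

    ∙-identityʳ : ∀ {m n} (M : Mat m n) → M ∙ I ≈ᴹ M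
    ∙-identityʳ M = entrywise λ i j → sum-δʳ j (M i)

    ⊞-comm : ∀ {m n} (M N : Mat m n) → M ⊞ N ≈ᴹ N ⊞ M
    ⊞-comm M N = entrywise λ i j → +-comm _ _

    ⊞-assoc : ∀ {m n} (M N P : Mat m n) → (M ⊞ N) ⊞ P ≈ᴹ M ⊞ (N ⊞ P)
    ⊞-assoc M N P = entrywise λ i j → +-assoc _ _ _

    ⊞-cancelʳ : ∀ {m n} (P M N : Mat m n) → M ⊞ P ≈ᴹ N ⊞ P → M ≈ᴹ N
    ⊞-cancelʳ P M N p = entrywise λ i j → +-cancelʳ (P i j) (M i j) (N i j) (entry p i j)

    tr-cong : ∀ {n} {M N : Mat n n} → M ≈ᴹ N → tr M ≈ tr N
    tr-cong p = sum-cong-≋ λ i → entry p i i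

    tr-⊞ : ∀ {n} (M N : Mat n n) → tr (M ⊞ N) ≈ tr M + tr N
    tr-⊞ M N = ∑-distrib-+ (λ i → M i i) (λ i → N i i)

    tr-comm : ∀ {m n} (M : Mat m n) (N : Mat n m) → tr (M ∙ N) ≈ tr (N ∙ M)
    tr-comm M N = trans (∑-comm (λ i k → M i k * N k i)) (sum-cong-≋ λ k → sum-cong-≋ λ i → *-comm (M i k) (N k i))

  module _ (derivation : Derivation S) where
    open Derivation derivation
    opaque
      unfolding _∙_
      θᴹ : ∀ {m n} → Mat m n → Mat m n
      θᴹ M i j = θ (M i j)

      θᴹ-entry : ∀ {m n} (M : Mat m n) i j → θᴹ M i j ≈ θ (M i j)
      θᴹ-entry M i j = refl

      θᴹ-cong : ∀ {m n} {M N : Mat m n} → M ≈ᴹ N → θᴹ M ≈ᴹ θᴹ N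
      θᴹ-cong p = entrywise λ i j → θ-cong (entry p i j)

      θᴹ-⊞ : ∀ {m n} (M N : Mat m n) → θᴹ (M ⊞ N) ≈ᴹ θᴹ M ⊞ θᴹ N
      θᴹ-⊞ M N = entrywise λ i j → θ-+ _ _

      θᴹ-∙ : ∀ {m n p} (M : Mat m n) (N : Mat n p) → θᴹ (M ∙ N) ≈ᴹ θᴹ M ∙ N ⊞ M ∙ θᴹ N
      θᴹ-∙ M N = entrywise λ i j → trans (θ-sum (λ k → M i k * N k j)) (trans (sum-cong-≋ λ k → θ-* (M i k) (N k j))
        (∑-distrib-+ (λ k → θ (M i k) * N k j) (λ k → M i k * θ (N k j))))

-- With K = M⁻¹, G = E⁻¹ and H = U⁻¹ we have Δ = U (1 - τ K Σ) and E = M - Σ τ, so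
-- Δ⁻¹ = (1 + τ G Σ) H, and tr(θΔ Δ⁻¹) = tr(θU H) + tr K - tr G. All identities are
-- stated with the terms moved so that no subtraction of matrices is needed.
module BassTrace {c ℓ} (S : CommutativeRing c ℓ) (derivation : Derivation S) where
  open CommutativeRing S hiding (zero)
  open Matrices S

  -- In the application x and y count vertices and edges, τ = t, ρ = t - u L s, Σ = uσ, U = 1 - u²
  -- L, J₁ = uJ, M = 1 + uJ and E = 1 - uB.
  module BassIdentity {x y : ℕ}
    (τ ρ : Mat x y) (Σ : Mat y x) (U H Δ : Mat x x) (M J₁ E K G : Mat y y)
    (M≈1+J₁ : M ≈ᴹ I ⊞ J₁) (E+Στ≈M : E ⊞ Σ ∙ τ ≈ᴹ M) (Δ+ρΣ≈U : Δ ⊞ ρ ∙ Σ ≈ᴹ U) (ρM≈Uτ : ρ ∙ M ≈ᴹ U ∙ τ)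
    (MK≈1 : M ∙ K ≈ᴹ I) (EG≈1 : E ∙ G ≈ᴹ I) (GE≈1 : G ∙ E ≈ᴹ I) (HU≈1 : H ∙ U ≈ᴹ I)
    (θUτ≈ : θᴹ derivation (U ∙ τ) ≈ᴹ θᴹ derivation U ∙ τ)
    (θΣ≈Σ : θᴹ derivation Σ ≈ᴹ Σ) (θM≈J₁ : θᴹ derivation M ≈ᴹ J₁)
    where
    private
      θ′ : ∀ {m n} → Mat m n → Mat m n
      θ′ = θᴹ derivation

    Q : Mat y x
    Q = G ∙ (Σ ∙ H)

    -- This is (1 + τ G Σ) H multiplied out. `PΔ≈1` is the side of invertibility that makes `N`
    -- satisfy `NΔ≈θΔ`, the hypothesis of Jacobi's formula.
    P : Mat x x
    P = H ⊞ τ ∙ Q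

    N : Mat x x
    N = θ′ Δ ∙ P

    -- `ρM≈Uτ` with the inverses of U and M brought across. It exchanges ρ, which occurs in Δ, for
    -- τ, which occurs in E.
    Hρ≈τK : H ∙ ρ ≈ᴹ τ ∙ K
    Hρ≈τK = begin
      H ∙ ρ              ≈⟨ ∙-cong reflᴹ (transᴹ (∙-cong reflᴹ MK≈1) (∙-identityʳ ρ)) ⟨
      H ∙ (ρ ∙ (M ∙ K))  ≈⟨ ∙-cong reflᴹ (∙-assoc ρ M K) ⟨
      H ∙ ((ρ ∙ M) ∙ K)  ≈⟨ ∙-cong reflᴹ (∙-cong ρM≈Uτ reflᴹ) ⟩
      H ∙ ((U ∙ τ) ∙ K)  ≈⟨ ∙-cong reflᴹ (∙-assoc U τ K) ⟩
      H ∙ (U ∙ (τ ∙ K))  ≈⟨ ∙-assoc H U (τ ∙ K) ⟨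
      (H ∙ U) ∙ (τ ∙ K)  ≈⟨ transᴹ (∙-cong HU≈1 reflᴹ) (∙-identityˡ _) ⟩
      τ ∙ K              ∎
      where open SetoidReasoning (matSetoid x y)

    -- The resolvent identity M G = 1 + Σ τ G, from M = E + Σ τ. The free factor Z saves
    -- reassociations where it is applied.
    MG-expand : ∀ {n} (Z : Mat y n) → M ∙ (G ∙ Z) ≈ᴹ Z ⊞ Σ ∙ (τ ∙ (G ∙ Z))
    MG-expand {n} Z = begin
      M ∙ (G ∙ Z)                        ≈⟨ ∙-cong E+Στ≈M reflᴹ ⟨
      (E ⊞ Σ ∙ τ) ∙ (G ∙ Z)              ≈⟨ ∙-distribʳ (G ∙ Z) E (Σ ∙ τ) ⟩
      E ∙ (G ∙ Z) ⊞ (Σ ∙ τ) ∙ (G ∙ Z)    ≈⟨ ⊞-cong (symᴹ (∙-assoc E G Z)) (∙-assoc Σ τ (G ∙ Z)) ⟩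
      (E ∙ G) ∙ Z ⊞ Σ ∙ (τ ∙ (G ∙ Z))    ≈⟨ ⊞-cong (transᴹ (∙-cong EG≈1 reflᴹ) (∙-identityˡ Z)) reflᴹ ⟩
      Z ⊞ Σ ∙ (τ ∙ (G ∙ Z))              ∎
      where open SetoidReasoning (matSetoid y n)

    GM-expand : ∀ {n} (Z : Mat y n) → G ∙ (M ∙ Z) ≈ᴹ Z ⊞ G ∙ (Σ ∙ (τ ∙ Z))
    GM-expand {n} Z = begin
      G ∙ (M ∙ Z)                        ≈⟨ ∙-assoc G M Z ⟨
      (G ∙ M) ∙ Z                        ≈⟨ ∙-cong (∙-cong reflᴹ E+Στ≈M) reflᴹ ⟨
      (G ∙ (E ⊞ Σ ∙ τ)) ∙ Z              ≈⟨ ∙-cong (∙-distribˡ G E (Σ ∙ τ)) reflᴹ ⟩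
      (G ∙ E ⊞ G ∙ (Σ ∙ τ)) ∙ Z          ≈⟨ ∙-distribʳ Z (G ∙ E) (G ∙ (Σ ∙ τ)) ⟩
      (G ∙ E) ∙ Z ⊞ (G ∙ (Σ ∙ τ)) ∙ Z    ≈⟨ ⊞-cong (transᴹ (∙-cong GE≈1 reflᴹ) (∙-identityˡ Z))
                                              (transᴹ (∙-assoc G (Σ ∙ τ) Z) (∙-cong reflᴹ (∙-assoc Σ τ Z))) ⟩
      Z ⊞ G ∙ (Σ ∙ (τ ∙ Z))              ∎
      where open SetoidReasoning (matSetoid y n)

    QU≈GΣ : Q ∙ U ≈ᴹ G ∙ Σ
    QU≈GΣ = begin
      (G ∙ (Σ ∙ H)) ∙ U  ≈⟨ transᴹ (∙-assoc G (Σ ∙ H) U) (∙-cong reflᴹ (∙-assoc Σ H U)) ⟩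
      G ∙ (Σ ∙ (H ∙ U))  ≈⟨ ∙-cong reflᴹ (transᴹ (∙-cong reflᴹ HU≈1) (∙-identityʳ Σ)) ⟩
      G ∙ Σ              ∎
      where open SetoidReasoning (matSetoid y x)

    PU≈1+τGΣ : P ∙ U ≈ᴹ I ⊞ τ ∙ (G ∙ Σ)
    PU≈1+τGΣ = transᴹ (∙-distribʳ U H (τ ∙ Q))
      (⊞-cong HU≈1 (transᴹ (∙-assoc τ Q U) (∙-cong reflᴹ QU≈GΣ)))

    Qρ≈GΣτK : Q ∙ ρ ≈ᴹ G ∙ (Σ ∙ (τ ∙ K))
    Qρ≈GΣτK = transᴹ (∙-assoc G (Σ ∙ H) ρ) (∙-cong reflᴹ (transᴹ (∙-assoc Σ H ρ) (∙-cong reflᴹ Hρ≈τK)))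

    -- Already P ρ = τ G: by `Hρ≈τK` it equals τ (K + G Σ τ K), and the bracket is G M K = G by
    -- `GM-expand`.
    PρΣ≈τGΣ : P ∙ (ρ ∙ Σ) ≈ᴹ τ ∙ (G ∙ Σ)
    PρΣ≈τGΣ = begin
      P ∙ (ρ ∙ Σ)                            ≈⟨ ∙-assoc P ρ Σ ⟨
      (P ∙ ρ) ∙ Σ                            ≈⟨ ∙-cong (∙-distribʳ ρ H (τ ∙ Q)) reflᴹ ⟩
      (H ∙ ρ ⊞ (τ ∙ Q) ∙ ρ) ∙ Σ              ≈⟨ ∙-cong (⊞-cong Hρ≈τK (transᴹ (∙-assoc τ Q ρ) (∙-cong reflᴹ Qρ≈GΣτK))) reflᴹ ⟩
      (τ ∙ K ⊞ τ ∙ (G ∙ (Σ ∙ (τ ∙ K)))) ∙ Σ  ≈⟨ ∙-cong (∙-distribˡ τ K _) reflᴹ ⟨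
      (τ ∙ (K ⊞ G ∙ (Σ ∙ (τ ∙ K)))) ∙ Σ      ≈⟨ ∙-cong (∙-cong reflᴹ (GM-expand K)) reflᴹ ⟨
      (τ ∙ (G ∙ (M ∙ K))) ∙ Σ                ≈⟨ ∙-cong (∙-cong reflᴹ (transᴹ (∙-cong reflᴹ MK≈1) (∙-identityʳ G))) reflᴹ ⟩
      (τ ∙ G) ∙ Σ                            ≈⟨ ∙-assoc τ G Σ ⟩
      τ ∙ (G ∙ Σ)                            ∎
      where open SetoidReasoning (matSetoid x x)

    PΔ≈1 : P ∙ Δ ≈ᴹ I
    PΔ≈1 = ⊞-cancelʳ (P ∙ (ρ ∙ Σ)) (P ∙ Δ) I (begin
      P ∙ Δ ⊞ P ∙ (ρ ∙ Σ)  ≈⟨ ∙-distribˡ P Δ (ρ ∙ Σ) ⟨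
      P ∙ (Δ ⊞ ρ ∙ Σ)      ≈⟨ ∙-cong reflᴹ Δ+ρΣ≈U ⟩
      P ∙ U                ≈⟨ PU≈1+τGΣ ⟩
      I ⊞ τ ∙ (G ∙ Σ)      ≈⟨ ⊞-cong reflᴹ PρΣ≈τGΣ ⟨
      I ⊞ P ∙ (ρ ∙ Σ)      ∎)
      where open SetoidReasoning (matSetoid x x)

    NΔ≈θΔ : N ∙ Δ ≈ᴹ θ′ Δ
    NΔ≈θΔ = transᴹ (∙-assoc (θ′ Δ) P Δ) (transᴹ (∙-cong reflᴹ PΔ≈1) (∙-identityʳ _))

    ΣP≈MQ : Σ ∙ P ≈ᴹ M ∙ Q
    ΣP≈MQ = transᴹ (∙-distribˡ Σ H (τ ∙ Q)) (symᴹ (MG-expand (Σ ∙ H)))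

    -- The derivative of ρ M = U τ. That τ is constant is contained in the hypothesis `θUτ≈`.
    θUτ : θ′ U ∙ τ ≈ᴹ θ′ ρ ∙ M ⊞ ρ ∙ J₁
    θUτ = begin
      θ′ U ∙ τ             ≈⟨ θUτ≈ ⟨
      θ′ (U ∙ τ)           ≈⟨ θᴹ-cong derivation ρM≈Uτ ⟨
      θ′ (ρ ∙ M)           ≈⟨ θᴹ-∙ derivation ρ M ⟩
      θ′ ρ ∙ M ⊞ ρ ∙ θ′ M  ≈⟨ ⊞-cong reflᴹ (∙-cong reflᴹ θM≈J₁) ⟩
      θ′ ρ ∙ M ⊞ ρ ∙ J₁    ∎
      where open SetoidReasoning (matSetoid x y)

    θΔ-expand : θ′ Δ ⊞ (θ′ ρ ∙ Σ ⊞ ρ ∙ Σ) ≈ᴹ θ′ U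
    θΔ-expand = begin
      θ′ Δ ⊞ (θ′ ρ ∙ Σ ⊞ ρ ∙ Σ)     ≈⟨ ⊞-cong reflᴹ (⊞-cong reflᴹ (∙-cong reflᴹ θΣ≈Σ)) ⟨
      θ′ Δ ⊞ (θ′ ρ ∙ Σ ⊞ ρ ∙ θ′ Σ)  ≈⟨ ⊞-cong reflᴹ (θᴹ-∙ derivation ρ Σ) ⟨
      θ′ Δ ⊞ θ′ (ρ ∙ Σ)             ≈⟨ θᴹ-⊞ derivation Δ (ρ ∙ Σ) ⟨
      θ′ (Δ ⊞ ρ ∙ Σ)                ≈⟨ θᴹ-cong derivation Δ+ρΣ≈U ⟩
      θ′ U                          ∎
      where open SetoidReasoning (matSetoid x x)

    -- Read subtractively, N = θU P - θρ Σ P - ρ Σ P. Here θU P = θU H + θU τ Q, and `θUτ` turns the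
    -- last term into θρ M Q + ρ J₁ Q. As Σ P = M Q and M = 1 + J₁, both of these cancel and θU H -
    -- ρ Q remains.
    N+ρQ≈θUH : N ⊞ ρ ∙ Q ≈ᴹ θ′ U ∙ H
    -- The two cancelling terms A and B are added on both sides.
    N+ρQ≈θUH = ⊞-cancelʳ (A ⊞ B) _ _ (begin
      (N ⊞ ρ ∙ Q) ⊞ (A ⊞ B)
        ≈⟨ transᴹ (⊞-assoc N (ρ ∙ Q) (A ⊞ B)) (⊞-cong reflᴹ (transᴹ (symᴹ (⊞-assoc (ρ ∙ Q) A B))
             (transᴹ (⊞-cong (⊞-comm (ρ ∙ Q) A) reflᴹ) (⊞-assoc A (ρ ∙ Q) B)))) ⟩
      N ⊞ (A ⊞ (ρ ∙ Q ⊞ B))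
        ≈⟨ ⊞-cong reflᴹ (⊞-cong reflᴹ (transᴹ (∙-cong reflᴹ (transᴹ (∙-cong M≈1+J₁ reflᴹ)
             (transᴹ (∙-distribʳ Q I J₁) (⊞-cong (∙-identityˡ Q) reflᴹ)))) (∙-distribˡ ρ Q (J₁ ∙ Q)))) ⟨
      N ⊞ (θ′ ρ ∙ (M ∙ Q) ⊞ ρ ∙ (M ∙ Q))
        ≈⟨ ⊞-cong reflᴹ (⊞-cong (∙-cong reflᴹ ΣP≈MQ) (∙-cong reflᴹ ΣP≈MQ)) ⟨
      N ⊞ (θ′ ρ ∙ (Σ ∙ P) ⊞ ρ ∙ (Σ ∙ P))
        ≈⟨ ⊞-cong reflᴹ (transᴹ (∙-distribʳ P (θ′ ρ ∙ Σ) (ρ ∙ Σ)) (⊞-cong (∙-assoc (θ′ ρ) Σ P) (∙-assoc ρ Σ P))) ⟨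
      θ′ Δ ∙ P ⊞ (θ′ ρ ∙ Σ ⊞ ρ ∙ Σ) ∙ P
        ≈⟨ ∙-distribʳ P (θ′ Δ) _ ⟨
      (θ′ Δ ⊞ (θ′ ρ ∙ Σ ⊞ ρ ∙ Σ)) ∙ P
        ≈⟨ ∙-cong θΔ-expand reflᴹ ⟩
      θ′ U ∙ (H ⊞ τ ∙ Q)
        ≈⟨ transᴹ (∙-distribˡ (θ′ U) H (τ ∙ Q)) (⊞-cong reflᴹ (symᴹ (∙-assoc (θ′ U) τ Q))) ⟩
      θ′ U ∙ H ⊞ (θ′ U ∙ τ) ∙ Q
        ≈⟨ ⊞-cong reflᴹ (transᴹ (∙-cong θUτ reflᴹ) (transᴹ (∙-distribʳ Q (θ′ ρ ∙ M) (ρ ∙ J₁))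
             (⊞-cong (∙-assoc (θ′ ρ) M Q) (∙-assoc ρ J₁ Q)))) ⟩
      θ′ U ∙ H ⊞ (A ⊞ B) ∎)
      where
      open SetoidReasoning (matSetoid x x)
      A = θ′ ρ ∙ (M ∙ Q)
      B = ρ ∙ (J₁ ∙ Q)

    -- Cyclicity brings H next to ρ, where `Hρ≈τK` applies; a second rotation makes the trace over
    -- vertices one over edges.
    tr-ρQ : tr (ρ ∙ Q) ≈ tr ((Σ ∙ τ) ∙ (K ∙ G))
    tr-ρQ = begin
      tr (ρ ∙ (G ∙ (Σ ∙ H)))    ≈⟨ tr-cong (transᴹ (∙-cong reflᴹ (symᴹ (∙-assoc G Σ H))) (symᴹ (∙-assoc ρ (G ∙ Σ) H))) ⟩
      tr ((ρ ∙ (G ∙ Σ)) ∙ H)    ≈⟨ tr-comm (ρ ∙ (G ∙ Σ)) H ⟩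
      tr (H ∙ (ρ ∙ (G ∙ Σ)))    ≈⟨ tr-cong (transᴹ (symᴹ (∙-assoc H ρ (G ∙ Σ))) (∙-cong Hρ≈τK reflᴹ)) ⟩
      tr ((τ ∙ K) ∙ (G ∙ Σ))    ≈⟨ tr-cong (transᴹ (symᴹ (∙-assoc (τ ∙ K) G Σ)) (∙-cong (∙-assoc τ K G) reflᴹ)) ⟩
      tr ((τ ∙ (K ∙ G)) ∙ Σ)    ≈⟨ tr-comm (τ ∙ (K ∙ G)) Σ ⟩
      tr (Σ ∙ (τ ∙ (K ∙ G)))    ≈⟨ tr-cong (∙-assoc Σ τ (K ∙ G)) ⟨
      tr ((Σ ∙ τ) ∙ (K ∙ G))    ∎
      where open SetoidReasoning setoid

    -- Since Σ τ = M - E, the trace of Σ τ K G is the difference of tr(M K G) = tr G and, by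
    -- cyclicity, tr(E K G) = tr(K G E) = tr K.
    tr-K+tr-ρQ : tr K + tr (ρ ∙ Q) ≈ tr G
    tr-K+tr-ρQ = begin
      tr K + tr (ρ ∙ Q)
        ≈⟨ +-cong (tr-cong (transᴹ (∙-cong reflᴹ GE≈1) (∙-identityʳ K))) (sym tr-ρQ) ⟨
      tr (K ∙ (G ∙ E)) + tr ((Σ ∙ τ) ∙ (K ∙ G))
        ≈⟨ +-congʳ (trans (tr-cong (symᴹ (∙-assoc K G E))) (tr-comm (K ∙ G) E)) ⟩
      tr (E ∙ (K ∙ G)) + tr ((Σ ∙ τ) ∙ (K ∙ G))
        ≈⟨ tr-⊞ _ _ ⟨
      tr (E ∙ (K ∙ G) ⊞ (Σ ∙ τ) ∙ (K ∙ G))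
        ≈⟨ tr-cong (transᴹ (symᴹ (∙-distribʳ (K ∙ G) E (Σ ∙ τ))) (∙-cong E+Στ≈M reflᴹ)) ⟩
      tr (M ∙ (K ∙ G))
        ≈⟨ tr-cong (transᴹ (symᴹ (∙-assoc M K G)) (transᴹ (∙-cong MK≈1 reflᴹ) (∙-identityˡ G))) ⟩
      tr G ∎
      where open SetoidReasoning setoid

    bass-trace : tr N + tr G ≈ tr (θ′ U ∙ H) + tr K
    bass-trace = begin
      tr N + tr G                  ≈⟨ +-congˡ (tr-K+tr-ρQ) ⟨
      tr N + (tr K + tr (ρ ∙ Q))   ≈⟨ +-congˡ (+-comm _ _) ⟩
      tr N + (tr (ρ ∙ Q) + tr K)   ≈⟨ +-assoc _ _ _ ⟨
      tr N + tr (ρ ∙ Q) + tr K     ≈⟨ +-congʳ (trans (sym (tr-⊞ N (ρ ∙ Q))) (tr-cong N+ρQ≈θUH)) ⟩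
      tr (θ′ U ∙ H) + tr K         ∎
      where open SetoidReasoning setoid

-- Counting by minimal periods

module _ {a p} {A : Set a} {P : Set p} {x y : A} where

  if-yes : (P? : Dec P) → P → (if does P? then x else y) ≡ x
  if-yes P? p = ≡.cong (if_then x else y) (dec-true P? p)

  if-no : (P? : Dec P) → ¬ P → (if does P? then x else y) ≡ y
  if-no P? ¬p = ≡.cong (if_then x else y) (dec-false P? ¬p)

module ℕΣ where
  open SemiringSum ℕ.+-*-semiring public using (sum; sum-cong-≗; ∑-distrib-+)
  open SumProperties ℕ.+-*-semiring public

module _ {a} {A : Set a} where

  unique-length : {xs ys : List A} → Unique xs → Unique ys →
    (∀ {x} → x ∈ xs → x ∈ ys) → (∀ {x} → x ∈ ys → x ∈ xs) → length xs ≡ length ys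
  unique-length uxs uys xs⊆ys ys⊆xs = ↭-length (∼bag⇒↭ (unique∧set⇒bag uxs uys (mk⇔ xs⊆ys ys⊆xs)))

  length-partition : ∀ {n p} {P : Fin n → A → Set p} (P? : ∀ k → Decidable (P k)) xs →
    (∀ {x} → x ∈ xs → ∃ λ k → P k x × (∀ j → P j x → j ≡ k)) →
    length xs ≡ ℕΣ.sum (λ k → length (filter (P? k) xs))
  length-partition {n} P? [] classify = ≡.sym (ℕΣ.sum-zero {n} _ λ k → ≡.refl)
  length-partition {n} {P = P} P? (x ∷ xs) classify with classify (here ≡.refl)
  ... | k , Pk , uniq = ≡.sym (≡.trans (ℕΣ.sum-cong-≗ {n} split)
    (≡.trans (ℕΣ.∑-distrib-+ ind (λ j → length (filter (P? j) xs)))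
      (≡.cong₂ ℕ._+_ (≡.trans (ℕΣ.sum-single k ind ind-other) ind-k)
        (≡.sym (length-partition P? xs (classify ∘ there))))))
    where
    ind : Fin n → ℕ
    ind j = if does (P? j x) then 1 else 0
    split : ∀ j → length (filter (P? j) (x ∷ xs)) ≡ ind j ℕ.+ length (filter (P? j) xs)
    split j with does (P? j x)
    ... | true  = ≡.refl
    ... | false = ≡.refl
    ind-other : ∀ j → j ≢ k → ind j ≡ 0
    ind-other j j≢k rewrite dec-false (P? j x) (j≢k ∘ uniq j) = ≡.refl
    ind-k : ind k ≡ 1
    ind-k rewrite dec-true (P? k x) Pk = ≡.refl

-- R is an equivalence only among elements satisfying V: `SameCycle k`, for example, is symmetric on
-- k-cycles but not on points leading into them. Reflexivity and the euclidean law together give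
-- symmetry and transitivity on V.
module Representatives {a v r} {A : Set a} {V : A → Set v} {R : A → A → Set r} (R? : Decidable₂ R)
  (R-refl : ∀ {x} → V x → R x x) (R-euclidean : ∀ {x y z} → V x → V y → V z → R x z → R y z → R x y) where

  deduplicate-all : ∀ {p} {P : A → Set p} {xs} → All P xs → All P (deduplicate R? xs)
  deduplicate-all = All.deduplicate⁺ R?

  deduplicate-separated : ∀ xs → AllPairs (λ x y → ¬ R x y) (deduplicate R? xs)
  deduplicate-separated []       = []
  deduplicate-separated (x ∷ xs) = All.all-filter _ (deduplicate R? xs) ∷ AllPairs.filter⁺ _ (deduplicate-separated xs)

  -- The representative z of y found in the tail may be removed when x is put in front. That happens
  -- only if R x z holds, and then x itself represents y.
  represented : ∀ {xs} → All V xs → ∀ {y} → y ∈ xs → Any (λ x → R x y) (deduplicate R? xs)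
  represented {x ∷ xs} (Vx ∷ Vxs) {y} y∈ with R? x y | y∈
  ... | yes Rxy | _           = here Rxy
  ... | no ¬Rxy | here ≡.refl = contradiction (R-refl Vx) ¬Rxy
  ... | no ¬Rxy | there y∈xs  with All.lookupAny (deduplicate-all Vxs) (represented Vxs y∈xs) | Any.filter⁺
    (¬? ∘ R? x) (represented Vxs y∈xs)
  ...   | _       | inj₁ found = there found
  ...   | Vz , Rzy | inj₂ ¬¬Rxz with R? x (Any.lookup (represented Vxs y∈xs))
  ...     | yes Rxz = contradiction (R-euclidean Vx Vy Vz Rxz (R-euclidean Vy Vz Vy (R-refl Vy) Rzy)) ¬Rxy
    where Vy = All.lookup Vxs y∈xs
  ...     | no ¬Rxz = contradiction ¬Rxz ¬¬Rxz

  representative-unique : ∀ {zs} → All V zs → AllPairs (λ x y → ¬ R x y) zs → ∀ {y} → V y →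
    ∀ i j → R (lookup zs i) y → R (lookup zs j) y → i ≡ j
  representative-unique (_ ∷ _)    (_ ∷ _)    Vy zero    zero    _ _ = ≡.refl
  representative-unique (Vx ∷ Vzs) (¬Rx ∷ _)  Vy zero    (suc j) Rxy Rzy =
    contradiction (R-euclidean Vx (All.lookup Vzs (∈-lookup j)) Vy Rxy Rzy) (All.lookup ¬Rx (∈-lookup j))
  representative-unique (Vx ∷ Vzs) (¬Rx ∷ _)  Vy (suc i) zero    Rzy Rxy =
    contradiction (R-euclidean Vx (All.lookup Vzs (∈-lookup i)) Vy Rxy Rzy) (All.lookup ¬Rx (∈-lookup i))
  representative-unique (_ ∷ Vzs)  (_ ∷ sep)  Vy (suc i) (suc j) Ri Rj =
    ≡.cong suc (representative-unique Vzs sep Vy i j Ri Rj)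

  length-deduplicate : ∀ k {xs} → All V xs → (∀ {x} → x ∈ xs → length (filter (R? x) xs) ≡ k) →
    length xs ≡ length (deduplicate R? xs) ℕ.* k
  length-deduplicate k {xs} Vxs class-size = ≡.trans
    (length-partition (λ i → R? (lookup reps i)) xs λ y∈xs → let found = represented Vxs y∈xs in
      Any.index found , Any.lookup-index found , λ j Rj →
        representative-unique (deduplicate-all Vxs) (deduplicate-separated xs) (All.lookup Vxs y∈xs) j
          (Any.index found) Rj (Any.lookup-index found))
    (≡.trans (ℕΣ.sum-cong-≗ {length reps} λ i → class-size (∈-deduplicate⁻ R? xs (∈-lookup i)))
      (sum-const (length reps)))
    where
    reps = deduplicate R? xs
    sum-const : ∀ n → ℕΣ.sum {n} (λ _ → k) ≡ n ℕ.* k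
    sum-const zero    = ≡.refl
    sum-const (suc n) = ≡.cong (k ℕ.+_) (sum-const n)

-- Minimal periods and orbits of a self-map

module Iteration {a} {A : Set a} (_≟_ : DecidableEquality A) (F : A → A) where

  infixr 8 F^_
  F^_ : ℕ → A → A
  (F^ k) x = fold x F k

  F^-+ : ∀ m n x → (F^ (m ℕ.+ n)) x ≡ (F^ m) ((F^ n) x)
  F^-+ m n x = fold-+ x F m

  F^-* : ∀ q {k x} → (F^ k) x ≡ x → (F^ (q ℕ.* k)) x ≡ x
  F^-* zero    p = ≡.refl
  F^-* (suc q) {k} {x} p = ≡.trans (F^-+ k (q ℕ.* k) x) (≡.trans (≡.cong (F^ k) (F^-* q p)) p)

  -- Definitionally `OnCycleOfLength` without its component `InZ`.
  IsMinPeriod : ℕ → A → Set a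
  IsMinPeriod k x = 0 < k × (F^ k) x ≡ x × (∀ {j} → j < k → 0 < j → (F^ j) x ≢ x)

  isMinPeriod? : ∀ k x → Dec (IsMinPeriod k x)
  isMinPeriod? k x = 0 ℕ.<? k ×-dec (F^ k) x ≟ x
    ×-dec ℕ.allUpTo? (λ j → 0 ℕ.<? j →-dec ¬? ((F^ j) x ≟ x)) k

  minPeriod-exists : ∀ n {x} → 0 < n → (F^ n) x ≡ x → ∃ λ k → IsMinPeriod k x
  minPeriod-exists = <-rec _ λ n rec {x} 0<n p → search n rec 0<n p
    where
    search : ∀ n {x} → (∀ {m} → m < n → ∀ {x} → 0 < m → (F^ m) x ≡ x → ∃ λ k → IsMinPeriod k x) →
             0 < n → (F^ n) x ≡ x → ∃ λ k → IsMinPeriod k x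
    search n {x} rec 0<n p with ℕ.anyUpTo? (λ j → 0 ℕ.<? j ×-dec (F^ j) x ≟ x) n
    ... | yes (j , j<n , 0<j , q) = rec j<n 0<j q
    ... | no none = n , 0<n , p , λ j<n 0<j q → none (_ , j<n , 0<j , q)

  F^-% : ∀ {k x} .{{_ : ℕ.NonZero k}} → (F^ k) x ≡ x → ∀ m → (F^ m) x ≡ (F^ (m % k)) x
  F^-% {k} {x} p m = ≡.trans (≡.cong (λ l → (F^ l) x) (m≡m%n+[m/n]*n m k))
    (≡.trans (F^-+ (m % k) (m / k ℕ.* k) x) (≡.cong (F^ (m % k)) (F^-* (m / k) p)))

  minPeriod-∣ : ∀ {k x m} → IsMinPeriod k x → (F^ m) x ≡ x → k ∣ m
  minPeriod-∣ {k@(suc _)} {x} {m} (_ , p , minimal) q with m % k in eq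
  ... | zero  = m%n≡0⇒n∣m m k eq
  ... | suc r = contradiction (≡.trans (≡.sym (F^-% p m)) q)
    (minimal (m%n<n m k) (≡.subst (0 <_) (≡.sym eq) ℕ.z<s))

  ∣⇒F^ : ∀ {k x m} → (F^ k) x ≡ x → k ∣ m → (F^ m) x ≡ x
  ∣⇒F^ p (divides q ≡.refl) = F^-* q p

  minPeriod-unique : ∀ {j k x} → IsMinPeriod j x → IsMinPeriod k x → j ≡ k
  minPeriod-unique P@(_ , p , _) Q@(_ , q , _) = ∣-antisym (minPeriod-∣ P q) (minPeriod-∣ Q p)

  orbit-return : ∀ {k x} m → m ≤ k → (F^ k) x ≡ x → (F^ (k ∸ m)) ((F^ m) x) ≡ x
  orbit-return {k} {x} m m≤k p = ≡.trans (≡.sym (F^-+ (k ∸ m) m x))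
    (≡.trans (≡.cong (λ l → (F^ l) x) (ℕ.m∸n+n≡m m≤k)) p)

  orbit-period : ∀ {k x} m → (F^ k) x ≡ x → (F^ k) ((F^ m) x) ≡ (F^ m) x
  orbit-period {k} {x} m p = ≡.trans (≡.sym (F^-+ k m x)) (≡.trans (≡.cong (λ l → (F^ l) x) (ℕ.+-comm k m))
    (≡.trans (F^-+ m k x) (≡.cong (F^ m) p)))

  minPeriod-suc : ∀ {k x} → IsMinPeriod k x → IsMinPeriod k (F x)
  minPeriod-suc {k} {x} P@(0<k , p , minimal) = 0<k , orbit-period {k} 1 p , λ {j} j<k 0<j q →
    minimal j<k 0<j (≡.trans (≡.cong (F^ j) (≡.sym back)) (≡.trans (≡.sym (F^-+ j (k ∸ 1) (F x)))
      (≡.trans (≡.cong (λ l → (F^ l) (F x)) (ℕ.+-comm j (k ∸ 1))) (≡.trans (F^-+ (k ∸ 1) j (F x))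
      (≡.trans (≡.cong (F^ (k ∸ 1)) q) back)))))
    where
    back : (F^ (k ∸ 1)) (F x) ≡ x
    back = orbit-return 1 0<k p

  -- Applying the iterate k - i to the equation shows that k + (j - i) is a period of x; so k
  -- divides j - i, which is less than k.
  orbit-injective-≤ : ∀ {k x} → IsMinPeriod k x → ∀ {i j} → i ≤ j → j < k → (F^ i) x ≡ (F^ j) x → i ≡ j
  orbit-injective-≤ {k} {x} P@(_ , p , _) {i} {j} i≤j j<k e = ℕ.≤-antisym i≤j (ℕ.m∸n≡0⇒m≤n (small (∣m+n∣m⇒∣n
    (≡.subst (k ∣_) rearrange (minPeriod-∣ P returns)) ∣-refl)))
    where
    i≤k = ℕ.≤-trans i≤j (ℕ.<⇒≤ j<k)
    returns : (F^ (k ∸ i ℕ.+ j)) x ≡ x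
    returns = ≡.trans (F^-+ (k ∸ i) j x) (≡.trans (≡.cong (F^ (k ∸ i)) (≡.sym e)) (orbit-return i i≤k p))
    rearrange : k ∸ i ℕ.+ j ≡ k ℕ.+ (j ∸ i)
    rearrange = ≡.trans (≡.sym (ℕ.+-∸-comm j i≤k)) (ℕ.+-∸-assoc k i≤j)
    small : k ∣ j ∸ i → j ∸ i ≡ 0
    small k∣d with j ∸ i | ℕ.m∸n≤m j i
    ... | zero  | _   = ≡.refl
    ... | suc d | d≤j = contradiction (∣⇒≤ k∣d) (ℕ.<⇒≱ (ℕ.≤-<-trans d≤j j<k))

  orbit-injective : ∀ {k x} → IsMinPeriod k x → ∀ {i j} → i < k → j < k → (F^ i) x ≡ (F^ j) x → i ≡ j
  orbit-injective P {i} {j} i<k j<k e with ℕ.≤-total i j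
  ... | inj₁ i≤j = orbit-injective-≤ P i≤j j<k e
  ... | inj₂ j≤i = ≡.sym (orbit-injective-≤ P j≤i i<k (≡.sym e))

  F^-closed : ∀ {p} (P : A → Set p) → (∀ {x} → P x → P (F x)) → ∀ m {x} → P x → P ((F^ m) x)
  F^-closed P closed zero    Px = Px
  F^-closed P closed (suc m) Px = closed (F^-closed P closed m Px)

  -- Serves both counts: cycles of a map on `Fin m`, and primes, where F is rotation of edge
  -- sequences. A class is an orbit, and `orbit-injective` gives it exactly k elements.
  orbits-length : ∀ {r} {R : A → A → Set r} (R? : Decidable₂ R) k {xs} → Unique xs →
    (∀ {x} → x ∈ xs → IsMinPeriod k x) → (∀ {x} → x ∈ xs → F x ∈ xs) →
    (∀ {x y} → x ∈ xs → R x y → ∃ λ (m : Fin k) → y ≡ (F^ toℕ m) x) →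
    (∀ {x} → x ∈ xs → ∀ (m : Fin k) → R x ((F^ toℕ m) x)) →
    length xs ≡ length (deduplicate R? xs) ℕ.* k
  -- A minimal period is positive, so for k = 0 the list is empty and both sides are 0.
  orbits-length {R = R} R? zero    {[]}     _ _ _ _ _ = ≡.refl
  orbits-length {R = R} R? zero    {x ∷ xs} _ min _ _ _ with () ← proj₁ (min (here ≡.refl))
  orbits-length {R = R} R? k@(suc _) {xs} uxs min closed R⇒orbit orbit⇒R =
    Representatives.length-deduplicate {V = _∈ xs} R? (λ x∈ → R-orbit x∈ 0) euclidean k
      (All.tabulate id) class-size
    where
    R-orbit : ∀ {x} → x ∈ xs → ∀ m → R x ((F^ m) x)
    -- `orbit⇒R` covers exponents below k only; any other exponent is reduced modulo k.
    R-orbit {x} x∈ m = ≡.subst (R x)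
      (≡.sym (≡.trans (F^-% (proj₁ (proj₂ (min x∈))) m) (≡.cong (λ l → (F^ l) x) (≡.sym (Fin.toℕ-fromℕ< (m%n<n m k))))))
      (orbit⇒R x∈ (fromℕ< (m%n<n m k)))

    euclidean : ∀ {x y z} → x ∈ xs → y ∈ xs → z ∈ xs → R x z → R y z → R x y
    euclidean {x} {y} x∈ y∈ z∈ Rxz Ryz with R⇒orbit x∈ Rxz | R⇒orbit y∈ Ryz
    ... | i , ≡.refl | j , e = ≡.subst (R x) return (R-orbit x∈ (k ∸ toℕ j ℕ.+ toℕ i))
      where
      return : (F^ (k ∸ toℕ j ℕ.+ toℕ i)) x ≡ y
      return = ≡.trans (F^-+ (k ∸ toℕ j) (toℕ i) x) (≡.trans (≡.cong (F^ (k ∸ toℕ j)) e)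
        (orbit-return (toℕ j) (ℕ.<⇒≤ (Fin.toℕ<n j)) (proj₁ (proj₂ (min y∈)))))

    class-size : ∀ {x} → x ∈ xs → length (filter (R? x) xs) ≡ k
    class-size {x} x∈ = ≡.trans (unique-length (Unique.filter⁺ (R? x) uxs)
      (Unique.map⁺ (λ {i} {j} e → Fin.toℕ-injective (orbit-injective (min x∈) (Fin.toℕ<n i) (Fin.toℕ<n j) e))
        (Unique.allFin⁺ k))
      to from) (≡.trans (List.length-map orbit (allFin k)) (List.length-tabulate id))
      where
      orbit : Fin k → A
      orbit m = (F^ toℕ m) x
      to : ∀ {y} → y ∈ filter (R? x) xs → y ∈ map orbit (allFin k)
      to {y} y∈ with R⇒orbit {x} {y} x∈ (proj₂ (∈-filter⁻ (R? x) {xs = xs} y∈))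
      ... | m , ≡.refl = ∈-map⁺ orbit (∈-allFin m)
      from : ∀ {y} → y ∈ map orbit (allFin k) → y ∈ filter (R? x) xs
      from {y} y∈ with ∈-map⁻ orbit {y} {allFin k} y∈
      ... | m , _ , ≡.refl = ∈-filter⁺ (R? x) (F^-closed (_∈ xs) closed (toℕ m) {x} x∈) (orbit⇒R x∈ m)

  -- Every x with Fⁿ x = x has exactly one minimal period, which divides n.
  length-by-period : ∀ n xs → 0 < n → (∀ {x} → x ∈ xs → (F^ n) x ≡ x) →
    length xs ≡ ℕΣ.sum {n} (λ k → length (filter (isMinPeriod? (suc (toℕ k))) xs))
  length-by-period n@(suc _) xs 0<n period =
    length-partition (λ k → isMinPeriod? (suc (toℕ k))) xs classify
    where
    classify : ∀ {x} → x ∈ xs → ∃ λ (k : Fin n) → IsMinPeriod (suc (toℕ k)) x × (∀ j → IsMinPeriod (suc (toℕ j)) x → j ≡ k)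
    classify {x} x∈ with minPeriod-exists n 0<n (period x∈)
    ... | zero  , () , _
    ... | suc k , P = fromℕ< k<n , ≡.subst (λ l → IsMinPeriod (suc l) x) (≡.sym (Fin.toℕ-fromℕ< k<n)) P ,
      λ j Q → Fin.toℕ-injective (≡.trans (ℕ.suc-injective (minPeriod-unique Q P)) (≡.sym (Fin.toℕ-fromℕ< k<n)))
      where k<n = ∣⇒≤ (minPeriod-∣ P (period x∈))

divisorSum : ℕ → (ℕ → ℕ) → ℕ
divisorSum n h = ℕΣ.sum {n} (λ k → if does (suc (toℕ k) ∣? n) then h (suc (toℕ k)) else 0)

module _ {m : ℕ} (F : Fin m → Fin m) where
  open Iteration Fin._≟_ F
  open SelfMap F using (InZ; OnCycleOfLength; onCycleOfLength?; SameCycle; sameCycle?; cycleCount)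

  -- The orbit of i is itself a subset permuted by F, with F^(k - 1) as inverse, and so witnesses
  -- membership in the union of all such subsets.
  minPeriod⇒InZ : ∀ {k i} → IsMinPeriod k i → InZ i
  minPeriod⇒InZ {k} {i} (0<k , p , _) = orbit , (closed , injective , surjective) , ∈-orbit 0
    where
    orbit = Vec.tabulate (λ j → does (sameCycle? k i j))

    ∈⇒ : ∀ {j} → j Subset.∈ orbit → SameCycle k i j
    ∈⇒ {j} j∈ with sameCycle? k i j | ≡.trans (≡.sym (Vec.lookup∘tabulate _ j)) (Vec.[]=⇒lookup j∈)
    ... | yes found | _ = found

    ⇒∈ : ∀ {j} → SameCycle k i j → j Subset.∈ orbit
    ⇒∈ {j} found = Vec.lookup⇒[]= j orbit (≡.trans (Vec.lookup∘tabulate _ j) (dec-true (sameCycle? k i j) found))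

    ∈-orbit : ∀ l → (F^ l) i Subset.∈ orbit
    ∈-orbit l = ⇒∈ (fromℕ< l%k<k , ≡.trans (F^-% p l) (≡.cong (λ l → (F^ l) i) (≡.sym (Fin.toℕ-fromℕ< l%k<k))))
      where
      instance _ = ℕ.>-nonZero 0<k
      l%k<k = m%n<n l k

    F^k∈ : ∀ {j} → j Subset.∈ orbit → (F^ (k ∸ 1)) (F j) ≡ j
    F^k∈ j∈ with ∈⇒ j∈
    ... | l , ≡.refl = orbit-return 1 0<k (orbit-period {k} (toℕ l) p)

    closed : ∀ j → j Subset.∈ orbit → F j Subset.∈ orbit
    closed j j∈ with ∈⇒ j∈
    ... | l , ≡.refl = ∈-orbit (suc (toℕ l))

    injective : ∀ j l → j Subset.∈ orbit → l Subset.∈ orbit → F j ≡ F l → j ≡ l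
    injective j l j∈ l∈ e = ≡.trans (≡.sym (F^k∈ j∈)) (≡.trans (≡.cong (F^ (k ∸ 1)) e) (F^k∈ l∈))

    surjective : ∀ j → j Subset.∈ orbit → ∃ λ l → l Subset.∈ orbit × F l ≡ j
    surjective j j∈ with ∈⇒ j∈
    ... | l , ≡.refl = (F^ (k ∸ 1 ℕ.+ toℕ l)) i , ∈-orbit (k ∸ 1 ℕ.+ toℕ l) ,
      ≡.trans (≡.cong (λ n → (F^ (n ℕ.+ toℕ l)) i) (ℕ.m+[n∸m]≡n 0<k)) (≡.trans (F^-+ k (toℕ l) i) (orbit-period {k} (toℕ l) p))

  cycleCount-length : ∀ k → length (filter (onCycleOfLength? k) (allFin m)) ≡ cycleCount k ℕ.* k
  cycleCount-length k = orbits-length (sameCycle? k) k (Unique.filter⁺ (onCycleOfLength? k) (Unique.allFin⁺ m))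
    (λ i∈ → proj₂ (onCycle i∈)) closed (λ _ → id) (λ _ l → l , ≡.refl)
    where
    onCycle : ∀ {i} → i ∈ filter (onCycleOfLength? k) (allFin m) → OnCycleOfLength k i
    onCycle i∈ = proj₂ (∈-filter⁻ (onCycleOfLength? k) {xs = allFin m} i∈)
    closed : ∀ {i} → i ∈ filter (onCycleOfLength? k) (allFin m) → F i ∈ filter (onCycleOfLength? k) (allFin m)
    closed {i} i∈ = ∈-filter⁺ (onCycleOfLength? k) (∈-allFin (F i)) (minPeriod⇒InZ P , P)
      where P = minPeriod-suc (proj₂ (onCycle i∈))

  -- Fixed points of Fⁿ are sorted by minimal period k; for k ∣ n these are exactly the points on
  -- k-cycles.
  count-fixed : ∀ n → 0 < n →
    length (filter (λ i → (F^ n) i Fin.≟ i) (allFin m)) ≡ divisorSum n (λ k → cycleCount k ℕ.* k)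
  count-fixed n 0<n = ≡.trans (length-by-period n fixed 0<n (λ i∈ → proj₂ (∈-filter⁻ fixed? {xs = allFin m} i∈)))
    (ℕΣ.sum-cong-≗ {n} λ k → term (suc (toℕ k)))
    where
    fixed? = λ i → (F^ n) i Fin.≟ i
    fixed  = filter fixed? (allFin m)
    term : ∀ k → length (filter (isMinPeriod? k) fixed) ≡ (if does (k ∣? n) then cycleCount k ℕ.* k else 0)
    term k with k ∣? n
    ... | no k∤n  = ≡.cong length (List.filter-none (isMinPeriod? k) (All.tabulate λ i∈ P →
      k∤n (minPeriod-∣ P (proj₂ (∈-filter⁻ fixed? {xs = allFin m} i∈)))))
    ... | yes k∣n = ≡.trans (unique-length (Unique.filter⁺ (isMinPeriod? k) (Unique.filter⁺ fixed? (Unique.allFin⁺ m)))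
      (Unique.filter⁺ (onCycleOfLength? k) (Unique.allFin⁺ m)) to from) (cycleCount-length k)
      where
      to : ∀ {i} → i ∈ filter (isMinPeriod? k) fixed → i ∈ filter (onCycleOfLength? k) (allFin m)
      to {i} i∈ = let P = proj₂ (∈-filter⁻ (isMinPeriod? k) {xs = fixed} i∈) in
        ∈-filter⁺ (onCycleOfLength? k) (∈-allFin i) (minPeriod⇒InZ P , P)
      from : ∀ {i} → i ∈ filter (onCycleOfLength? k) (allFin m) → i ∈ filter (isMinPeriod? k) fixed
      from {i} i∈ = let P = proj₂ (proj₂ (∈-filter⁻ (onCycleOfLength? k) {xs = allFin m} i∈)) in
        ∈-filter⁺ (isMinPeriod? k) (∈-filter⁺ fixed? (∈-allFin i) (∣⇒F^ (proj₁ (proj₂ P)) k∣n)) P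

-- Closed walks and primes

module _ {a} {A : Set a} where

  ++-prefix : ∀ (p q s r : List A) → p ++ s ≡ q ++ r → length p ≤ length q → ∃ λ q′ → q ≡ p ++ q′
  ++-prefix []      q       s r e _         = q , ≡.refl
  ++-prefix (x ∷ p) (y ∷ q) s r e (s≤s p≤q) with ++-prefix p q s r (List.∷-injectiveʳ e) p≤q
  ... | q′ , ≡.refl = q′ , ≡.cong (_∷ p ++ q′) (≡.sym (List.∷-injectiveˡ e))

  copies : ℕ → List A → List A
  copies m p = concat (replicate m p)

  length-copies : ∀ m p → length (copies m p) ≡ m ℕ.* length p
  length-copies zero    p = ≡.refl
  length-copies (suc m) p = ≡.trans (List.length-++ p) (≡.cong (length p ℕ.+_) (length-copies m p))

  -- Commuting words are powers of a common word. Here the length of p divides that of q, so p can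
  -- be stripped from the front of q and the remainder still commutes with p.
  commuting⇒copies : ∀ m (p q : List A) → p ++ q ≡ q ++ p → length q ≡ m ℕ.* length p → q ≡ copies m p
  commuting⇒copies zero    p []      e l = ≡.refl
  commuting⇒copies (suc m) p q       e l with ++-prefix p q q p e (ℕ.≤-trans (ℕ.m≤m+n _ _) (ℕ.≤-reflexive (≡.sym l)))
  ... | q′ , ≡.refl = ≡.cong (p ++_) (commuting⇒copies m p q′
    (List.++-cancelˡ p _ _ (≡.trans e (List.++-assoc p q′ p)))
    (ℕ.+-cancelˡ-≡ (length p) _ _ (≡.trans (≡.sym (List.length-++ p)) l)))

  copies-rotate : ∀ m y (us : List A) → copies m (y ∷ us) ++ y ∷ [] ≡ y ∷ copies m (us ++ y ∷ [])
  copies-rotate zero    y us = ≡.refl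
  copies-rotate (suc m) y us = ≡.cong (y ∷_) (≡.trans (List.++-assoc us _ _)
    (≡.trans (≡.cong (us ++_) (copies-rotate m y us)) (≡.sym (List.++-assoc us (y ∷ []) _))))

  toList-injective : ∀ {c d : List⁺ A} → toList c ≡ toList d → c ≡ d
  toList-injective {_ ∷ _} {_ ∷ _} ≡.refl = ≡.refl

  rotate : List⁺ A → List⁺ A
  rotate (y ∷ [])     = y ∷ []
  rotate (y ∷ z ∷ ys) = z ∷ ys ++ y ∷ []

  toList-rotate : ∀ y ys → toList (rotate (y ∷ ys)) ≡ ys ++ y ∷ []
  toList-rotate y []       = ≡.refl
  toList-rotate y (_ ∷ _) = ≡.refl

  rotate^-++ : ∀ us vs c → toList c ≡ us ++ vs → toList (fold c rotate (length us)) ≡ vs ++ us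
  rotate^-++ []       vs c        e = ≡.trans e (≡.sym (List.++-identityʳ vs))
  rotate^-++ (u ∷ us) vs (y ∷ ys) e = begin
    toList (fold c rotate (suc (length us)))    ≡⟨ ≡.cong (λ n → toList (fold c rotate n)) (ℕ.+-comm 1 (length us)) ⟩
    toList (fold c rotate (length us ℕ.+ 1))    ≡⟨ ≡.cong toList (fold-+ c rotate (length us)) ⟩
    toList (fold (rotate c) rotate (length us)) ≡⟨ rotate^-++ us (vs ++ u ∷ []) (rotate c) rotated ⟩
    (vs ++ u ∷ []) ++ us                        ≡⟨ List.++-assoc vs (u ∷ []) us ⟩
    vs ++ u ∷ us                                ∎
    where
    open ≡.≡-Reasoning
    c = y ∷ ys
    rotated : toList (rotate c) ≡ us ++ vs ++ u ∷ []
    rotated = ≡.trans (toList-rotate y ys) (≡.trans (≡.cong₂ (λ w ws → ws ++ w ∷ []) (List.∷-injectiveˡ e)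
      (List.∷-injectiveʳ e))
      (List.++-assoc us vs (u ∷ [])))

  -- Identifies iterated rotation with the `drop` and `take` form in which `_∼_` is defined.
  rotate^ : ∀ {m} c → m ≤ List⁺.length c → toList (fold c rotate m) ≡ drop m (toList c) ++ take m (toList c)
  rotate^ {m} c m≤c = ≡.subst (λ n → toList (fold c rotate n) ≡ drop m (toList c) ++ take m (toList c))
    (≡.trans (List.length-take m (toList c)) (ℕ.m≤n⇒m⊓n≡m (≡.subst (m ≤_) (length-toList c) m≤c)))
    (rotate^-++ (take m (toList c)) (drop m (toList c)) c (≡.sym (List.take++drop≡id m (toList c))))
    where
    length-toList : ∀ c → List⁺.length c ≡ length (toList c)
    length-toList (_ ∷ _) = ≡.refl

  length-rotate : ∀ c → List⁺.length (rotate c) ≡ List⁺.length c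
  length-rotate (y ∷ [])     = ≡.refl
  length-rotate (y ∷ z ∷ ys) = ≡.cong suc (≡.trans (List.length-++ ys) (ℕ.+-comm (length ys) 1))

  rotate^-length : ∀ c → fold c rotate (List⁺.length c) ≡ c
  rotate^-length c@(y ∷ ys) = toList-injective (rotate^-++ (y ∷ ys) [] c (≡.sym (List.++-identityʳ (y ∷ ys))))

  -- power m c is the (m+1)-st power of c.
  power : ℕ → List⁺ A → List⁺ A
  power m (y ∷ ys) = y ∷ ys ++ copies m (y ∷ ys)

  toList-power : ∀ m c → toList (power m c) ≡ copies (suc m) (toList c)
  toList-power m (y ∷ ys) = ≡.refl

  length-power : ∀ m c → List⁺.length (power m c) ≡ suc m ℕ.* List⁺.length c
  length-power m (y ∷ ys) = length-copies (suc m) (y ∷ ys)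

  power-injective : ∀ m {c d} → power m c ≡ power m d → c ≡ d
  power-injective m {c@(y ∷ ys)} {d@(z ∷ zs)} e = toList-injective (cancel (y ∷ ys) (z ∷ zs)
    (ℕ.*-cancelˡ-≡ _ _ (suc m) (≡.trans (≡.sym (length-power m c)) (≡.trans (≡.cong List⁺.length e) (length-power m d))))
    (≡.cong toList e))
    where
    cancel : ∀ (us vs : List A) {ws xs} → length us ≡ length vs → us ++ ws ≡ vs ++ xs → us ≡ vs
    cancel []       []       _ _ = ≡.refl
    cancel (u ∷ us) (v ∷ vs) l e = ≡.cong₂ _∷_ (List.∷-injectiveˡ e) (cancel us vs (ℕ.suc-injective l) (List.∷-injectiveʳ e))

  rotate-power : ∀ m c → rotate (power m c) ≡ power m (rotate c)
  rotate-power m (y ∷ ys) = toList-injective (begin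
    toList (rotate (power m (y ∷ ys)))      ≡⟨ toList-rotate y (ys ++ copies m (y ∷ ys)) ⟩
    (ys ++ copies m (y ∷ ys)) ++ y ∷ []     ≡⟨ List.++-assoc ys _ _ ⟩
    ys ++ copies m (y ∷ ys) ++ y ∷ []       ≡⟨ ≡.cong (ys ++_) (copies-rotate m y ys) ⟩
    ys ++ y ∷ copies m (ys ++ y ∷ [])       ≡⟨ List.++-assoc ys (y ∷ []) _ ⟨
    copies (suc m) (ys ++ y ∷ [])           ≡⟨ ≡.cong (copies (suc m)) (toList-rotate y ys) ⟨
    copies (suc m) (toList (rotate (y ∷ ys))) ≡⟨ toList-power m (rotate (y ∷ ys)) ⟨
    toList (power m (rotate (y ∷ ys)))      ∎)
    where open ≡.≡-Reasoning

  rotate^-power : ∀ m c j → fold (power m c) rotate j ≡ power m (fold c rotate j)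
  rotate^-power m c zero    = ≡.refl
  rotate^-power m c (suc j) = ≡.trans (≡.cong rotate (rotate^-power m c j)) (rotate-power m (fold c rotate j))

  -- Cut c = r s with r of length k. Invariance under rotation by k says r s = s r, so s consists of
  -- m copies of r by `commuting⇒copies`.
  rotation-root : ∀ k m c → 0 < k → List⁺.length c ≡ suc m ℕ.* k → fold c rotate k ≡ c →
    ∃ λ r → List⁺.length r ≡ k × c ≡ power m r
  rotation-root (suc k) m c@(y ∷ ys) _ l e = r , length-r ,
    toList-injective (≡.trans (≡.sym c≡r++s) (≡.cong (toList r ++_) (commuting⇒copies m (toList r) s commute length-s)))
    where
    r = y ∷ take k ys
    s = drop k ys
    k≤ys : k ≤ length ys
    k≤ys = ℕ.≤-pred (ℕ.≤-trans (ℕ.m≤m+n (suc k) (m ℕ.* suc k)) (ℕ.≤-reflexive (≡.sym l)))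
    length-r : List⁺.length r ≡ suc k
    length-r = ≡.cong suc (≡.trans (List.length-take k ys) (ℕ.m≤n⇒m⊓n≡m k≤ys))
    c≡r++s : toList r ++ s ≡ y ∷ ys
    c≡r++s = ≡.cong (y ∷_) (List.take++drop≡id k ys)
    commute : toList r ++ s ≡ s ++ toList r
    commute = ≡.trans c≡r++s (≡.trans (≡.cong toList (≡.sym e)) (rotate^ c (s≤s k≤ys)))
    length-s : length s ≡ m ℕ.* length (toList r)
    length-s = ℕ.+-cancelˡ-≡ (suc k) _ _ (begin
      suc k ℕ.+ length s                         ≡⟨ ≡.cong (ℕ._+ length s) length-r ⟨
      length (toList r) ℕ.+ length s             ≡⟨ List.length-++ (toList r) ⟨
      length (toList r ++ s)                     ≡⟨ ≡.cong length c≡r++s ⟩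
      suc (length ys)                            ≡⟨ l ⟩
      suc k ℕ.+ m ℕ.* suc k                      ≡⟨ ≡.cong (λ n → suc k ℕ.+ m ℕ.* n) length-r ⟨
      suc k ℕ.+ m ℕ.* length (toList r)          ∎)
      where open ≡.≡-Reasoning

-- Tailless non-backtracking closed walks and primitive cycles

module ClosedWalks {a b} (Γ : AbstractIsogenyGraph a b) (fin : Finite Γ) where
  open AbstractIsogenyGraph Γ
  open Finite fin
  open Primes Γ fin
  private
    module EX = Enumeration enumX
    module EY = Enumeration enumY

  Step : Y → Y → Set (a ⊔ b)
  Step y z = s z ≡ t y × z ≢ J y

  step? : ∀ y z → Dec (Step y z)
  step? y z = s z EX.≟ t y ×-dec ¬? (z EY.≟ J y)

  -- The step into z is included. Hence `Walk y ys y` contains the wrap-around step from the last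
  -- edge to y, which combines the closing of the cycle with the absence of a tail, and closedness
  -- is invariant under rotation.
  Walk : Y → List Y → Y → Set (a ⊔ b)
  Walk y []       z = Step y z
  Walk y (w ∷ ws) z = Step y w × Walk w ws z

  walk? : ∀ y ws z → Dec (Walk y ws z)
  walk? y []       z = step? y z
  walk? y (w ∷ ws) z = step? y w ×-dec walk? w ws z

  Closed : EdgeSeq → Set (a ⊔ b)
  Closed (y ∷ ys) = Walk y ys y

  closed? : ∀ c → Dec (Closed c)
  closed? (y ∷ ys) = walk? y ys y

  last-∷ : ∀ (y w : Y) ws → List⁺.last (y ∷ w ∷ ws) ≡ List⁺.last (w ∷ ws)
  last-∷ y w ws with List.initLast ws
  ... | List.[]       = ≡.refl
  ... | _ List.∷ʳ′ _ = ≡.refl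

  walk⁺ : ∀ y ys z → IsPath (y ∷ ys) → NonBacktracking (y ∷ ys) →
    s z ≡ t (List⁺.last (y ∷ ys)) → z ≢ J (List⁺.last (y ∷ ys)) → Walk y ys z
  walk⁺ y []       z _        _        e ne = e , ne
  walk⁺ y (w ∷ ws) z (p ∷ ps) (n ∷ ns) e ne =
    (p , n) , walk⁺ w ws z ps ns (≡.trans e (≡.cong t (last-∷ y w ws)))
      (λ q → ne (≡.trans q (≡.cong J (≡.sym (last-∷ y w ws)))))

  walk⁻ : ∀ y ys z → Walk y ys z → IsPath (y ∷ ys) × NonBacktracking (y ∷ ys) ×
    s z ≡ t (List⁺.last (y ∷ ys)) × z ≢ J (List⁺.last (y ∷ ys))
  walk⁻ y []       z (e , ne)       = [-] , [-] , e , ne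
  walk⁻ y (w ∷ ws) z ((p , n) , wk) with walk⁻ w ws z wk
  ... | ps , ns , e , ne = p ∷ ps , n ∷ ns , ≡.trans e (≡.cong t (≡.sym (last-∷ y w ws))) ,
    λ q → ne (≡.trans q (≡.cong J (last-∷ y w ws)))

  closed⁺ : ∀ c → IsCycle c → NonBacktracking c → ¬ HasTail c → Closed c
  closed⁺ (y ∷ ys) (path , e) nb tailless = walk⁺ y ys y path nb (≡.sym e) tailless

  closed⁻ : ∀ c → Closed c → IsCycle c × NonBacktracking c × ¬ HasTail c
  closed⁻ (y ∷ ys) wk with walk⁻ y ys y wk
  ... | path , nb , e , tailless = (path , ≡.sym e) , nb , tailless

  walk-++⁺ : ∀ y us z vs w → Walk y us z → Walk z vs w → Walk y (us ++ z ∷ vs) w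
  walk-++⁺ y []       z vs w p q        = p , q
  walk-++⁺ y (u ∷ us) z vs w (e , p) q = e , walk-++⁺ u us z vs w p q

  walk-++⁻ : ∀ y us z vs w → Walk y (us ++ z ∷ vs) w → Walk y us z
  walk-++⁻ y []       z vs w (p , _) = p
  walk-++⁻ y (u ∷ us) z vs w (e , p) = e , walk-++⁻ u us z vs w p

  closed-rotate : ∀ {c} → Closed c → Closed (rotate c)
  closed-rotate {y ∷ []}     wk       = wk
  closed-rotate {y ∷ z ∷ ys} (e , wk) = walk-++⁺ z ys y [] z wk e

  closed-power : ∀ m {c} → Closed c → Closed (power m c)
  closed-power m {y ∷ ys} wk = go m
    where
    go : ∀ m → Walk y (ys ++ copies m (y ∷ ys)) y
    go zero    = ≡.subst (λ us → Walk y us y) (≡.sym (List.++-identityʳ ys)) wk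
    go (suc m) = walk-++⁺ y ys y (ys ++ copies m (y ∷ ys)) y wk (go m)

  closed-root : ∀ m {c} → Closed (power m c) → Closed c
  closed-root zero    {y ∷ ys} wk = ≡.subst (λ us → Walk y us y) (List.++-identityʳ ys) wk
  closed-root (suc m) {y ∷ ys} wk = walk-++⁻ y ys y (ys ++ copies m (y ∷ ys)) y wk

  _≟ᶜ_ : DecidableEquality EdgeSeq
  c ≟ᶜ d = map′ toList-injective (≡.cong toList) (List.≡-dec EY._≟_ (toList c) (toList d))

  open Iteration _≟ᶜ_ rotate

  minPeriod-power⁺ : ∀ m {k c} → IsMinPeriod k c → IsMinPeriod k (power m c)
  minPeriod-power⁺ m {k} {c} (0<k , p , minimal) =
    0<k , ≡.trans (rotate^-power m c k) (≡.cong (power m) p) ,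
    λ {j} j<k 0<j q → minimal j<k 0<j (power-injective m (≡.trans (≡.sym (rotate^-power m c j)) q))

  minPeriod-power⁻ : ∀ m {k c} → IsMinPeriod k (power m c) → IsMinPeriod k c
  minPeriod-power⁻ m {k} {c} (0<k , p , minimal) =
    0<k , power-injective m (≡.trans (≡.sym (rotate^-power m c k)) p) ,
    λ {j} j<k 0<j q → minimal j<k 0<j (≡.trans (rotate^-power m c j) (≡.cong (power m) q))

  -- A proper power of d is fixed by rotation through the length of d, which is smaller than that of
  -- c.
  primitive⁺ : ∀ c → Closed c → IsMinPeriod (List⁺.length c) c → Primitive c
  primitive⁺ c closed (_ , _ , minimal) with closed⁻ c closed
  ... | cycle , nb , tailless = cycle , nb , tailless , notPower
    where
    notPower : ¬ IsProperPower c
    notPower (d , suc f , _ , s≤s (s≤s z≤n) , e) with toList-injective {c = c} {power f d}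
      (≡.trans e (≡.sym (toList-power f d)))
    ... | ≡.refl = minimal {List⁺.length d} shorter ℕ.z<s
      (≡.trans (rotate^-power f d (List⁺.length d)) (≡.cong (power f) (rotate^-length d)))
      where
      shorter : List⁺.length d < List⁺.length (power f d)
      shorter = ≡.subst (List⁺.length d <_) (≡.sym (length-power f d)) (ℕ.m<m+n (List⁺.length d) ℕ.z<s)

  primitive-power : ∀ m {r k} → IsMinPeriod k (power m r) → List⁺.length (power m r) ≡ suc m ℕ.* k →
    Primitive (power m r) → Closed (power m r) × IsMinPeriod (List⁺.length (power m r)) (power m r)
  primitive-power zero {r} {k} P l (cycle , nb , tailless , _) =
    closed⁺ (power 0 r) cycle nb tailless ,
    ≡.subst (λ n → IsMinPeriod n (power 0 r)) (≡.sym (≡.trans l (ℕ.*-identityˡ k))) P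
  primitive-power (suc m) {r} _ _ (cycle , nb , tailless , notPower) = contradiction
    (r , suc (suc m) , proj₁ (closed⁻ r (closed-root (suc m) {r} (closed⁺ (power (suc m) r) cycle nb tailless))) ,
      s≤s (s≤s z≤n) , toList-power (suc m) r) notPower

  -- The minimal rotation period k divides the length of c, so c is the (m+1)-st power of some r of
  -- length k. For m > 0 the root r is again closed, hence a cycle, and c would be a proper power.
  primitive⁻ : ∀ c → Primitive c → Closed c × IsMinPeriod (List⁺.length c) c
  primitive⁻ c prim with minPeriod-exists (List⁺.length c) ℕ.z<s (rotate^-length c)
  ... | k , P@(0<k , p , _) with minPeriod-∣ P (rotate^-length c)
  ...   | divides (suc m) l with rotation-root k m c 0<k l p
  ...     | r , length-r , ≡.refl = primitive-power m P l prim

  ∈-elements : ∀ y → y ∈ EY.elements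
  ∈-elements y = ≡.subst (_∈ EY.elements) (Inverse.strictlyInverseʳ enumY y) (∈-map⁺ EY.elem (∈-allFin (EY.index y)))

  elements-unique : Unique EY.elements
  elements-unique = Unique.map⁺ (λ {i} {j} e → ≡.trans (≡.sym (Inverse.strictlyInverseˡ enumY i))
    (≡.trans (≡.cong EY.index e) (Inverse.strictlyInverseˡ enumY j))) (Unique.allFin⁺ _)

  ∈-words : ∀ ys → ys ∈ words (length ys)
  ∈-words []       = here ≡.refl
  ∈-words (y ∷ ys) = ∈-cartesianProductWith⁺ _∷_ (∈-elements y) (∈-words ys)

  length-word : ∀ n {ys} → ys ∈ words n → length ys ≡ n
  length-word zero    (here ≡.refl) = ≡.refl
  length-word (suc n) ys∈ with ∈-cartesianProductWith⁻ _∷_ EY.elements (words n) ys∈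
  ... | y , zs , _ , zs∈ , ≡.refl = ≡.cong suc (length-word n zs∈)

  words-unique : ∀ n → Unique (words n)
  words-unique zero    = [] ∷ []
  words-unique (suc n) = Unique.cartesianProductWith⁺ _∷_ List.∷-injective elements-unique (words-unique n)

  ∈-edgeSeqs : ∀ {n} c → List⁺.length c ≡ n → c ∈ edgeSeqs n
  ∈-edgeSeqs (y ∷ ys) ≡.refl = ∈-cartesianProductWith⁺ _∷_ (∈-elements y) (∈-words ys)

  length-edgeSeq : ∀ n {c} → c ∈ edgeSeqs n → List⁺.length c ≡ n
  length-edgeSeq (suc n) c∈ with ∈-cartesianProductWith⁻ _∷_ EY.elements (words n) c∈
  ... | y , ys , _ , ys∈ , ≡.refl = ≡.cong suc (length-word n ys∈)

  edgeSeqs-unique : ∀ n → Unique (edgeSeqs n)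
  edgeSeqs-unique zero    = []
  edgeSeqs-unique (suc n) = Unique.cartesianProductWith⁺ _∷_ (λ { ≡.refl → ≡.refl , ≡.refl }) elements-unique (words-unique n)

  ∈-primitives : ∀ n {c} → c ∈ filter primitive? (edgeSeqs n) → List⁺.length c ≡ n × Closed c × IsMinPeriod n c
  ∈-primitives n c∈ with ∈-filter⁻ primitive? {xs = edgeSeqs n} c∈
  ... | c∈′ , prim with length-edgeSeq n c∈′ | primitive⁻ _ prim
  ...   | ≡.refl | closed , P = ≡.refl , closed , P

  primitives-∈ : ∀ {n c} → List⁺.length c ≡ n → Closed c → IsMinPeriod n c → c ∈ filter primitive? (edgeSeqs n)
  primitives-∈ {c = c} ≡.refl closed P = ∈-filter⁺ primitive? (∈-edgeSeqs c ≡.refl) (primitive⁺ c closed P)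

  primitives-length : ∀ n → length (filter primitive? (edgeSeqs n)) ≡ length (primes n) ℕ.* n
  primitives-length n = orbits-length _∼?_ n (Unique.filter⁺ primitive? (edgeSeqs-unique n))
    (λ c∈ → proj₂ (proj₂ (∈-primitives n c∈))) rotate-closed to from
    where
    rotate-closed : ∀ {c} → c ∈ filter primitive? (edgeSeqs n) → rotate c ∈ filter primitive? (edgeSeqs n)
    rotate-closed {c} c∈ with ∈-primitives n c∈
    ... | l , closed , P = primitives-∈ (≡.trans (length-rotate c) l) (closed-rotate {c} closed) (minPeriod-suc P)
    to : ∀ {c d} → c ∈ filter primitive? (edgeSeqs n) → c ∼ d → ∃ λ (m : Fin n) → d ≡ (F^ toℕ m) c
    to {c} c∈ (i , e) with proj₁ (∈-primitives n c∈)
    ... | ≡.refl = i , toList-injective (≡.trans e (≡.sym (rotate^ c (ℕ.<⇒≤ (Fin.toℕ<n i)))))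
    from : ∀ {c} → c ∈ filter primitive? (edgeSeqs n) → ∀ (m : Fin n) → c ∼ (F^ toℕ m) c
    from {c} c∈ m with proj₁ (∈-primitives n c∈)
    ... | ≡.refl = m , rotate^ c (ℕ.<⇒≤ (Fin.toℕ<n m))

  count-closed : ∀ n → 0 < n →
    length (filter closed? (edgeSeqs n)) ≡ divisorSum n (λ k → length (primes k) ℕ.* k)
  count-closed n 0<n = ≡.trans (length-by-period n walks 0<n period)
    (ℕΣ.sum-cong-≗ {n} λ k → term (suc (toℕ k)))
    where
    walks = filter closed? (edgeSeqs n)
    ∈-walks : ∀ {c} → c ∈ walks → List⁺.length c ≡ n × Closed c
    ∈-walks c∈ with ∈-filter⁻ closed? {xs = edgeSeqs n} c∈
    ... | c∈′ , closed = length-edgeSeq n c∈′ , closed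
    period : ∀ {c} → c ∈ walks → (F^ n) c ≡ c
    period {c} c∈ with ∈-walks c∈
    ... | ≡.refl , _ = rotate^-length c
    term : ∀ k → length (filter (isMinPeriod? k) walks) ≡ (if does (k ∣? n) then length (primes k) ℕ.* k else 0)
    term k with k ∣? n
    ... | no k∤n = ≡.cong length (List.filter-none (isMinPeriod? k) (All.tabulate λ c∈ P → k∤n (minPeriod-∣ P (period c∈))))
    ... | yes (divides zero n≡0) = contradiction (≡.sym n≡0) (ℕ.<⇒≢ 0<n)
    -- Here n = (m+1) k, and `power m` is a bijection from the primitive cycles of length k to the
    -- closed walks of length n with rotation period k.
    ... | yes (divides (suc m) n≡) = ≡.trans (unique-length
        (Unique.filter⁺ (isMinPeriod? k) (Unique.filter⁺ closed? (edgeSeqs-unique n)))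
        (Unique.map⁺ (power-injective m) (Unique.filter⁺ primitive? (edgeSeqs-unique k))) to from)
      (≡.trans (List.length-map (power m) (filter primitive? (edgeSeqs k))) (primitives-length k))
      where
      to : ∀ {c} → c ∈ filter (isMinPeriod? k) walks → c ∈ map (power m) (filter primitive? (edgeSeqs k))
      to {c} c∈ = ∈-power (∈-walks (proj₁ found)) (proj₂ found)
        where
        found = ∈-filter⁻ (isMinPeriod? k) {xs = walks} c∈
        ∈-power : List⁺.length c ≡ n × Closed c → IsMinPeriod k c → c ∈ map (power m) (filter primitive? (edgeSeqs k))
        ∈-power (l , closed) P with rotation-root k m c (proj₁ P) (≡.trans l n≡) (proj₁ (proj₂ P))
        ... | r , length-r , ≡.refl =
          ∈-map⁺ (power m) (primitives-∈ length-r (closed-root m {r} closed) (minPeriod-power⁻ m P))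
      from : ∀ {c} → c ∈ map (power m) (filter primitive? (edgeSeqs k)) → c ∈ filter (isMinPeriod? k) walks
      from c∈ with ∈-map⁻ (power m) c∈
      ... | r , r∈ , ≡.refl with ∈-primitives k r∈
      ...   | length-r , closed , P = ∈-filter⁺ (isMinPeriod? k) (∈-filter⁺ closed?
        (∈-edgeSeqs (power m r) (≡.trans (length-power m r) (≡.trans (≡.cong (suc m ℕ.*_) length-r) (≡.sym n≡))))
        (closed-power m {r} closed)) (minPeriod-power⁺ m P)

-- Logarithmic derivatives of the zeta function and of the cycle factors

module DerivationOfPowers {c ℓ} {S : CommutativeRing c ℓ} (derivation : Derivation S) where
  open CommutativeRing S
  open Derivation derivation
  open RingOps rawRing using (_^_; _×ₙ_)
  open SemiringMult semiring using (×-assoc-*; ×-congʳ)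
  open RingProperties ring using (-‿distribˡ-*; -‿distribʳ-*)
  open SetoidReasoning setoid

  θ-^ : ∀ {v} → θ v ≈ v → ∀ k → θ (v ^ k) ≈ k ×ₙ v ^ k
  θ-^     θv zero    = θ-1
  θ-^ {v} θv (suc k) = begin
    θ (v * v ^ k)                  ≈⟨ θ-* v (v ^ k) ⟩
    θ v * v ^ k + v * θ (v ^ k)    ≈⟨ +-cong (*-congʳ θv)
      (trans (*-congˡ (θ-^ θv k)) (SemiringMult.×-comm-* semiring k v (v ^ k))) ⟩
    v * v ^ k + k ×ₙ (v * v ^ k)   ∎

  -- p = w / (1 - w).
  θ-one-minus : ∀ {w p} k → θ w ≈ k ×ₙ w → p ≈ w * (1# + p) → θ (1# - w) ≈ - (k ×ₙ p) * (1# - w)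
  θ-one-minus {w} {p} k θw p≈ = begin
    θ (1# - w)                 ≈⟨ θ-+ 1# (- w) ⟩
    θ 1# + θ (- w)             ≈⟨ +-cong θ-1 (trans (θ-neg w) (-‿cong θw)) ⟩
    0# - (k ×ₙ w)              ≈⟨ +-identityˡ _ ⟩
    - (k ×ₙ w)                 ≈⟨ -‿cong (×-congʳ k p*[1-w]≈w) ⟨
    - (k ×ₙ (p * (1# - w)))    ≈⟨ -‿cong (×-assoc-* k p (1# - w)) ⟨
    - ((k ×ₙ p) * (1# - w))    ≈⟨ -‿distribˡ-* _ _ ⟩
    - (k ×ₙ p) * (1# - w)      ∎
    where
    p*[1-w]≈w : p * (1# - w) ≈ w
    p*[1-w]≈w = begin
      p * (1# - w)          ≈⟨ distribˡ p 1# (- w) ⟩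
      p * 1# + p * - w      ≈⟨ +-cong (trans (*-identityʳ p)
        (trans p≈ (trans (distribˡ w 1# p) (+-cong (*-identityʳ w) (*-comm w p)))))
                                 (sym (-‿distribʳ-* p w)) ⟩
      w + p * w - p * w     ≈⟨ +-assoc w _ _ ⟩
      w + (p * w - p * w)   ≈⟨ trans (+-congˡ (-‿inverseʳ _)) (+-identityʳ w) ⟩
      w                     ∎

-- Powers of u and -u, and the factors 1 - vᵏ

module Monomials {c ℓ} (R : CommutativeRing c ℓ) where
  private
    module K = CommutativeRing R
    module KS = SumProperties K.semiring
    module KΣ = SemiringSum K.semiring
    module KM = SemiringMult K.semiring
    module KP = RingProperties K.ring
    module KR = RingOps K.rawRing
  open SeriesRing R
  open LogDerivative R
  open HasLogDeriv
  private
    module S = CommutativeRing seriesRing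
  open Series K.rawRing

  shift : Carrier → Carrier
  shift f zero    = K.0#
  shift f (suc n) = f n

  -- Characterises v = εu by its multiplication, so that u (primes and L) and -u (J) are treated at
  -- once, with ε = 1 and ε = -1.
  record IsShiftBy (ε : K.Carrier) (v : Carrier) : Set (c ⊔ ℓ) where
    constructor shiftBy
    field shifts : ∀ f → v * f ≈ shift (scale ε f)
  open IsShiftBy

  u*-shift : ∀ f → u * f ≈ shift (scale K.1# f)
  u*-shift f zero    = K.trans (K.+-identityʳ _) (K.zeroˡ _)
  u*-shift f (suc n) = K.trans (⊛-suc-0 u f K.refl n) (K.trans
    (⊛-cong {tail u} {1#} {f} {f} (λ { zero → K.refl ; (suc _) → K.refl }) (λ _ → K.refl) n)
    (K.trans (⊛-identityˡ f n) (K.sym (K.*-identityˡ _))))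

  u-shift : IsShiftBy K.1# u
  u-shift = shiftBy u*-shift

  -- Written `- 1# * u`, so that its k-th power splits into `(- 1#) ^ k * u ^ k`, the form in the
  -- theorem.
  -u-shift : IsShiftBy (K.- K.1#) (- 1# * u)
  -u-shift = shiftBy λ f n → K.trans (⊛-assoc (- 1#) u f n)
    (K.trans (RingProperties.-1*x≈-x S.ring (u * f) n) (negated f n))
    where
    negated : ∀ f n → K.- (u * f) n K.≈ shift (scale (K.- K.1#) f) n
    negated f zero    = K.trans (K.-‿cong (u*-shift f 0)) KP.-0#≈0#
    negated f (suc n) = K.trans (K.-‿cong (K.trans (u*-shift f (suc n)) (K.*-identityˡ _))) (K.sym (KP.-1*x≈-x _))

  ×-coeff : ∀ k f n → (k ×ₙ f) n ≡ k KR.×ₙ f n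
  ×-coeff zero    f n = ≡.refl
  ×-coeff (suc k) f n = ≡.cong (f n K.+_) (×-coeff k f n)

  module _ {ε v} (isShift : IsShiftBy ε v) where

    v-coeff : v ≈ shift (scale ε 1#)
    v-coeff n = K.trans (K.sym (S.*-identityʳ v n)) (shifts isShift 1# n)

    θv≈v : θ v ≈ v
    θv≈v zero          = K.sym (v-coeff 0)
    θv≈v (suc zero)    = K.+-identityʳ _
    θv≈v (suc (suc n)) = K.trans (KS.·-zero (suc (suc n)) v≈0) (K.sym v≈0)
      where v≈0 = K.trans (v-coeff (suc (suc n))) (K.zeroʳ ε)

    v^-high : ∀ k f n → (v ^ k * f) (k ℕ.+ n) K.≈ ε KR.^ k K.* f n
    v^-high zero    f n = K.trans (⊛-identityˡ f n) (K.sym (K.*-identityˡ _))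
    v^-high (suc k) f n = K.trans (⊛-assoc v (v ^ k) f (suc k ℕ.+ n)) (K.trans (shifts isShift (v ^ k * f) (suc k ℕ.+ n))
      (K.trans (K.*-congˡ (v^-high k f n)) (K.sym (K.*-assoc _ _ _))))

    v^-low : ∀ k f {j} → j < k → (v ^ k * f) j K.≈ K.0#
    v^-low (suc k) f {zero}  _         = K.trans (⊛-assoc v (v ^ k) f 0) (shifts isShift (v ^ k * f) 0)
    v^-low (suc k) f {suc j} (s≤s j<k) = K.trans (⊛-assoc v (v ^ k) f (suc j))
      (K.trans (shifts isShift (v ^ k * f) (suc j)) (K.trans (K.*-congˡ (v^-low k f j<k)) (K.zeroʳ ε)))

    -- The series vᵏ / (1 - vᵏ).
    multiples : ℕ → Carrier
    multiples k zero    = K.0#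
    multiples k (suc n) = if does (k ∣? suc n) then ε KR.^ suc n else K.0#

    multiples-low : ∀ k {j} → j < k → multiples k j K.≈ K.0#
    multiples-low k {zero}  _   = K.refl
    multiples-low k {suc j} j<k = K.reflexive (if-no (k ∣? suc j) (>⇒∤ j<k))

    -- Below degree k both sides vanish. In degree k + m, k divides k + m exactly if it divides m,
    -- and εᵏ⁺ᵐ = εᵏ εᵐ; in degree k itself the term stems from `1#`, because `multiples` starts
    -- with 0.
    multiples-unroll : ∀ k → 0 < k → multiples k ≈ v ^ k * (1# + multiples k)
    multiples-unroll k@(suc k′) _ n with n ℕ.<? k
    ... | yes n<k = K.trans (multiples-low k n<k) (K.sym (v^-low k (1# + multiples k) n<k))
    ... | no  n≮k = ≡.subst (λ n → multiples k n K.≈ (v ^ k * (1# + multiples k)) n) (ℕ.m+[n∸m]≡n (ℕ.≮⇒≥ n≮k))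
      (K.trans (at (n ∸ k)) (K.sym (v^-high k (1# + multiples k) (n ∸ k))))
      where
      at : ∀ m → multiples k (k ℕ.+ m) K.≈ ε KR.^ k K.* (1# m K.+ multiples k m)
      at zero rewrite ℕ.+-identityʳ k′ = K.trans (K.reflexive (if-yes (k ∣? k) ∣-refl))
        (K.sym (K.trans (K.*-congˡ (K.+-identityʳ _)) (K.*-identityʳ _)))
      at (suc m) = by-divisibility (k ∣? suc m)
        where
        by-divisibility : Dec (k ∣ suc m) → multiples k (k ℕ.+ suc m) K.≈ ε KR.^ k K.* (K.0# K.+ multiples k (suc m))
        by-divisibility (yes k∣m) = K.trans (K.reflexive (if-yes (k ∣? k ℕ.+ suc m) (∣m∣n⇒∣m+n ∣-refl k∣m)))
          (K.trans (SemiringExp.^-homo-* K.semiring ε k (suc m))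
            (K.*-congˡ (K.trans (K.reflexive (≡.sym (if-yes (k ∣? suc m) k∣m))) (K.sym (K.+-identityˡ _)))))
        by-divisibility (no k∤m) = K.trans (K.reflexive (if-no (k ∣? k ℕ.+ suc m) (λ k∣ → k∤m (∣m+n∣m⇒∣n k∣ ∣-refl))))
          (K.sym (K.trans (K.*-congˡ (K.trans (K.+-identityˡ _) (K.reflexive (if-no (k ∣? suc m) k∤m)))) (K.zeroʳ _)))

    logDeriv-factor : ∀ k → 0 < k → HasLogDeriv (1# - v ^ k) (- (k ×ₙ multiples k))
    logDeriv-factor k 0<k =
      K.trans (K.+-congˡ (K.trans (K.-‿cong (K.trans (K.sym (S.*-identityʳ (v ^ k) 0)) (v^-low k 1# 0<k))) KP.-0#≈0#))
        (K.+-identityʳ _) ,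
      DerivationOfPowers.θ-one-minus θ-derivation {v ^ k} {multiples k} k
        (DerivationOfPowers.θ-^ θ-derivation {v} θv≈v k) (multiples-unroll k 0<k)

  logDeriv-productList : ∀ {b} {B : Set b} (F : B → Carrier) {a} {xs} → All (λ x → HasLogDeriv (F x) a) xs →
    HasLogDeriv (productList (map F xs)) (length xs ×ₙ a)
  logDeriv-productList F []       = logDeriv-1
  logDeriv-productList F (h ∷ hs) = logDeriv-* h (logDeriv-productList F hs)

  ×-sumˡ : ∀ {n} (h : Fin n → ℕ) x → ℕΣ.sum h KR.×ₙ x K.≈ KΣ.sum (λ i → h i KR.×ₙ x)
  ×-sumˡ {zero}  h x = K.refl
  ×-sumˡ {suc n} h x = K.trans (KM.×-homo-+ x (h zero) (ℕΣ.sum (h ∘ suc))) (K.+-congˡ (×-sumˡ (h ∘ suc) x))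

  -- N is free because the products from 1 and from 2 lead to sums of different lengths; beyond m >
  -- 0 there are no divisors of m.
  sum-divisors : ∀ m N (h : ℕ → K.Carrier) (e : ℕ → ℕ) x → 0 < m → m ≤ N →
    (∀ k → h (suc k) K.≈ (if does (suc k ∣? m) then e (suc k) else 0) KR.×ₙ x) →
    KΣ.sum {N} (λ i → h (suc (toℕ i))) K.≈ divisorSum m e KR.×ₙ x
  sum-divisors m@(suc _) N h e x _ m≤N h≈ = K.trans
    (KS.sum-truncate-≤ (h ∘ suc) m≤N λ k m≤k → K.trans (h≈ k)
      (K.reflexive (≡.cong (λ b → (if b then e (suc k) else 0) KR.×ₙ x) (dec-false (suc k ∣? m) (>⇒∤ (s≤s m≤k))))))
    (K.trans (KΣ.sum-cong-≋ {m} (λ i → h≈ (toℕ i)))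
      (K.sym (×-sumˡ {m} (λ k → if does (suc (toℕ k) ∣? m) then e (suc (toℕ k)) else 0) x)))

-- fixedByHalf F q n counts the fixed points of F^(q + n/2) for even n and is 0 for odd n.
module _ {m : ℕ} (F : Fin m → Fin m) where

  fixedPoints : ℕ → ℕ
  fixedPoints n = length (filter (λ i → fold i F n Fin.≟ i) (allFin m))

  fixedByHalf : ℕ → ℕ → ℕ
  fixedByHalf q zero          = fixedPoints q
  fixedByHalf q (suc zero)    = 0
  fixedByHalf q (suc (suc n)) = fixedByHalf (suc q) n

  fixedByHalf-parity : ∀ q n →
    (∃ λ p → n ≡ 2 ℕ.* p × fixedByHalf q n ≡ fixedPoints (p ℕ.+ q)) ⊎ (¬ 2 ∣ n × fixedByHalf q n ≡ 0)
  fixedByHalf-parity q zero       = inj₁ (0 , ≡.refl , ≡.refl)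
  fixedByHalf-parity q (suc zero) = inj₂ (>⇒∤ (s≤s (s≤s z≤n)) , ≡.refl)
  fixedByHalf-parity q (suc (suc n)) with fixedByHalf-parity (suc q) n
  ... | inj₁ (p , ≡.refl , e) = inj₁ (suc p , ≡.cong suc (≡.sym (ℕ.+-suc p (p ℕ.+ 0))) , ≡.trans e
    (≡.cong fixedPoints (ℕ.+-suc p q)))
  ... | inj₂ (odd , e) = inj₂ ((λ 2∣ → odd (∣m+n∣m⇒∣n 2∣ ∣-refl)) , e)

module IndexMaps {a b} (Γ : AbstractIsogenyGraph a b) (fin : Finite Γ) where
  open AbstractIsogenyGraph Γ
  open Finite fin
  private
    module EX = Enumeration enumX
    module EY = Enumeration enumY

  ŝ t̂ : Fin ∣Y∣ → Fin ∣X∣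
  ŝ = EX.index ∘ s ∘ EY.elem
  t̂ = EX.index ∘ t ∘ EY.elem

  -- `L̂` and `Ĵ` are definitionally the self-maps whose cycles `C enumX L` and `C enumY J` count,
  -- so `count-fixed` applies to them as it stands.
  L̂ : Fin ∣X∣ → Fin ∣X∣
  L̂ = EX.index ∘ L ∘ EX.elem

  Ĵ : Fin ∣Y∣ → Fin ∣Y∣
  Ĵ = EY.index ∘ J ∘ EY.elem

  elem-indexX : ∀ x → EX.elem (EX.index x) ≡ x
  elem-indexX = Inverse.strictlyInverseʳ enumX

  elem-indexY : ∀ y → EY.elem (EY.index y) ≡ y
  elem-indexY = Inverse.strictlyInverseʳ enumY

  t̂∘Ĵ : ∀ j → t̂ (Ĵ j) ≡ L̂ (ŝ j)
  t̂∘Ĵ j = ≡.cong EX.index (≡.trans (≡.cong t (elem-indexY _)) (≡.trans (t∘J _) (≡.cong L (≡.sym (elem-indexX _)))))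

  ŝ∘Ĵ : ∀ j → ŝ (Ĵ j) ≡ t̂ j
  ŝ∘Ĵ j = ≡.cong EX.index (≡.trans (≡.cong s (elem-indexY _)) (s∘J _))

module LogDerivatives {a b c ℓ} (R : CommutativeRing c ℓ) (torsionFree : TorsionFree R)
                      (Γ : AbstractIsogenyGraph a b) (fin : Finite Γ) where
  private
    module K = CommutativeRing R
    module KS = SumProperties K.semiring
    module KΣ = SemiringSum K.semiring
    module KM = SemiringMult K.semiring
    module KP = RingProperties K.ring
    module KR = RingOps K.rawRing
  open SeriesRing R
  open LogDerivative R
  open Monomials R
  private
    module S = CommutativeRing seriesRing
    module SP = RingProperties S.ring
  open Series K.rawRing
  open Primes Γ fin using (primes; primitive?; edgeSeqs; _∼?_)
  open ClosedWalks Γ fin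
  open IndexMaps Γ fin using (L̂; Ĵ)

  ×-neg : ∀ n f → n ×ₙ (- f) ≈ - (n ×ₙ f)
  ×-neg zero    f j = K.sym KP.-0#≈0#
  ×-neg (suc n) f j = K.trans (K.+-congˡ (×-neg n f j)) (KP.-‿+-comm _ _)

  logDeriv-factor^ : ∀ {f g} n → HasLogDeriv f (- g) → HasLogDeriv (f ^ n) (- (n ×ₙ g))
  logDeriv-factor^ {f} {g} n h = logDeriv-cong {f ^ n} {f ^ n} {n ×ₙ (- g)} (λ _ → K.refl) (×-neg n g) (logDeriv-^ n h)

  logDeriv-factor⁻¹ : ∀ {f g} → HasLogDeriv f (- g) → HasLogDeriv (f ⁻¹) g
  logDeriv-factor⁻¹ {f} {g} h = logDeriv-cong {f ⁻¹} {f ⁻¹} { - (- g)} (λ _ → K.refl) (SP.-‿involutive g) (logDeriv-⁻¹ h)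

  -- The logarithmic derivative of the n-th power of 1 / (1 - vᵏ), if M k is vᵏ / (1 - vᵏ).
  term : (ℕ → Carrier) → ℕ → ℕ → Carrier
  term M n k = n ×ₙ (k ×ₙ M k)

  term-coeff : ∀ M n k j → term M n k j ≡ n KR.×ₙ (k KR.×ₙ M k j)
  term-coeff M n k j = ≡.trans (×-coeff n (k ×ₙ M k) j) (≡.cong (n KR.×ₙ_) (×-coeff k (M k) j))

  term-low : ∀ M n k {j} → M k j K.≈ K.0# → term M n k j K.≈ K.0#
  term-low M n k {j} low = K.trans (K.reflexive (term-coeff M n k j)) (KS.·-zero n (KS.·-zero k low))

  -- A Lambert series: the n-th coefficient of Σ e(k) k vᵏ / (1 - vᵏ) is εⁿ times the sum of k e(k)
  -- over the divisors k of n.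
  multiples-divisorSum : ∀ {ε v} (isShift : IsShiftBy ε v) n N (e : ℕ → ℕ) → suc n ≤ N →
    KΣ.sum {N} (λ i → term (multiples isShift) (e (suc (toℕ i))) (suc (toℕ i)) (suc n))
      K.≈ divisorSum (suc n) (λ k → e k ℕ.* k) KR.×ₙ ε KR.^ suc n
  multiples-divisorSum {ε} isShift n N e 1+n≤N = sum-divisors (suc n) N
    (λ k → term M (e k) k (suc n)) (λ k → e k ℕ.* k) (ε KR.^ suc n) ℕ.z<s 1+n≤N coefficient
    where
    M = multiples isShift
    coefficient : ∀ k → term M (e (suc k)) (suc k) (suc n)
      K.≈ (if does (suc k ∣? suc n) then e (suc k) ℕ.* suc k else 0) KR.×ₙ (ε KR.^ suc n)
    coefficient k = K.trans (K.reflexive (term-coeff M (e (suc k)) (suc k) (suc n))) (by-divisibility (suc k ∣? suc n))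
      where
      by-divisibility : Dec (suc k ∣ suc n) → e (suc k) KR.×ₙ (suc k KR.×ₙ M (suc k) (suc n))
        K.≈ (if does (suc k ∣? suc n) then e (suc k) ℕ.* suc k else 0) KR.×ₙ (ε KR.^ suc n)
      by-divisibility (yes k∣n) = K.trans
        (KM.×-congʳ (e (suc k)) (KM.×-congʳ (suc k) (K.reflexive (if-yes (suc k ∣? suc n) k∣n))))
        (K.trans (KM.×-assocˡ (ε KR.^ suc n) (e (suc k)) (suc k))
          (K.reflexive (≡.cong (KR._×ₙ (ε KR.^ suc n)) (≡.sym (if-yes (suc k ∣? suc n) k∣n)))))
      by-divisibility (no k∤n) = K.trans
        (KS.·-zero (e (suc k)) (KS.·-zero (suc k) (K.reflexive (if-no (suc k ∣? suc n) k∤n))))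
        (K.reflexive (≡.cong (KR._×ₙ (ε KR.^ suc n)) (≡.sym (if-no (suc k ∣? suc n) k∤n))))

  1^n≈1 : ∀ n → K.1# KR.^ n K.≈ K.1#
  1^n≈1 zero    = K.refl
  1^n≈1 (suc n) = K.trans (K.*-identityˡ _) (1^n≈1 n)

  -- The constant term is 0, as it must be for a logarithmic derivative, whereas the trace of Σ uⁿ
  -- Bⁿ starts with the number of edges.
  closedWalkSeries : Carrier
  closedWalkSeries zero    = K.0#
  closedWalkSeries (suc n) = length (filter closed? (edgeSeqs (suc n))) KR.×ₙ K.1#

  logDeriv-ζ : HasLogDeriv (ζ Γ fin) closedWalkSeries
  logDeriv-ζ = logDeriv-cong {ζ Γ fin} {ζ Γ fin} (λ _ → K.refl) coefficients
    (logDeriv-∏≥ torsionFree 1 (λ n → productList (map (λ P → (1# - u ^ List⁺.length P) ⁻¹) (primes n)))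
      A ℕ.z<s (λ k j<k → term-low M (length (primes k)) k (multiples-low u-shift k j<k)) factors)
    where
    M = multiples u-shift
    A : ℕ → Carrier
    A k = term M (length (primes k)) k

    factors : ∀ k → 0 < k → HasLogDeriv (productList (map (λ P → (1# - u ^ List⁺.length P) ⁻¹) (primes k))) (A k)
    factors k 0<k = logDeriv-productList (λ P → (1# - u ^ List⁺.length P) ⁻¹) (All.tabulate λ {P} P∈ →
      ≡.subst (λ l → HasLogDeriv ((1# - u ^ l) ⁻¹) (k ×ₙ M k))
        (≡.sym (proj₁ (∈-primitives k (∈-deduplicate⁻ _∼?_ (filter primitive? (edgeSeqs k)) P∈))))
        (logDeriv-factor⁻¹ (logDeriv-factor u-shift k 0<k)))

    coefficients : (λ n → KΣ.sum {suc n} (λ i → A (1 ℕ.+ toℕ i) n)) ≈ closedWalkSeries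
    coefficients zero    = K.trans (K.+-identityʳ _) (term-low M (length (primes 1)) 1 K.refl)
    coefficients (suc n) = K.trans (multiples-divisorSum u-shift n (suc (suc n)) (length ∘ primes) (ℕ.n≤1+n _))
      (K.trans (KM.×-congʳ (divisorSum (suc n) (λ k → length (primes k) ℕ.* k)) (1^n≈1 (suc n)))
        (K.reflexive (≡.cong (KR._×ₙ K.1#) (≡.sym (count-closed (suc n) ℕ.z<s)))))

  cycleSeries : Carrier
  cycleSeries zero    = K.0#
  cycleSeries (suc n) = K.- ((2 ℕ.* fixedByHalf L̂ 0 (suc n)) KR.×ₙ K.1#)
                        K.+ fixedPoints Ĵ (suc n) KR.×ₙ ((K.- K.1#) KR.^ suc n)

  module _ (cᴸ cᴶ : ℕ → ℕ) where

    lFactor jFactor : ℕ → Carrier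
    lFactor k = (1# - u ^ (2 ℕ.* k)) ^ cᴸ k
    jFactor k = (1# - (- 1#) ^ k * u ^ k) ⁻¹ ^ cᴶ k

    cycleProduct : Carrier
    cycleProduct = (1# - u ^ 2) ^ cᴸ 1 * (1# + u) ⁻¹ ^ cᴶ 1 * ∏≥ 2 (λ k → lFactor k * jFactor k)

    -- The two isolated factors are the case k = 1 of the family, since 1 - (-1)u = 1 + u. So the
    -- sums extend over all k ≥ 1 and turn into divisor sums, which the hypotheses evaluate as
    -- numbers of fixed points.
    logDeriv-cycles : (∀ n → 0 < n → fixedPoints L̂ n ≡ divisorSum n (λ k → cᴸ k ℕ.* k)) →
      (∀ n → 0 < n → fixedPoints Ĵ n ≡ divisorSum n (λ k → cᴶ k ℕ.* k)) → HasLogDeriv cycleProduct cycleSeries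
    logDeriv-cycles fixed-L fixed-J = logDeriv-cong {cycleProduct} {cycleProduct} (λ _ → K.refl) coefficients
      (logDeriv-* {lFactor 1 * jFactor₁} {∏≥ 2 (λ k → lFactor k * jFactor k)} {A 1}
        (logDeriv-* {lFactor 1} {jFactor₁} { - Aᴸ 1} {Aᴶ 1} (L-factor 1 ℕ.z<s) J-factor₁)
        (logDeriv-∏≥ torsionFree 2 (λ k → lFactor k * jFactor k) A ℕ.z<s A-low λ k 0<k →
          logDeriv-* {lFactor k} {jFactor k} { - Aᴸ k} {Aᴶ k} (L-factor k 0<k) (J-factor k 0<k)))
      where
      v = - 1# * u
      jFactor₁ = (1# + u) ⁻¹ ^ cᴶ 1
      Mᴸ Mᴶ : ℕ → Carrier
      Mᴸ = multiples u-shift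
      Mᴶ = multiples -u-shift
      Aᴸ Aᴶ A : ℕ → Carrier
      Aᴸ k = cᴸ k ×ₙ ((2 ℕ.* k) ×ₙ Mᴸ (2 ℕ.* k))
      Aᴶ k = term Mᴶ (cᴶ k) k
      A k = - Aᴸ k + Aᴶ k

      negate : ∀ n → (- (v ^ 1)) n K.≈ u n
      negate n = K.trans (K.-‿cong (K.trans (S.*-identityʳ v n) (SP.-1*x≈-x u n))) (KP.-‿involutive _)

      Aᴸ-coeff : ∀ k j → Aᴸ k j ≡ cᴸ k KR.×ₙ ((2 ℕ.* k) KR.×ₙ Mᴸ (2 ℕ.* k) j)
      Aᴸ-coeff k j = ≡.trans (×-coeff (cᴸ k) ((2 ℕ.* k) ×ₙ Mᴸ (2 ℕ.* k)) j)
        (≡.cong (cᴸ k KR.×ₙ_) (×-coeff (2 ℕ.* k) (Mᴸ (2 ℕ.* k)) j))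

      A-low : ∀ k {j} → j < k → A k j K.≈ K.0#
      A-low k {j} j<k = K.trans (K.+-cong (K.trans (K.-‿cong (K.trans (K.reflexive (Aᴸ-coeff k j))
          (KS.·-zero (cᴸ k) (KS.·-zero (2 ℕ.* k) (multiples-low u-shift (2 ℕ.* k)
            (ℕ.<-≤-trans j<k (ℕ.m≤m+n k (k ℕ.+ 0)))))))) KP.-0#≈0#)
        (term-low Mᴶ (cᴶ k) k (multiples-low -u-shift k j<k))) (K.+-identityʳ _)

      J-factor₁ : HasLogDeriv jFactor₁ (Aᴶ 1)
      J-factor₁ = logDeriv-^ {(1# + u) ⁻¹} (cᴶ 1) (logDeriv-factor⁻¹ {1# + u}
        (logDeriv-cong {1# - v ^ 1} {1# + u} (λ n → K.+-congˡ (negate n)) (λ _ → K.refl) (logDeriv-factor -u-shift 1 ℕ.z<s)))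

      J-factor : ∀ k → 0 < k → HasLogDeriv (jFactor k) (Aᴶ k)
      J-factor k 0<k = logDeriv-^ {(1# - (- 1#) ^ k * u ^ k) ⁻¹} (cᴶ k) (logDeriv-factor⁻¹ {1# - (- 1#) ^ k * u ^ k}
        (logDeriv-cong {1# - v ^ k} {1# - (- 1#) ^ k * u ^ k}
          (λ n → K.+-congˡ (K.-‿cong (CommutativeSemiringExp.^-distrib-* S.commutativeSemiring (- 1#) u k n))) (λ _ → K.refl)
          (logDeriv-factor -u-shift k 0<k)))

      L-factor : ∀ k → 0 < k → HasLogDeriv (lFactor k) (- Aᴸ k)
      L-factor k 0<k = logDeriv-factor^ (cᴸ k) (logDeriv-factor u-shift (2 ℕ.* k) (ℕ.<-≤-trans 0<k (ℕ.m≤m+n k (k ℕ.+ 0))))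

      sum-neg : ∀ {n} (h : Fin n → K.Carrier) → KΣ.sum (λ i → K.- h i) K.≈ K.- KΣ.sum h
      sum-neg {zero}  h = K.sym KP.-0#≈0#
      sum-neg {suc n} h = K.trans (K.+-congˡ (sum-neg (h ∘ suc))) (KP.-‿+-comm _ _)

      -- In odd degree no 2k is a divisor. In degree 2p, 2k divides 2p exactly if k divides p, which
      -- leaves twice the number of fixed points of Lᵖ.
      L-coefficients : ∀ n → KΣ.sum {3 ℕ.+ n} (λ i → Aᴸ (suc (toℕ i)) (suc n)) K.≈ (2 ℕ.* fixedByHalf L̂ 0 (suc n)) KR.×ₙ K.1#
      L-coefficients n with fixedByHalf-parity L̂ 0 (suc n)
      ... | inj₂ (odd , e) = K.trans (KS.sum-zero {3 ℕ.+ n} (λ i → Aᴸ (suc (toℕ i)) (suc n)) λ i → vanish (suc (toℕ i)))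
        (K.reflexive (≡.cong (λ l → (2 ℕ.* l) KR.×ₙ K.1#) (≡.sym e)))
        where
        vanish : ∀ k → Aᴸ k (suc n) K.≈ K.0#
        vanish k = K.trans (K.reflexive (Aᴸ-coeff k (suc n))) (KS.·-zero (cᴸ k) (KS.·-zero (2 ℕ.* k)
          (K.reflexive (if-no ((2 ℕ.* k) ∣? suc n) λ 2k∣ → odd (∣-trans (divides k (ℕ.*-comm 2 k)) 2k∣)))))
      ... | inj₁ (zero , () , _)
      ... | inj₁ (suc p , 1+n≡ , e) = K.trans
        (sum-divisors (suc p) (3 ℕ.+ n) (λ k → Aᴸ k (suc n)) (λ k → cᴸ k ℕ.* k) (2 KR.×ₙ K.1#) ℕ.z<s p≤n coefficient)
        (K.trans (KM.×-assocˡ K.1# total 2) (K.reflexive (≡.cong (KR._×ₙ K.1#) (≡.trans (ℕ.*-comm total 2) (≡.cong (2 ℕ.*_)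
          (≡.sym (≡.trans e (≡.trans (≡.cong (fixedPoints L̂) (ℕ.+-identityʳ (suc p))) (fixed-L (suc p) ℕ.z<s)))))))))
        where
        total = divisorSum (suc p) (λ k → cᴸ k ℕ.* k)
        p≤n : suc p ≤ 3 ℕ.+ n
        p≤n = ℕ.≤-trans (ℕ.m≤m+n (suc p) _) (ℕ.≤-trans (ℕ.≤-reflexive (≡.sym 1+n≡)) (ℕ.m≤n+m (suc n) 2))
        coefficient : ∀ k → Aᴸ (suc k) (suc n)
          K.≈ (if does (suc k ∣? suc p) then cᴸ (suc k) ℕ.* suc k else 0) KR.×ₙ (2 KR.×ₙ K.1#)
        coefficient k = K.trans (K.reflexive (Aᴸ-coeff (suc k) (suc n))) (by-divisibility (suc k ∣? suc p))
          where
          by-divisibility : Dec (suc k ∣ suc p) → cᴸ (suc k) KR.×ₙ ((2 ℕ.* suc k) KR.×ₙ Mᴸ (2 ℕ.* suc k) (suc n))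
            K.≈ (if does (suc k ∣? suc p) then cᴸ (suc k) ℕ.* suc k else 0) KR.×ₙ (2 KR.×ₙ K.1#)
          by-divisibility (yes k∣p) = K.trans
            (KM.×-congʳ (cᴸ (suc k)) (K.trans (KM.×-congʳ (2 ℕ.* suc k) (K.trans
              (K.reflexive (if-yes ((2 ℕ.* suc k) ∣? suc n)
                (≡.subst ((2 ℕ.* suc k) ∣_) (≡.sym 1+n≡) (*-monoʳ-∣ 2 k∣p)))) (1^n≈1 (suc n))))
              (K.trans (K.reflexive (≡.cong (KR._×ₙ K.1#) (ℕ.*-comm 2 (suc k)))) (K.sym (KM.×-assocˡ K.1# (suc k) 2)))))
            (K.trans (KM.×-assocˡ (2 KR.×ₙ K.1#) (cᴸ (suc k)) (suc k))
              (K.reflexive (≡.cong (KR._×ₙ (2 KR.×ₙ K.1#)) (≡.sym (if-yes (suc k ∣? suc p) k∣p)))))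
          by-divisibility (no k∤p) = K.trans
            (KS.·-zero (cᴸ (suc k)) (KS.·-zero (2 ℕ.* suc k) (K.reflexive (if-no ((2 ℕ.* suc k) ∣? suc n)
              λ 2k∣ → k∤p (*-cancelˡ-∣ 2 (≡.subst ((2 ℕ.* suc k) ∣_) 1+n≡ 2k∣))))))
            (K.reflexive (≡.cong (KR._×ₙ (2 KR.×ₙ K.1#)) (≡.sym (if-no (suc k ∣? suc p) k∤p))))

      J-coefficients : ∀ n → KΣ.sum {3 ℕ.+ n} (λ i → Aᴶ (suc (toℕ i)) (suc n))
        K.≈ fixedPoints Ĵ (suc n) KR.×ₙ ((K.- K.1#) KR.^ suc n)
      J-coefficients n = K.trans (multiples-divisorSum -u-shift n (3 ℕ.+ n) (cᴶ) (ℕ.m≤n+m (suc n) 2))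
        (K.reflexive (≡.cong (KR._×ₙ ((K.- K.1#) KR.^ suc n)) (≡.sym (fixed-J (suc n) ℕ.z<s))))

      coefficients : (- Aᴸ 1 + Aᴶ 1 + (λ n → KΣ.sum {suc n} (λ i → A (2 ℕ.+ toℕ i) n))) ≈ cycleSeries
      coefficients zero    = K.trans (K.+-cong (A-low 1 ℕ.z<s) (K.trans (K.+-identityʳ _) (A-low 2 ℕ.z<s))) (K.+-identityʳ _)
      -- `A 1` and the sum over k ≥ 2 are definitionally the sum over k = 1, ..., n + 3.
      coefficients (suc n) = K.trans
        (KΣ.∑-distrib-+ {3 ℕ.+ n} (λ i → K.- Aᴸ (suc (toℕ i)) (suc n)) (λ i → Aᴶ (suc (toℕ i)) (suc n)))
        (K.+-cong (K.trans (sum-neg {3 ℕ.+ n} (λ i → Aᴸ (suc (toℕ i)) (suc n))) (K.-‿cong (L-coefficients n)))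
          (J-coefficients n))

-- The operators of the graph

module GraphMatrices {a b c ℓ} (R : CommutativeRing c ℓ) (Γ : AbstractIsogenyGraph a b) (fin : Finite Γ) where
  open CommutativeRing R hiding (zero)
  open SemiringSum semiring using (sum; sum-cong-≋; ∑-distrib-+)
  open Matrices R
  open RingOps rawRing using (sumList; _×ₙ_)
  open AbstractIsogenyGraph Γ
  open Finite fin
  open GraphOperators rawRing Γ fin using (𝐀; 𝐃; 𝐋; 𝐐)
  open Operators rawRing enumX using (basis; _≈ₒ_; _∘ₒ_)
  open Primes Γ fin using (words; edgeSeqs)
  open IndexMaps Γ fin
  open ClosedWalks Γ fin using (Step; walk?; step?; closed?)
  private
    module EX = Enumeration enumX
    module EY = Enumeration enumY
  open SetoidReasoning setoid

  sumList-cong : ∀ {i} {A : Set i} {f g : A → Carrier} xs → (∀ x → f x ≈ g x) → sumList (map f xs) ≈ sumList (map g xs)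
  sumList-cong []       f≈g = refl
  sumList-cong (x ∷ xs) f≈g = +-cong (f≈g x) (sumList-cong xs f≈g)

  sumList-filter : ∀ {i p} {A : Set i} {P : A → Set p} (P? : Decidable P) (f : A → Carrier) xs →
    sumList (map f (filter P? xs)) ≈ sumList (map (λ x → if does (P? x) then f x else 0#) xs)
  sumList-filter P? f [] = refl
  sumList-filter P? f (x ∷ xs) with does (P? x)
  ... | true  = +-congˡ (sumList-filter P? f xs)
  ... | false = trans (sumList-filter P? f xs) (sym (+-identityˡ _))

  sumList-const : ∀ {i} {A : Set i} (xs : List A) x → length xs ×ₙ x ≈ sumList (map (λ _ → x) xs)
  sumList-const []       x = refl
  sumList-const (_ ∷ xs) x = +-congˡ (sumList-const xs x)

  sumList-++ : ∀ xs ys → sumList (xs ++ ys) ≈ sumList xs + sumList ys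
  sumList-++ []       ys = sym (+-identityˡ _)
  sumList-++ (x ∷ xs) ys = trans (+-congˡ (sumList-++ xs ys)) (sym (+-assoc _ _ _))

  sumList-product : ∀ {i j k} {A : Set i} {B : Set j} {D : Set k} (_·_ : A → B → D) (f : D → Carrier) xs ys →
    sumList (map f (cartesianProductWith _·_ xs ys)) ≈ sumList (map (λ x → sumList (map (λ y → f (x · y)) ys)) xs)
  sumList-product _·_ f []       ys = refl
  sumList-product _·_ f (x ∷ xs) ys = begin
    sumList (map f (map (x ·_) ys ++ cartesianProductWith _·_ xs ys))
      ≡⟨ ≡.cong sumList (List.map-++ f (map (x ·_) ys) _) ⟩
    sumList (map f (map (x ·_) ys) ++ map f (cartesianProductWith _·_ xs ys))
      ≈⟨ sumList-++ (map f (map (x ·_) ys)) _ ⟩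
    sumList (map f (map (x ·_) ys)) + sumList (map f (cartesianProductWith _·_ xs ys))
      ≈⟨ +-cong (reflexive (≡.cong sumList (≡.sym (List.map-∘ ys)))) (sumList-product _·_ f xs ys) ⟩
    sumList (map (λ y → f (x · y)) ys) + sumList (map (λ x → sumList (map (λ y → f (x · y)) ys)) xs) ∎

  sumList-tabulate : ∀ {i} {A : Set i} {n} (f : A → Carrier) (g : Fin n → A) → sumList (map f (List.tabulate g)) ≈ sum (f ∘ g)
  sumList-tabulate {n = zero}  f g = refl
  sumList-tabulate {n = suc n} f g = +-congˡ (sumList-tabulate f (g ∘ suc))

  sumList-elements : ∀ (f : Y → Carrier) → sumList (map f EY.elements) ≈ sum (f ∘ EY.elem)
  sumList-elements f = trans (reflexive (≡.cong (sumList ∘ map f) (List.map-tabulate id EY.elem))) (sumList-tabulate f EY.elem)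

  length-filter-allFin : ∀ {n p} {P : Fin n → Set p} (P? : Decidable P) x →
    length (filter P? (allFin n)) ×ₙ x ≈ sum (λ i → if does (P? i) then x else 0#)
  length-filter-allFin {n} P? x = trans (sumList-const (filter P? (allFin n)) x)
    (trans (sumList-filter P? (λ _ → x) (allFin n)) (sumList-tabulate (λ i → if does (P? i) then x else 0#) id))

  δ-sym : ∀ {n} (i j : Fin n) → δ i j ≈ δ j i
  δ-sym i j with i Fin.≟ j
  ... | yes ≡.refl = sym (δ-refl i)
  ... | no i≢j     = sym (δ-≢ (i≢j ∘ ≡.sym))

  -- Column j holds the image of j, so that products follow composition. An `Op` takes its arguments
  -- in the other order, which is why the entry lemmas, like `detₒ`, exchange i and j.
  Φ : ∀ {m n} → (Fin m → Fin n) → Mat n m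
  Φ F i j = δ i (F j)

  Φ-∙ : ∀ {m n p} (F : Fin n → Fin p) (G : Fin m → Fin n) → Φ F ∙ Φ G ≈ᴹ Φ (F ∘ G)
  Φ-∙ F G = entrywise λ i j → trans (∙-entry (Φ F) (Φ G) i j) (sum-δʳ (G j) (λ k → δ i (F k)))

  Φ-cong : ∀ {m n} {F G : Fin m → Fin n} → (∀ j → F j ≡ G j) → Φ F ≈ᴹ Φ G
  Φ-cong F≡G = entrywise λ i j → reflexive (≡.cong (δ i) (F≡G j))

  -- The transpose of `Φ ŝ`.
  σ : Mat ∣Y∣ ∣X∣
  σ i j = δ j (ŝ i)

  basis-elem : ∀ p i → basis p (EX.elem i) ≡ δ (EX.index p) i
  basis-elem p i = ≡.cong (δ (EX.index p)) (Inverse.strictlyInverseˡ enumX i)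

  𝐋-entry : ∀ j i → 𝐋 (EX.elem j) (EX.elem i) ≈ Φ L̂ i j
  𝐋-entry j i = trans (reflexive (basis-elem (L (EX.elem j)) i)) (δ-sym _ i)

  -- A and D both sum over the edges leaving a vertex; such a sum becomes an entry of a product with
  -- σ on the right.
  at-source : ∀ j (f : Y → Carrier) →
    sumList (map f (filter (λ y → s y EX.≟ EX.elem j) EY.elements)) ≈ sum (λ k → f (EY.elem k) * σ k j)
  at-source j f = trans (sumList-filter (λ y → s y EX.≟ EX.elem j) f EY.elements)
    (trans (sumList-elements (λ y → if does (s y EX.≟ EX.elem j) then f y else 0#)) (sum-cong-≋ λ k → restrict k))
    where
    restrict : ∀ k → (if does (s (EY.elem k) EX.≟ EX.elem j) then f (EY.elem k) else 0#) ≈ f (EY.elem k) * σ k j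
    restrict k with ŝ k Fin.≟ EX.index (EX.elem j)
    ... | yes e = sym (trans (*-congˡ (trans (reflexive (≡.cong (δ j) (≡.trans e (Inverse.strictlyInverseˡ enumX j))))
      (δ-refl j))) (*-identityʳ _))
    ... | no ne = sym (trans (*-congˡ (δ-≢ (λ e → ne (≡.trans (≡.sym e) (≡.sym (Inverse.strictlyInverseˡ enumX j))))))
      (zeroʳ _))

  𝐀-entry : ∀ i j → 𝐀 (EX.elem j) (EX.elem i) ≈ (Φ t̂ ∙ σ) i j
  𝐀-entry i j = trans (at-source j (λ y → basis (t y) (EX.elem i)))
    (trans (sum-cong-≋ target) (sym (∙-entry (Φ t̂) σ i j)))
    where
    target : ∀ k → basis (t (EY.elem k)) (EX.elem i) * σ k j ≈ Φ t̂ i k * σ k j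
    target k = *-congʳ (trans (reflexive (basis-elem (t (EY.elem k)) i)) (δ-sym (t̂ k) i))

  𝐃-entry : ∀ i j → 𝐃 (EX.elem j) (EX.elem i) ≈ (Φ ŝ ∙ σ) i j
  𝐃-entry i j = trans (sumList-const (filter (λ y → s y EX.≟ EX.elem j) EY.elements) (basis (EX.elem j) (EX.elem i)))
    (trans (at-source j (λ _ → basis (EX.elem j) (EX.elem i))) (trans (sum-cong-≋ same) (sym (∙-entry (Φ ŝ) σ i j))))
    where
    same : ∀ k → basis (EX.elem j) (EX.elem i) * σ k j ≈ Φ ŝ i k * σ k j
    same k with j Fin.≟ ŝ k
    ... | yes ≡.refl = *-congʳ (trans (reflexive (≡.trans (basis-elem (EX.elem j) i)
      (≡.cong (λ l → δ l i) (Inverse.strictlyInverseˡ enumX j)))) (δ-sym j i))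
    ... | no j≢      = trans (zeroʳ _) (sym (zeroʳ _))

  -- QL + L = DL = LD = L s σ. Commutation enters here: with D = s σ it is LD that ends in σ on the
  -- right, as tσ = A does.
  𝐐∘𝐋-entry : 𝐃 ∘ₒ 𝐋 ≈ₒ 𝐋 ∘ₒ 𝐃 → ∀ i j →
    (𝐐 ∘ₒ 𝐋) (EX.elem j) (EX.elem i) + Φ L̂ i j ≈ (Φ (L̂ ∘ ŝ) ∙ σ) i j
  𝐐∘𝐋-entry commutes i j = begin
    (𝐐 ∘ₒ 𝐋) p q + Φ L̂ i j
      ≈⟨ +-congˡ 𝐋-sum ⟨
    sum (λ k → 𝐋 p (EX.elem k) * (𝐃 (EX.elem k) q - basis (EX.elem k) q)) + sum (λ k → 𝐋 p (EX.elem k) * basis (EX.elem k) q)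
      ≈⟨ ∑-distrib-+ (λ k → 𝐋 p (EX.elem k) * (𝐃 (EX.elem k) q - basis (EX.elem k) q))
        (λ k → 𝐋 p (EX.elem k) * basis (EX.elem k) q) ⟨
    sum (λ k → 𝐋 p (EX.elem k) * (𝐃 (EX.elem k) q - basis (EX.elem k) q) + 𝐋 p (EX.elem k) * basis (EX.elem k) q)
      ≈⟨ sum-cong-≋ add-back ⟩
    (𝐃 ∘ₒ 𝐋) p q
      ≈⟨ commutes p q ⟩
    sum (λ k → 𝐃 p (EX.elem k) * 𝐋 (EX.elem k) q)
      ≈⟨ sum-cong-≋ (λ k → trans (*-comm (𝐃 p (EX.elem k)) (𝐋 (EX.elem k) q)) (*-cong (𝐋-entry k i) (𝐃-entry k j))) ⟩
    sum (λ k → Φ L̂ i k * (Φ ŝ ∙ σ) k j)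
      ≈⟨ ∙-entry (Φ L̂) (Φ ŝ ∙ σ) i j ⟨
    (Φ L̂ ∙ (Φ ŝ ∙ σ)) i j
      ≈⟨ entry (transᴹ (symᴹ (∙-assoc (Φ L̂) (Φ ŝ) σ)) (∙-cong (Φ-∙ L̂ ŝ) reflᴹ)) i j ⟩
    (Φ (L̂ ∘ ŝ) ∙ σ) i j ∎
    where
    p = EX.elem j
    q = EX.elem i
    add-back : ∀ k → 𝐋 p (EX.elem k) * (𝐃 (EX.elem k) q - basis (EX.elem k) q) + 𝐋 p (EX.elem k) * basis (EX.elem k) q
               ≈ 𝐋 p (EX.elem k) * 𝐃 (EX.elem k) q
    add-back k = trans (sym (distribˡ _ _ _)) (*-congˡ (trans (+-assoc _ _ _) (trans (+-congˡ (-‿inverseˡ _)) (+-identityʳ _))))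
    𝐋-sum : sum (λ k → 𝐋 p (EX.elem k) * basis (EX.elem k) q) ≈ Φ L̂ i j
    𝐋-sum = trans (sum-cong-≋ λ k → *-cong {u = basis (EX.elem k) q} {v = δ i k} (𝐋-entry j k)
      (trans (reflexive (≡.trans (basis-elem (EX.elem k) i)
      (≡.cong (λ l → δ l i) (Inverse.strictlyInverseˡ enumX k)))) (δ-sym k i)))
      (trans (sum-cong-≋ λ k → *-comm (Φ L̂ k j) (δ i k)) (sum-δˡ i (λ k → Φ L̂ k j)))

  B : Mat ∣Y∣ ∣Y∣
  B i j = if does (step? (EY.elem j) (EY.elem i)) then 1# else 0#

  -- Because sJ = t, the edge Jy is among those starting at t(y); adding J to B restores exactly the
  -- edge that non-backtracking excludes.
  B+J : ∀ i j → B i j + Φ Ĵ i j ≈ (σ ∙ Φ t̂) i j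
  B+J i j = trans (by-step (step? y z) (z EY.≟ J y)) (sym (trans (∙-entry σ (Φ t̂) i j) (sum-δʳ (t̂ j) (λ k → δ k (ŝ i)))))
    where
    y = EY.elem j
    z = EY.elem i
    J-eq : z ≡ J y → i ≡ Ĵ j
    J-eq e = ≡.trans (≡.sym (Inverse.strictlyInverseˡ enumY i)) (≡.cong EY.index e)
    eq-J : i ≡ Ĵ j → z ≡ J y
    eq-J e = ≡.trans (≡.cong EY.elem e) (elem-indexY _)
    by-step : Dec (Step y z) → Dec (z ≡ J y) → B i j + Φ Ĵ i j ≈ δ (t̂ j) (ŝ i)
    by-step (yes st@(e , z≢Jy)) _ = trans
      (+-cong (reflexive (if-yes (step? y z) st)) (δ-≢ (z≢Jy ∘ eq-J)))
      (trans (+-identityʳ _) (sym (trans (reflexive (≡.cong (δ (t̂ j)) (≡.cong EX.index e))) (δ-refl (t̂ j)))))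
    by-step (no ¬st) (yes z≡Jy) = trans
      (+-cong (reflexive (if-no (step? y z) ¬st)) (trans (reflexive (≡.cong (λ k → δ k (Ĵ j)) (J-eq z≡Jy))) (δ-refl (Ĵ j))))
      (trans (+-identityˡ _) (sym (trans (reflexive (≡.cong (δ (t̂ j))
        (≡.cong EX.index (≡.trans (≡.cong s z≡Jy) (s∘J y))))) (δ-refl (t̂ j)))))
    by-step (no ¬st) (no z≢Jy) = trans
      (+-cong (reflexive (if-no (step? y z) ¬st)) (δ-≢ (z≢Jy ∘ eq-J)))
      (trans (+-identityʳ _) (sym (δ-≢ λ e → ¬st (≡.trans (≡.sym (elem-indexX _))
        (≡.trans (≡.cong EX.elem (≡.sym e)) (elem-indexX _)) , z≢Jy))))

  B^ : ℕ → Mat ∣Y∣ ∣Y∣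
  B^ zero    = I
  B^ (suc n) = B ∙ B^ n

  B^-comm : ∀ n → B ∙ B^ n ≈ᴹ B^ n ∙ B
  B^-comm zero    = transᴹ (∙-identityʳ B) (symᴹ (∙-identityˡ B))
  B^-comm (suc n) = transᴹ (∙-cong reflᴹ (B^-comm n)) (symᴹ (∙-assoc B (B^ n) B))

  -- A word of length n between the two end edges makes n + 1 steps. The recursion splits off the
  -- first step, the rightmost factor, while `B^` multiplies on the left; `B^-comm` reconciles the
  -- two.
  walk-sum : ∀ n j i → sumList (map (λ ws → if does (walk? (EY.elem j) ws (EY.elem i)) then 1# else 0#)
    (words n)) ≈ B^ (suc n) i j
  walk-sum zero    j i = trans (+-identityʳ _) (sym (entry (∙-identityʳ B) i j))
  walk-sum (suc n) j i = begin
    sumList (map (walks (EY.elem j)) (cartesianProductWith _∷_ EY.elements (words n)))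
      ≈⟨ sumList-product _∷_ (walks (EY.elem j)) EY.elements (words n) ⟩
    sumList (map (λ y → sumList (map (λ ws → walks (EY.elem j) (y ∷ ws)) (words n))) EY.elements)
      ≈⟨ sumList-elements (λ y → sumList (map (λ ws → walks (EY.elem j) (y ∷ ws)) (words n))) ⟩
    sum (λ k → sumList (map (λ ws → walks (EY.elem j) (EY.elem k ∷ ws)) (words n)))
      ≈⟨ sum-cong-≋ (λ k → trans (sumList-cong (words n)
        (λ ws → conjunction (step? (EY.elem j) (EY.elem k)) (walk? (EY.elem k) ws (EY.elem i))))
           (trans (sumList-*ˡ (words n) (B k j) (walks (EY.elem k))) (trans (*-congˡ (walk-sum n k i)) (*-comm _ _)))) ⟩
    sum (λ k → B^ (suc n) i k * B k j)
      ≈⟨ ∙-entry (B^ (suc n)) B i j ⟨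
    (B^ (suc n) ∙ B) i j
      ≈⟨ entry (B^-comm (suc n)) i j ⟨
    B^ (suc (suc n)) i j ∎
    where
    walks : Y → List Y → Carrier
    walks y ws = if does (walk? y ws (EY.elem i)) then 1# else 0#
    conjunction : ∀ {p q} {P : Set p} {Q : Set q} (P? : Dec P) (Q? : Dec Q) →
      (if does (P? ×-dec Q?) then 1# else 0#) ≈ (if does P? then 1# else 0#) * (if does Q? then 1# else 0#)
    conjunction P? Q? with does P?
    ... | true  = sym (*-identityˡ _)
    ... | false = sym (zeroˡ _)
    sumList-*ˡ : ∀ {i} {A : Set i} (xs : List A) x (f : A → Carrier) → sumList (map (λ y → x * f y) xs) ≈ x * sumList (map f xs)
    sumList-*ˡ []       x f = sym (zeroʳ x)
    sumList-*ˡ (y ∷ ys) x f = trans (+-congˡ (sumList-*ˡ ys x f)) (sym (distribˡ x _ _))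

  closed-trace : ∀ n → length (filter closed? (edgeSeqs (suc n))) ×ₙ 1# ≈ sum (λ i → B^ (suc n) i i)
  closed-trace n = begin
    length (filter closed? (edgeSeqs (suc n))) ×ₙ 1#
      ≈⟨ trans (sumList-const (filter closed? (edgeSeqs (suc n))) 1#) (sumList-filter closed? (λ _ → 1#) (edgeSeqs (suc n))) ⟩
    sumList (map indicator (cartesianProductWith _∷_ EY.elements (words n)))
      ≈⟨ trans (sumList-product _∷_ indicator EY.elements (words n))
        (sumList-elements (λ y → sumList (map (λ ws → indicator (y ∷ ws)) (words n)))) ⟩
    sum (λ i → sumList (map (λ ws → indicator (EY.elem i ∷ ws)) (words n)))
      ≈⟨ sum-cong-≋ (λ i → walk-sum n i i) ⟩
    sum (λ i → B^ (suc n) i i) ∎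
    where
    indicator : List⁺ Y → Carrier
    indicator c = if does (closed? c) then 1# else 0#

  fixedPoints-trace : ∀ {m} (F : Fin m → Fin m) n x → fixedPoints F n ×ₙ x ≈ sum (λ i → δ i (fold i F n) * x)
  fixedPoints-trace F n x = trans (length-filter-allFin (λ i → fold i F n Fin.≟ i) x) (sum-cong-≋ λ i → flip i (fold i F n))
    where
    flip : ∀ i j → (if does (j Fin.≟ i) then x else 0#) ≈ δ i j * x
    flip i j with j Fin.≟ i
    ... | yes ≡.refl = sym (trans (*-congʳ (δ-refl i)) (*-identityˡ x))
    ... | no j≢i     = sym (trans (*-congʳ (δ-≢ (j≢i ∘ ≡.sym))) (zeroˡ x))

-- Matrices of power series built from blocks uᵈ A

module MonomialMatrices {c ℓ} (R : CommutativeRing c ℓ) where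
  private
    module K = CommutativeRing R
    module KS = SumProperties K.semiring
    module KΣ = SemiringSum K.semiring
    module KM = Matrices R
  open SeriesRing R
  open SeriesInverse R using (sum-coeff)
  open RingProperties K.ring using (-0#≈0#)
  open Monomials R using (shift)
  private
    module S = CommutativeRing seriesRing
    module SΣ = SemiringSum S.semiring
  open Series K.rawRing
  open Matrices seriesRing public

  -- mono d a is a uᵈ.
  mono : ℕ → K.Carrier → Carrier
  mono zero    a = const a
  mono (suc d) a = shift (mono d a)

  mono-zero : ∀ d {a} → a K.≈ K.0# → mono d a ≈ 0#
  mono-zero zero    a≈0 zero    = a≈0
  mono-zero zero    a≈0 (suc n) = K.refl
  mono-zero (suc d) a≈0 zero    = K.refl
  mono-zero (suc d) a≈0 (suc n) = mono-zero d a≈0 n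

  mono-+ : ∀ d a b → mono d (a K.+ b) ≈ mono d a + mono d b
  mono-+ zero    a b zero    = K.refl
  mono-+ zero    a b (suc n) = K.sym (K.+-identityʳ _)
  mono-+ (suc d) a b zero    = K.sym (K.+-identityʳ _)
  mono-+ (suc d) a b (suc n) = mono-+ d a b n

  mono-cong : ∀ d {a b} → a K.≈ b → mono d a ≈ mono d b
  mono-cong zero    a≈b zero    = a≈b
  mono-cong zero    a≈b (suc n) = K.refl
  mono-cong (suc d) a≈b zero    = K.refl
  mono-cong (suc d) a≈b (suc n) = mono-cong d a≈b n

  mono-sum : ∀ d {n} (h : Fin n → K.Carrier) → SΣ.sum (λ i → mono d (h i)) ≈ mono d (KΣ.sum h)
  mono-sum d {zero}  h j = K.sym (mono-zero d K.refl j)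
  mono-sum d {suc n} h j = K.trans (K.+-congˡ (mono-sum d (h ∘ suc) j)) (K.sym (mono-+ d (h zero) (KΣ.sum (h ∘ suc)) j))

  shift-cong : ∀ {f g} → f ≈ g → shift f ≈ shift g
  shift-cong f≈g zero    = K.refl
  shift-cong f≈g (suc n) = f≈g n

  shift-* : ∀ f g → shift f * g ≈ shift (f * g)
  shift-* f g zero    = K.trans (K.+-identityʳ _) (K.zeroˡ _)
  shift-* f g (suc n) = ⊛-suc-0 (shift f) g K.refl n

  const-* : ∀ a f → const a * f ≈ scale a f
  const-* a f zero    = K.+-identityʳ _
  const-* a f (suc n) = K.trans (K.+-congˡ (⊛-zeroˡ f n)) (K.+-identityʳ _)

  scale-mono : ∀ d a b → scale a (mono d b) ≈ mono d (a K.* b)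
  scale-mono zero    a b zero    = K.refl
  scale-mono zero    a b (suc n) = K.zeroʳ a
  scale-mono (suc d) a b zero    = K.zeroʳ a
  scale-mono (suc d) a b (suc n) = scale-mono d a b n

  mono-* : ∀ d e a b → mono d a * mono e b ≈ mono (d ℕ.+ e) (a K.* b)
  mono-* zero    e a b n = K.trans (const-* a (mono e b) n) (scale-mono e a b n)
  mono-* (suc d) e a b n = K.trans (shift-* (mono d a) (mono e b) n) (shift-cong (mono-* d e a b) n)

  θ-mono₀ : ∀ a → θ (mono 0 a) ≈ 0#
  θ-mono₀ a zero    = K.refl
  θ-mono₀ a (suc n) = KS.·-zero (suc n) K.refl

  θ-mono₁ : ∀ a → θ (mono 1 a) ≈ mono 1 a
  θ-mono₁ a zero          = K.refl
  θ-mono₁ a (suc zero)    = K.+-identityʳ _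
  θ-mono₁ a (suc (suc n)) = KS.·-zero (suc (suc n)) K.refl

  θ-mono₂ : ∀ a → θ (mono 2 a) ≈ mono 2 (a K.+ a)
  θ-mono₂ a zero                = K.refl
  θ-mono₂ a (suc zero)          = K.+-identityʳ _
  θ-mono₂ a (suc (suc zero))    = K.+-congˡ (K.+-identityʳ _)
  θ-mono₂ a (suc (suc (suc n))) = KS.·-zero (suc (suc (suc n))) K.refl

  monoM : ∀ {m n} → ℕ → KM.Mat m n → Mat m n
  monoM d A i j = mono d (A i j)

  monoM-∙ : ∀ {m n p} d e (A : KM.Mat m n) (B : KM.Mat n p) → monoM d A ∙ monoM e B ≈ᴹ monoM (d ℕ.+ e) (A KM.∙ B)
  monoM-∙ d e A B = entrywise λ i j l → K.trans (∙-entry (monoM d A) (monoM e B) i j l)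
    (K.trans (SΣ.sum-cong-≋ {x = λ k → mono d (A i k) * mono e (B k j)} {λ k → mono (d ℕ.+ e) (A i k K.* B k j)}
      (λ k → mono-* d e (A i k) (B k j)) l)
      (K.trans (mono-sum (d ℕ.+ e) (λ k → A i k K.* B k j) l) (mono-cong (d ℕ.+ e) (K.sym (KM.∙-entry A B i j)) l)))

  monoM-cong : ∀ {m n} d {A B : KM.Mat m n} → A KM.≈ᴹ B → monoM d A ≈ᴹ monoM d B
  monoM-cong d A≈B = entrywise λ i j → mono-cong d (KM.entry A≈B i j)

  mono-indicator : ∀ b → (if b then 1# else 0#) ≈ mono 0 (if b then K.1# else K.0#)
  mono-indicator true  zero    = K.refl
  mono-indicator true  (suc l) = K.refl
  mono-indicator false zero    = K.refl
  mono-indicator false (suc l) = K.refl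

  mono-neg : ∀ d a → - mono d a ≈ mono d (K.- a)
  mono-neg zero    a zero    = K.refl
  mono-neg zero    a (suc n) = -0#≈0#
  mono-neg (suc d) a zero    = -0#≈0#
  mono-neg (suc d) a (suc n) = mono-neg d a n

  u≈mono : u ≈ mono 1 K.1#
  u≈mono zero          = K.refl
  u≈mono (suc zero)    = K.refl
  u≈mono (suc (suc n)) = K.refl

  u^≈mono : ∀ d → u ^ d ≈ mono d K.1#
  u^≈mono zero    zero    = K.refl
  u^≈mono zero    (suc n) = K.refl
  u^≈mono (suc d) n = K.trans (⊛-cong {u} {mono 1 K.1#} {u ^ d} {mono d K.1#} u≈mono (u^≈mono d) n)
    (K.trans (mono-* 1 d K.1# K.1# n) (mono-cong (suc d) (K.*-identityˡ K.1#) n))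

  mono-const : ∀ d {f} a → f ≈ mono d K.1# → f * const a ≈ mono d a
  mono-const d {f} a f≈ n = K.trans (⊛-cong {f} {mono d K.1#} {const a} {const a} f≈ (λ _ → K.refl) n)
    (K.trans (mono-* d 0 K.1# a n) (K.trans (K.reflexive (≡.cong (λ e → mono e (K.1# K.* a) n) (ℕ.+-identityʳ d)))
      (mono-cong d (K.*-identityˡ a) n)))

  I≈monoM : ∀ {n} → I {n} ≈ᴹ monoM 0 KM.δ
  I≈monoM = entrywise λ i j l → K.trans (I-entry i j l) (mono-indicator (does (i Fin.≟ j)) l)

  coeff : ∀ {m n} → ℕ → Mat m n → KM.Mat m n
  coeff l F i j = F i j l

  monoM₁-coeff-0 : ∀ {m n p} (A : KM.Mat m n) (F : Mat n p) i j → (monoM 1 A ∙ F) i j 0 K.≈ K.0#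
  monoM₁-coeff-0 A F i j = K.trans (∙-entry (monoM 1 A) F i j 0)
    (K.trans (K.reflexive (sum-coeff (λ k → monoM 1 A i k * F k j) 0))
      (KS.sum-zero (λ k → (monoM 1 A i k * F k j) 0) λ k → shift-* (const (A i k)) (F k j) 0))

  monoM₁-coeff : ∀ {m n p} (A : KM.Mat m n) (F : Mat n p) i j l →
    (monoM 1 A ∙ F) i j (suc l) K.≈ (A KM.∙ coeff l F) i j
  monoM₁-coeff A F i j l = K.trans (∙-entry (monoM 1 A) F i j (suc l))
    (K.trans (K.reflexive (sum-coeff (λ k → monoM 1 A i k * F k j) (suc l)))
      (K.trans (KΣ.sum-cong-≋ {x = λ k → (monoM 1 A i k * F k j) (suc l)} {λ k → A i k K.* F k j l} λ k →
        K.trans (shift-* (const (A i k)) (F k j) (suc l)) (const-* (A i k) (F k j) l))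
        (K.sym (KM.∙-entry A (coeff l F) i j))))

  ∙-monoM-coeff : ∀ {m n p} d (A : KM.Mat n p) (F : Mat m n) i j l →
    (F ∙ monoM d A) i j l K.≈ KΣ.sum (λ k → (mono d (A k j) * F i k) l)
  ∙-monoM-coeff d A F i j l = K.trans (∙-entry F (monoM d A) i j l)
    (K.trans (K.reflexive (sum-coeff (λ k → F i k * monoM d A k j) l))
      (KΣ.sum-cong-≋ {x = λ k → (F i k * monoM d A k j) l} {λ k → (mono d (A k j) * F i k) l} λ k → ⊛-comm (F i k)
        (mono d (A k j)) l))

  mono₁-*-coeff : ∀ a f l → (mono 1 a * f) (suc l) K.≈ f l K.* a
  mono₁-*-coeff a f l = K.trans (shift-* (const a) f (suc l)) (K.trans (const-* a f l) (K.*-comm _ _))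

  mono₂-*-coeff : ∀ a f l → (mono 2 a * f) (suc (suc l)) K.≈ f l K.* a
  mono₂-*-coeff a f l = K.trans (shift-* (shift (const a)) f (suc (suc l))) (mono₁-*-coeff a f l)

  mono₂-*-coeff-1 : ∀ a f → (mono 2 a * f) 1 K.≈ K.0#
  mono₂-*-coeff-1 a f = K.trans (shift-* (shift (const a)) f 1) (shift-* (const a) f 0)

  ∙-monoM₁-coeff : ∀ {m n p} (A : KM.Mat n p) (F : Mat m n) i j l →
    (F ∙ monoM 1 A) i j (suc l) K.≈ (coeff l F KM.∙ A) i j
  ∙-monoM₁-coeff A F i j l = K.trans (∙-monoM-coeff 1 A F i j (suc l))
    (K.trans (KΣ.sum-cong-≋ {x = λ k → (mono 1 (A k j) * F i k) (suc l)} {λ k → F i k l K.* A k j} λ k → mono₁-*-coeff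
      (A k j) (F i k) l)
      (K.sym (KM.∙-entry (coeff l F) A i j)))

  ∙-monoM₂-coeff : ∀ {m n p} (A : KM.Mat n p) (F : Mat m n) i j l →
    (F ∙ monoM 2 A) i j (suc (suc l)) K.≈ (coeff l F KM.∙ A) i j
  ∙-monoM₂-coeff A F i j l = K.trans (∙-monoM-coeff 2 A F i j (suc (suc l)))
    (K.trans (KΣ.sum-cong-≋ {x = λ k → (mono 2 (A k j) * F i k) (suc (suc l))} {λ k → F i k l K.* A k j} λ k →
      mono₂-*-coeff (A k j) (F i k) l)
      (K.sym (KM.∙-entry (coeff l F) A i j)))

  ∙-monoM-coeff-0 : ∀ {m n p} d (A : KM.Mat n p) (F : Mat m n) i j → (F ∙ monoM (suc d) A) i j 0 K.≈ K.0#
  ∙-monoM-coeff-0 d A F i j = K.trans (∙-monoM-coeff (suc d) A F i j 0)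
    (KS.sum-zero (λ k → (mono (suc d) (A k j) * F i k) 0) λ k → shift-* (mono d (A k j)) (F i k) 0)

  ∙-monoM₂-coeff-1 : ∀ {m n p} (A : KM.Mat n p) (F : Mat m n) i j → (F ∙ monoM 2 A) i j 1 K.≈ K.0#
  ∙-monoM₂-coeff-1 A F i j = K.trans (∙-monoM-coeff 2 A F i j 1)
    (KS.sum-zero (λ k → (mono 2 (A k j) * F i k) 1) λ k → mono₂-*-coeff-1 (A k j) (F i k))

  tr-coeff : ∀ {n} (F : Mat n n) l → tr F l K.≈ KΣ.sum (λ i → F i i l)
  tr-coeff F l = K.trans (tr-sum F l) (K.reflexive (sum-coeff (λ i → F i i) l))

  -- Supplies the constant term 1 of det Δ, without which `det Δ ⁻¹` would not be an inverse.
  det-constant-1 : ∀ {n} (F : Mat n n) → (∀ i j → F i j 0 K.≈ KM.δ i j) → det F 0 K.≈ K.1#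
  det-constant-1 {zero}  F F₀≈1 = K.refl
  det-constant-1 {suc n} F F₀≈1 = K.trans (K.reflexive (sum-coeff {suc n} summand 0))
    (K.trans (KS.sum-single {suc n} zero (λ j → summand j 0) other) first)
    where
    summand : Fin (suc n) → Carrier
    summand j = (- 1#) ^ toℕ j * F zero j * det (λ i k → F (suc i) (punchIn j k))
    constant-* : ∀ f g → (f * g) 0 K.≈ f 0 K.* g 0
    constant-* f g = K.+-identityʳ _
    other : ∀ j → j ≢ zero → summand j 0 K.≈ K.0#
    other zero    0≢0 = contradiction ≡.refl 0≢0
    other (suc j) _   = K.trans (constant-* ((- 1#) ^ suc (toℕ j) * F zero (suc j)) D)
      (K.trans (K.*-congʳ (K.trans (constant-* ((- 1#) ^ suc (toℕ j)) (F zero (suc j)))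
        (K.trans (K.*-congˡ (K.trans (F₀≈1 zero (suc j)) (KM.δ-≢ {i = zero} {suc j} λ ()))) (K.zeroʳ _)))) (K.zeroˡ _))
      where D = det (λ i k → F (suc i) (punchIn (suc j) k))
    first : summand zero 0 K.≈ K.1#
    first = K.trans (constant-* (1# * F zero zero) D)
      (K.trans (K.*-cong (K.trans (constant-* 1# (F zero zero))
        (K.trans (K.*-identityˡ (F zero zero 0)) (K.trans (F₀≈1 zero zero) (KM.δ-refl {suc n} zero))))
        (det-constant-1 (λ i k → F (suc i) (suc k)) λ i j → K.trans (F₀≈1 (suc i) (suc j)) (δ-suc i j))) (K.*-identityˡ K.1#))
      where
      D = det (λ i k → F (suc i) (suc k))
      δ-suc : ∀ i j → KM.δ (suc i) (suc j) K.≈ KM.δ {n} i j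
      δ-suc i j with i Fin.≟ j
      ... | yes _ = K.refl
      ... | no _  = K.refl

-- The matrices of the graph satisfy the hypotheses of Bass's identity

module IharaMatrices {a b c ℓ} (R : CommutativeRing c ℓ) (Γ : AbstractIsogenyGraph a b) (fin : Finite Γ) where
  private
    module K = CommutativeRing R
    module KS = SumProperties K.semiring
    module KΣ = SemiringSum K.semiring
    module KP = RingProperties K.ring
    module KR = RingOps K.rawRing
    module KM = Matrices R
    module EX = Enumeration (Finite.enumX fin)
  open SeriesRing R
  open MonomialMatrices R
  open IndexMaps Γ fin using (ŝ; t̂; L̂; Ĵ; t̂∘Ĵ; ŝ∘Ĵ)
  open GraphMatrices R Γ fin using (Φ; Φ-∙; Φ-cong; σ; B; B+J; B^; B^-comm; 𝐀-entry; 𝐐∘𝐋-entry; δ-sym)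
  open Finite fin
  open Setting R Γ fin using (𝐀; 𝐃; 𝐋; 𝐐; idₒ; _-ₒ_; _+ₒ_; _·ₒ_; _∘ₒ_; _≈ₒ_; ⟪_⟫)
  open Series K.rawRing

  neg : ∀ {m n} → KM.Mat m n → KM.Mat m n
  neg A i j = K.- A i j

  neg-∙ : ∀ {m n p} (A : KM.Mat m n) (B : KM.Mat n p) → neg A KM.∙ B KM.≈ᴹ neg (A KM.∙ B)
  neg-∙ A B = KM.entrywise λ i j → KP.+-inverseʳ-unique _ _ (K.trans (K.+-cong (KM.∙-entry A B i j) (KM.∙-entry (neg A) B i j))
    (K.trans (K.sym (KΣ.∑-distrib-+ (λ k → A i k K.* B k j) (λ k → (K.- A i k) K.* B k j)))
      (KS.sum-zero (λ k → A i k K.* B k j K.+ (K.- A i k) K.* B k j) λ k →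
        K.trans (K.sym (K.distribʳ (B k j) (A i k) (K.- A i k)))
          (K.trans (K.*-congʳ (K.-‿inverseʳ (A i k))) (K.zeroˡ (B k j))))))

  monoM-⊞ : ∀ {m n} d {A B C : KM.Mat m n} → (∀ i j → A i j K.+ B i j K.≈ C i j) → monoM d A ⊞ monoM d B ≈ᴹ monoM d C
  monoM-⊞ d {A} {B} {C} A+B≈C = entrywise λ i j l → K.trans (⊞-entry (monoM d A) (monoM d B) i j l)
    (K.trans (K.sym (mono-+ d (A i j) (B i j) l)) (mono-cong d (A+B≈C i j) l))

  monoM-zero : ∀ {m n} d {A : KM.Mat m n} (F : Mat m n) → (∀ i j → A i j K.≈ K.0#) → F ⊞ monoM d A ≈ᴹ F
  monoM-zero d {A} F A≈0 = entrywise λ i j l → K.trans (⊞-entry F (monoM d A) i j l)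
    (K.trans (K.+-congˡ (mono-zero d (A≈0 i j) l)) (K.+-identityʳ (F i j l)))

  monoM-cancel : ∀ {m n} d {A B : KM.Mat m n} (F G : Mat m n) → (∀ i j → A i j K.+ B i j K.≈ K.0#) →
    (F ⊞ monoM d A) ⊞ (monoM d B ⊞ G) ≈ᴹ F ⊞ G
  monoM-cancel d {A} {B} F G A+B≈0 = transᴹ (symᴹ (⊞-assoc (F ⊞ monoM d A) (monoM d B) G))
    (⊞-cong (transᴹ (⊞-assoc F (monoM d A) (monoM d B)) (transᴹ (⊞-cong reflᴹ (monoM-⊞ d λ i j → K.refl))
      (monoM-zero d F A+B≈0))) reflᴹ)

  Ls : KM.Mat ∣X∣ ∣Y∣
  Ls = Φ (L̂ ∘ ŝ)

  τ ρ : Mat ∣X∣ ∣Y∣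
  τ = monoM 0 (Φ t̂)
  ρ = τ ⊞ monoM 1 (neg Ls)

  uσ : Mat ∣Y∣ ∣X∣
  uσ = monoM 1 σ

  -- `H` is the geometric series Σ u²ᵖ Lᵖ, the inverse of `U`.
  U H : Mat ∣X∣ ∣X∣
  U = I ⊞ monoM 2 (neg (Φ L̂))

  -- L^half q n is L^(q + n/2) for even n and 0 for odd n.
  L^half : ℕ → ℕ → KM.Mat ∣X∣ ∣X∣
  L^half q zero          i j = KM.δ i (fold j L̂ q)
  L^half q (suc zero)    i j = K.0#
  L^half q (suc (suc n)) i j = L^half (suc q) n i j

  H i j n = L^half 0 n i j

  -- `M⁻¹` and `E⁻¹` are the geometric series Σ (-u)ⁿ Jⁿ and Σ uⁿ Bⁿ. Given by their coefficients,
  -- they have traces that can be compared directly with the counts.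
  uJ M E M⁻¹ E⁻¹ : Mat ∣Y∣ ∣Y∣
  uJ = monoM 1 (Φ Ĵ)
  M = I ⊞ uJ
  E = I ⊞ monoM 1 (neg B)
  M⁻¹ i j n = (K.- K.1#) KR.^ n K.* KM.δ i (fold j Ĵ n)
  E⁻¹ i j n = B^ n i j

  -- Indexed as in `detₒ`, so that `det Δ` is definitionally the determinant of the theorem.
  Δ : Mat ∣X∣ ∣X∣
  Δ i j = (idₒ -ₒ u ·ₒ ⟪ 𝐀 ⟫ +ₒ u ^ 2 ·ₒ ⟪ 𝐐 ∘ₒ 𝐋 ⟫) (EX.elem j) (EX.elem i)

  E+uσ∙τ≈M : E ⊞ uσ ∙ τ ≈ᴹ M
  E+uσ∙τ≈M = transᴹ (⊞-assoc I (monoM 1 (neg B)) (uσ ∙ τ)) (⊞-cong reflᴹ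
    (transᴹ (⊞-cong reflᴹ (monoM-∙ 1 0 σ (Φ t̂))) (monoM-⊞ 1 λ i j → -B+στ≈J (B+J i j))))
    where
    -B+στ≈J : ∀ {x y z} → x K.+ y K.≈ z → (K.- x) K.+ z K.≈ y
    -B+στ≈J {x} {y} x+y≈z = K.trans (K.+-congˡ (K.sym x+y≈z)) (K.trans (K.sym (K.+-assoc (K.- x) x y))
      (K.trans (K.+-congʳ (K.-‿inverseˡ x)) (K.+-identityˡ y)))

  ρ∙-expand : ∀ {n} (A : KM.Mat ∣Y∣ n) → ρ ∙ monoM 1 A ≈ᴹ monoM 1 (Φ t̂ KM.∙ A) ⊞ monoM 2 (neg (Ls KM.∙ A))
  ρ∙-expand A = transᴹ (∙-distribʳ (monoM 1 A) τ (monoM 1 (neg Ls)))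
    (⊞-cong (monoM-∙ 0 1 (Φ t̂) A) (transᴹ (monoM-∙ 1 1 (neg Ls) A) (monoM-cong 2 (neg-∙ Ls A))))

  neg-cong : ∀ {m n} {A B : KM.Mat m n} → A KM.≈ᴹ B → neg A KM.≈ᴹ neg B
  neg-cong A≈B = KM.entrywise λ i j → K.-‿cong (KM.entry A≈B i j)

  -- tJ = Ls cancels the terms in u, and sJ = t turns the term L s J in u² into L t.
  ρM≈Uτ : ρ ∙ M ≈ᴹ U ∙ τ
  ρM≈Uτ = begin
    ρ ∙ (I ⊞ uJ)                                                 ≈⟨ transᴹ (∙-distribˡ ρ I uJ)
      (⊞-cong (∙-identityʳ ρ) (ρ∙-expand (Φ Ĵ))) ⟩
    ρ ⊞ (monoM 1 (Φ t̂ KM.∙ Φ Ĵ) ⊞ monoM 2 (neg (Ls KM.∙ Φ Ĵ)))   ≈⟨ monoM-cancel 1 τ _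
      (λ i j → K.trans (K.+-congˡ (KM.entry tJ≈Ls i j)) (K.-‿inverseˡ (Ls i j))) ⟩
    τ ⊞ monoM 2 (neg (Ls KM.∙ Φ Ĵ))                              ≈⟨ ⊞-cong reflᴹ (monoM-cong 2 (neg-cong LsJ≈Lt)) ⟩
    τ ⊞ monoM 2 (neg (Φ L̂ KM.∙ Φ t̂))                             ≈⟨ ⊞-cong (∙-identityˡ τ)
      (transᴹ (monoM-∙ 2 0 (neg (Φ L̂)) (Φ t̂)) (monoM-cong 2 (neg-∙ (Φ L̂) (Φ t̂)))) ⟨
    I ∙ τ ⊞ monoM 2 (neg (Φ L̂)) ∙ τ                              ≈⟨ ∙-distribʳ τ I (monoM 2 (neg (Φ L̂))) ⟨
    U ∙ τ                                                        ∎
    where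
    open SetoidReasoning (matSetoid ∣X∣ ∣Y∣)
    tJ≈Ls : Φ t̂ KM.∙ Φ Ĵ KM.≈ᴹ Ls
    tJ≈Ls = KM.transᴹ (Φ-∙ t̂ Ĵ) (Φ-cong t̂∘Ĵ)
    LsJ≈Lt : Ls KM.∙ Φ Ĵ KM.≈ᴹ Φ L̂ KM.∙ Φ t̂
    LsJ≈Lt = KM.transᴹ (Φ-∙ (L̂ ∘ ŝ) Ĵ) (KM.transᴹ (Φ-cong (≡.cong L̂ ∘ ŝ∘Ĵ)) (KM.symᴹ (Φ-∙ L̂ t̂)))

  QL : KM.Mat ∣X∣ ∣X∣
  QL i j = (𝐐 ∘ₒ 𝐋) (EX.elem j) (EX.elem i)

  Δ-expand : Δ ≈ᴹ (I ⊞ monoM 2 QL) ⊞ monoM 1 (neg (Φ t̂ KM.∙ σ))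
  Δ-expand = entrywise λ i j l → K.trans
    (K.+-cong (K.+-cong (identity i j l) (K.trans (K.-‿cong (mono-const 1 (𝐀 (EX.elem j) (EX.elem i)) u≈mono l))
        (K.trans (mono-neg 1 (𝐀 (EX.elem j) (EX.elem i)) l) (mono-cong 1 (K.-‿cong (𝐀-entry i j)) l))))
      (mono-const 2 (QL i j) (u^≈mono 2) l))
    (K.trans (swap (I i j l) (mono 1 (K.- (Φ t̂ KM.∙ σ) i j) l) (mono 2 (QL i j) l))
      (K.sym (K.trans (⊞-entry (I ⊞ monoM 2 QL) (monoM 1 (neg (Φ t̂ KM.∙ σ))) i j l)
        (K.+-congʳ (⊞-entry I (monoM 2 QL) i j l)))))
    where
    swap : ∀ x y z → x K.+ y K.+ z K.≈ x K.+ z K.+ y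
    swap x y z = K.trans (K.+-assoc x y z) (K.trans (K.+-congˡ (K.+-comm y z)) (K.sym (K.+-assoc x z y)))
    identity : ∀ i j → idₒ (EX.elem j) (EX.elem i) ≈ I i j
    identity i j l = K.trans (mono-indicator (does (EX.elem j EX.≟ EX.elem i)) l) (K.trans
      (mono-cong 0 (K.trans (K.reflexive (≡.cong₂ KM.δ (Inverse.strictlyInverseˡ enumX j)
        (Inverse.strictlyInverseˡ enumX i))) (δ-sym j i)) l)
      (K.sym (entry I≈monoM i j l)))

  -- The terms in u cancel because A = tσ; in u² there remains QL - L s σ = -L by `𝐐∘𝐋-entry`.
  Δ+ρ∙uσ≈U : 𝐃 ∘ₒ 𝐋 ≈ₒ 𝐋 ∘ₒ 𝐃 → Δ ⊞ ρ ∙ uσ ≈ᴹ U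
  Δ+ρ∙uσ≈U commutes = begin
    Δ ⊞ ρ ∙ uσ
      ≈⟨ ⊞-cong Δ-expand (ρ∙-expand σ) ⟩
    ((I ⊞ monoM 2 QL) ⊞ monoM 1 (neg (Φ t̂ KM.∙ σ))) ⊞ (monoM 1 (Φ t̂ KM.∙ σ) ⊞ monoM 2 (neg (Ls KM.∙ σ)))
      ≈⟨ monoM-cancel 1 (I ⊞ monoM 2 QL) _ (λ i j → K.-‿inverseˡ _) ⟩
    (I ⊞ monoM 2 QL) ⊞ monoM 2 (neg (Ls KM.∙ σ))
      ≈⟨ transᴹ (⊞-assoc I (monoM 2 QL) _) (⊞-cong reflᴹ (monoM-⊞ 2 λ i j → subtract (𝐐∘𝐋-entry commutes i j))) ⟩
    U ∎
    where
    open SetoidReasoning (matSetoid ∣X∣ ∣X∣)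
    subtract : ∀ {x y z} → x K.+ y K.≈ z → x K.+ (K.- z) K.≈ K.- y
    subtract {x} {y} x+y≈z = KP.+-inverseʳ-unique _ _ (K.trans (K.sym (K.+-assoc y x _))
      (K.trans (K.+-congʳ (K.trans (K.+-comm y x) x+y≈z)) (K.-‿inverseʳ _)))

  I-coeff-0 : ∀ {n} (i j : Fin n) → I i j 0 K.≈ KM.δ i j
  I-coeff-0 i j = entry I≈monoM i j 0

  I-coeff-suc : ∀ {n} (i j : Fin n) l → I i j (suc l) K.≈ K.0#
  I-coeff-suc i j l = entry I≈monoM i j (suc l)

  ⊞-coeff : ∀ {m n} (F G : Mat m n) i j l → (F ⊞ G) i j l K.≈ F i j l K.+ G i j l
  ⊞-coeff F G i j l = ⊞-entry F G i j l

  M∙M⁻¹≈I : M ∙ M⁻¹ ≈ᴹ I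
  M∙M⁻¹≈I = transᴹ (transᴹ (∙-distribʳ M⁻¹ I uJ) (⊞-cong (∙-identityˡ M⁻¹) reflᴹ)) (entrywise coefficient)
    where
    coefficient : ∀ i j → (M⁻¹ ⊞ uJ ∙ M⁻¹) i j ≈ I i j
    coefficient i j zero = K.trans (⊞-coeff M⁻¹ (uJ ∙ M⁻¹) i j 0)
      (K.trans (K.+-cong (K.*-identityˡ _) (monoM₁-coeff-0 (Φ Ĵ) M⁻¹ i j))
      (K.trans (K.+-identityʳ _) (K.sym (I-coeff-0 i j))))
    coefficient i j (suc l) = K.trans (⊞-coeff M⁻¹ (uJ ∙ M⁻¹) i j (suc l)) (K.trans (K.+-cong
        (K.trans (K.*-congʳ (KP.-1*x≈-x _)) (K.sym (KP.-‿distribˡ-* _ _)))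
        (K.trans (monoM₁-coeff (Φ Ĵ) M⁻¹ i j l) (K.trans (KM.∙-entry (Φ Ĵ) (coeff l M⁻¹) i j)
          (K.trans (KΣ.sum-cong-≋ move) (KM.sum-δʳ (fold j Ĵ l) (λ k → ε^l K.* KM.δ i (Ĵ k)))))))
      (K.trans (K.-‿inverseˡ _) (K.sym (I-coeff-suc i j l))))
      where
      ε^l = (K.- K.1#) KR.^ l
      move : ∀ k → KM.δ i (Ĵ k) K.* (ε^l K.* KM.δ k (fold j Ĵ l)) K.≈ ε^l K.* KM.δ i (Ĵ k) K.* KM.δ k (fold j Ĵ l)
      move k = K.trans (K.sym (K.*-assoc _ _ _)) (K.*-congʳ (K.*-comm _ _))

  E∙E⁻¹≈I : E ∙ E⁻¹ ≈ᴹ I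
  E∙E⁻¹≈I = transᴹ (transᴹ (∙-distribʳ E⁻¹ I (monoM 1 (neg B))) (⊞-cong (∙-identityˡ E⁻¹) reflᴹ)) (entrywise coefficient)
    where
    coefficient : ∀ i j → (E⁻¹ ⊞ monoM 1 (neg B) ∙ E⁻¹) i j ≈ I i j
    coefficient i j zero = K.trans (⊞-coeff E⁻¹ (monoM 1 (neg B) ∙ E⁻¹) i j 0)
      (K.trans (K.+-cong (KM.I-entry i j) (monoM₁-coeff-0 (neg B) E⁻¹ i j))
      (K.trans (K.+-identityʳ _) (K.sym (I-coeff-0 i j))))
    coefficient i j (suc l) = K.trans (⊞-coeff E⁻¹ (monoM 1 (neg B) ∙ E⁻¹) i j (suc l)) (K.trans
      (K.+-congˡ (K.trans (monoM₁-coeff (neg B) E⁻¹ i j l) (KM.entry (neg-∙ B (B^ l)) i j)))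
      (K.trans (K.-‿inverseʳ _) (K.sym (I-coeff-suc i j l))))

  ∙-neg : ∀ {m n p} (A : KM.Mat m n) (B : KM.Mat n p) → A KM.∙ neg B KM.≈ᴹ neg (A KM.∙ B)
  ∙-neg A B = KM.entrywise λ i j → KP.+-inverseʳ-unique _ _ (K.trans (K.+-cong (KM.∙-entry A B i j) (KM.∙-entry A (neg B) i j))
    (K.trans (K.sym (KΣ.∑-distrib-+ (λ k → A i k K.* B k j) (λ k → A i k K.* K.- B k j)))
      (KS.sum-zero (λ k → A i k K.* B k j K.+ A i k K.* K.- B k j) λ k →
        K.trans (K.sym (K.distribˡ (A i k) (B k j) (K.- B k j)))
          (K.trans (K.*-congˡ (K.-‿inverseʳ (B k j))) (K.zeroʳ (A i k))))))

  -- B now stands on the right of its powers, so `B^-comm` is what makes the coefficients cancel.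
  E⁻¹∙E≈I : E⁻¹ ∙ E ≈ᴹ I
  E⁻¹∙E≈I = transᴹ (transᴹ (∙-distribˡ E⁻¹ I (monoM 1 (neg B))) (⊞-cong (∙-identityʳ E⁻¹) reflᴹ)) (entrywise coefficient)
    where
    coefficient : ∀ i j → (E⁻¹ ⊞ E⁻¹ ∙ monoM 1 (neg B)) i j ≈ I i j
    coefficient i j zero = K.trans (⊞-coeff E⁻¹ (E⁻¹ ∙ monoM 1 (neg B)) i j 0)
      (K.trans (K.+-cong (KM.I-entry i j) (∙-monoM-coeff-0 0 (neg B) E⁻¹ i j))
      (K.trans (K.+-identityʳ _) (K.sym (I-coeff-0 i j))))
    coefficient i j (suc l) = K.trans (⊞-coeff E⁻¹ (E⁻¹ ∙ monoM 1 (neg B)) i j (suc l)) (K.trans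
      (K.+-cong (KM.entry (B^-comm l) i j) (K.trans (∙-monoM₁-coeff (neg B) E⁻¹ i j l) (KM.entry (∙-neg (B^ l) B) i j)))
      (K.trans (K.-‿inverseʳ _) (K.sym (I-coeff-suc i j l))))

  fold-shift : ∀ {i} {A : Set i} (F : A → A) x n → fold (F x) F n ≡ F (fold x F n)
  fold-shift F x zero    = ≡.refl
  fold-shift F x (suc n) = ≡.cong F (fold-shift F x n)

  -- The iteration applies L last, whereas the product of `H` with L applies it first; the two agree
  -- because L commutes with its iterates.
  L^half-suc : ∀ q n i j → L^half (suc q) n i j ≡ L^half q n i (L̂ j)
  L^half-suc q zero          i j = ≡.cong (KM.δ i) (≡.sym (fold-shift L̂ j q))
  L^half-suc q (suc zero)    i j = ≡.refl
  L^half-suc q (suc (suc n)) i j = L^half-suc (suc q) n i j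

  H∙L-coeff : ∀ i j l → (coeff l H KM.∙ Φ L̂) i j K.≈ H i j (suc (suc l))
  H∙L-coeff i j l = K.trans (KM.∙-entry (coeff l H) (Φ L̂) i j) (K.trans (KM.sum-δʳ (L̂ j) (λ k → H i k l))
    (K.reflexive (≡.sym (L^half-suc 0 l i j))))

  H∙U≈I : H ∙ U ≈ᴹ I
  H∙U≈I = transᴹ (transᴹ (∙-distribˡ H I (monoM 2 (neg (Φ L̂)))) (⊞-cong (∙-identityʳ H) reflᴹ)) (entrywise coefficient)
    where
    HL = H ∙ monoM 2 (neg (Φ L̂))
    coefficient : ∀ i j → (H ⊞ HL) i j ≈ I i j
    coefficient i j zero = K.trans (⊞-coeff H HL i j 0) (K.trans (K.+-congˡ (∙-monoM-coeff-0 1 (neg (Φ L̂)) H i j))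
      (K.trans (K.+-identityʳ _) (K.sym (I-coeff-0 i j))))
    coefficient i j (suc zero) = K.trans (⊞-coeff H HL i j 1) (K.trans (K.+-congˡ (∙-monoM₂-coeff-1 (neg (Φ L̂)) H i j))
      (K.trans (K.+-identityʳ _) (K.sym (I-coeff-suc i j 0))))
    coefficient i j (suc (suc l)) = K.trans (⊞-coeff H HL i j (suc (suc l))) (K.trans
      (K.+-congˡ (K.trans (∙-monoM₂-coeff (neg (Φ L̂)) H i j l)
        (K.trans (KM.entry (∙-neg (coeff l H) (Φ L̂)) i j) (K.-‿cong (H∙L-coeff i j l)))))
      (K.trans (K.-‿inverseʳ _) (K.sym (I-coeff-suc i j (suc l)))))

-- The logarithmic derivative of the determinant

module IharaDeterminant {a b c ℓ} (R : CommutativeRing c ℓ) (torsionFree : TorsionFree R)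
                        (Γ : AbstractIsogenyGraph a b) (fin : Finite Γ) where
  private
    module K = CommutativeRing R
    module KS = SumProperties K.semiring
    module KΣ = SemiringSum K.semiring
    module KMult = SemiringMult K.semiring
    module KP = RingProperties K.ring
    module KR = RingOps K.rawRing
    module KM = Matrices R
  open SeriesRing R
  open MonomialMatrices R
  open IharaMatrices R Γ fin
  open LogDerivative R
  open LogDerivatives R torsionFree Γ fin using (closedWalkSeries; cycleSeries)
  open IndexMaps Γ fin using (t̂; L̂; Ĵ)
  open GraphMatrices R Γ fin using (Φ; σ; B^; closed-trace; fixedPoints-trace)
  open Finite fin
  open Setting R Γ fin using (𝐃; 𝐋; _∘ₒ_; _≈ₒ_)
  private
    module S = CommutativeRing seriesRing
  open Series K.rawRing

  θ′ : ∀ {m n} → Mat m n → Mat m n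
  θ′ = θᴹ θ-derivation

  0ᴹ : ∀ {m n} → Mat m n
  0ᴹ i j = 0#

  ⊞-0ᴹ : ∀ {m n} (F : Mat m n) → F ⊞ 0ᴹ ≈ᴹ F
  ⊞-0ᴹ F = entrywise λ i j l → K.trans (⊞-entry F 0ᴹ i j l) (K.+-identityʳ (F i j l))

  ∙-0ᴹ : ∀ {m n p} (F : Mat m n) → F ∙ 0ᴹ {n} {p} ≈ᴹ 0ᴹ
  ∙-0ᴹ F = entrywise λ i j l → K.trans (∙-entry F 0ᴹ i j l)
    (SumProperties.sum-zero S.semiring (λ k → F i k * 0#) (λ k → S.zeroʳ (F i k)) l)

  θ-I : ∀ {n} → θ′ (I {n}) ≈ᴹ 0ᴹ
  θ-I = entrywise λ i j l → K.trans (θᴹ-entry θ-derivation I i j l)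
    (K.trans (θ-cong (entry I≈monoM i j) l) (θ-mono₀ (KM.δ i j) l))

  θ-monoM₁ : ∀ {m n} (A : KM.Mat m n) → θ′ (monoM 1 A) ≈ᴹ monoM 1 A
  θ-monoM₁ A = entrywise λ i j l → K.trans (θᴹ-entry θ-derivation (monoM 1 A) i j l) (θ-mono₁ (A i j) l)

  0ᴹ-⊞ : ∀ {m n} {F G : Mat m n} → F ≈ᴹ 0ᴹ → F ⊞ G ≈ᴹ G
  0ᴹ-⊞ {F = F} {G} F≈0 = transᴹ (⊞-cong F≈0 reflᴹ) (transᴹ (⊞-comm 0ᴹ G) (⊞-0ᴹ G))

  θM≈uJ : θ′ M ≈ᴹ uJ
  θM≈uJ = transᴹ (θᴹ-⊞ θ-derivation I uJ) (transᴹ (0ᴹ-⊞ θ-I) (θ-monoM₁ (Φ Ĵ)))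

  θU≈ : θ′ U ≈ᴹ monoM 2 (λ i j → (neg (Φ L̂)) i j K.+ (neg (Φ L̂)) i j)
  θU≈ = transᴹ (θᴹ-⊞ θ-derivation I (monoM 2 (neg (Φ L̂)))) (transᴹ (0ᴹ-⊞ θ-I)
    (entrywise λ i j l → K.trans (θᴹ-entry θ-derivation (monoM 2 (neg (Φ L̂))) i j l) (θ-mono₂ (K.- Φ L̂ i j) l)))

  θUτ≈ : θ′ (U ∙ τ) ≈ᴹ θ′ U ∙ τ
  θUτ≈ = transᴹ (θᴹ-∙ θ-derivation U τ) (transᴹ (⊞-cong reflᴹ (transᴹ (∙-cong reflᴹ θτ≈0) (∙-0ᴹ U))) (⊞-0ᴹ (θ′ U ∙ τ)))
    where
    θτ≈0 : θ′ τ ≈ᴹ 0ᴹ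
    θτ≈0 = entrywise λ i j l → K.trans (θᴹ-entry θ-derivation τ i j l) (θ-mono₀ (Φ t̂ i j) l)

  L^half-trace : ∀ q n → KΣ.sum (λ i → L^half q n i i) K.≈ fixedByHalf L̂ q n KR.×ₙ K.1#
  L^half-trace q zero          = K.sym (K.trans (fixedPoints-trace L̂ q K.1#)
    (KΣ.sum-cong-≋ λ i → K.*-identityʳ (KM.δ i (fold i L̂ q))))
  L^half-trace q (suc zero)    = KS.sum-zero {∣X∣} (λ _ → K.0#) (λ _ → K.refl)
  L^half-trace q (suc (suc n)) = L^half-trace (suc q) n

  tr-θU∙H : ∀ n → tr (θ′ U ∙ H) n K.≈ tr (H ∙ monoM 2 (λ i j → (neg (Φ L̂)) i j K.+ (neg (Φ L̂)) i j)) n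
  tr-θU∙H n = K.trans (tr-comm (θ′ U) H n) (tr-cong (∙-cong reflᴹ θU≈) n)

  tr-θU∙H-low : ∀ n → n < 2 → tr (θ′ U ∙ H) n K.≈ K.0#
  tr-θU∙H-low n n<2 = K.trans (tr-θU∙H n) (K.trans (tr-coeff (H ∙ monoM 2 A) n)
    (KS.sum-zero (λ i → (H ∙ monoM 2 A) i i n) (low n n<2)))
    where
    A : KM.Mat ∣X∣ ∣X∣
    A i j = (neg (Φ L̂)) i j K.+ (neg (Φ L̂)) i j
    low : ∀ n → n < 2 → ∀ i → (H ∙ monoM 2 A) i i n K.≈ K.0#
    low 0 _ i = ∙-monoM-coeff-0 1 A H i i
    low 1 _ i = ∙-monoM₂-coeff-1 A H i i
    low (suc (suc _)) (s≤s (s≤s ()))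

  -- θU = -2 u² L and H = Σ u²ᵖ Lᵖ, so the trace is -2 Σ tr(Lᵖ) u²ᵖ over p ≥ 1, and tr(Lᵖ) counts
  -- the fixed points of Lᵖ.
  tr-θU∙H-coeff : ∀ n → tr (θ′ U ∙ H) (suc n) K.≈ K.- ((2 ℕ.* fixedByHalf L̂ 0 (suc n)) KR.×ₙ K.1#)
  tr-θU∙H-coeff zero    = K.trans (tr-θU∙H-low 1 (s≤s (s≤s z≤n))) (K.sym KP.-0#≈0#)
  tr-θU∙H-coeff (suc n) = K.trans (tr-θU∙H (suc (suc n))) (K.trans (tr-coeff (H ∙ monoM 2 A) (suc (suc n)))
    (K.trans (KΣ.sum-cong-≋ diagonal) (K.trans (KΣ.∑-distrib-+ (λ i → K.- h i) (λ i → K.- h i))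
      (K.trans (K.+-cong sum-neg sum-neg) (K.trans (KP.-‿+-comm _ _) (K.-‿cong double))))))
    where
    A : KM.Mat ∣X∣ ∣X∣
    A i j = (neg (Φ L̂)) i j K.+ (neg (Φ L̂)) i j
    h : Fin ∣X∣ → K.Carrier
    h i = H i i (suc (suc n))
    f = fixedByHalf L̂ 0 (suc (suc n))
    sum-neg : KΣ.sum (λ i → K.- h i) K.≈ K.- (f KR.×ₙ K.1#)
    sum-neg = KP.+-inverseʳ-unique _ _ (K.trans (K.+-congʳ (K.sym (L^half-trace 0 (suc (suc n)))))
      (K.trans (K.sym (KΣ.∑-distrib-+ h (λ i → K.- h i))) (KS.sum-zero (λ i → h i K.+ K.- h i) (λ i → K.-‿inverseʳ (h i)))))
    double : f KR.×ₙ K.1# K.+ f KR.×ₙ K.1# K.≈ (2 ℕ.* f) KR.×ₙ K.1#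
    double = K.trans (K.sym (KMult.×-homo-+ K.1# f f)) (K.reflexive
      (≡.cong (λ m → (f ℕ.+ m) KR.×ₙ K.1#) (≡.sym (ℕ.+-identityʳ f))))
    diagonal : ∀ i → (H ∙ monoM 2 A) i i (suc (suc n)) K.≈ (K.- h i) K.+ (K.- h i)
    diagonal i = K.trans (∙-monoM₂-coeff A H i i n) (K.trans twice
      (K.+-cong negated negated))
      where
      twice : (coeff n H KM.∙ A) i i K.≈ (coeff n H KM.∙ neg (Φ L̂)) i i K.+ (coeff n H KM.∙ neg (Φ L̂)) i i
      twice = K.trans (KM.entry (KM.∙-cong (KM.reflᴹ {x = coeff n H}) A≈) i i) (K.trans
        (KM.entry (KM.∙-distribˡ (coeff n H) (neg (Φ L̂)) (neg (Φ L̂))) i i) (KM.⊞-entry _ _ i i))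
        where
        A≈ : A KM.≈ᴹ neg (Φ L̂) KM.⊞ neg (Φ L̂)
        A≈ = KM.entrywise λ i j → K.sym (KM.⊞-entry (neg (Φ L̂)) (neg (Φ L̂)) i j)
      negated : (coeff n H KM.∙ neg (Φ L̂)) i i K.≈ K.- h i
      negated = K.trans (KM.entry (∙-neg (coeff n H) (Φ L̂)) i i) (K.-‿cong (H∙L-coeff i i n))

  tr-M⁻¹-coeff : ∀ n → tr M⁻¹ n K.≈ fixedPoints Ĵ n KR.×ₙ ((K.- K.1#) KR.^ n)
  tr-M⁻¹-coeff n = K.trans (tr-coeff M⁻¹ n) (K.trans (KΣ.sum-cong-≋ λ i → K.*-comm ((K.- K.1#) KR.^ n) (KM.δ i (fold i Ĵ n)))
    (K.sym (fixedPoints-trace Ĵ n ((K.- K.1#) KR.^ n))))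

  tr-E⁻¹-coeff : ∀ n → tr E⁻¹ (suc n) K.≈ closedWalkSeries (suc n)
  tr-E⁻¹-coeff n = K.trans (tr-coeff E⁻¹ (suc n)) (K.sym (closed-trace n))

  -- Both are the trace of the identity on edges. They cancel in Bass's identity, which lets
  -- `closedWalkSeries` and `cycleSeries` start with 0.
  tr-E⁻¹≈tr-M⁻¹ : tr E⁻¹ 0 K.≈ tr M⁻¹ 0
  tr-E⁻¹≈tr-M⁻¹ = K.trans (tr-coeff E⁻¹ 0) (K.trans (KΣ.sum-cong-≋ same) (K.sym (tr-coeff M⁻¹ 0)))
    where
    same : ∀ i → B^ 0 i i K.≈ K.1# K.* KM.δ i i
    same i = K.trans (KM.I-entry i i) (K.sym (K.*-identityˡ _))

  module _ (commutes : 𝐃 ∘ₒ 𝐋 ≈ₒ 𝐋 ∘ₒ 𝐃) where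
    open BassTrace.BassIdentity seriesRing θ-derivation τ ρ uσ U H Δ M uJ E M⁻¹ E⁻¹
      reflᴹ E+uσ∙τ≈M (Δ+ρ∙uσ≈U commutes) ρM≈Uτ M∙M⁻¹≈I E∙E⁻¹≈I E⁻¹∙E≈I H∙U≈I θUτ≈ (θ-monoM₁ σ) θM≈uJ
      public using (N; NΔ≈θΔ; bass-trace)

    logDeriv-det : HasLogDeriv (det Δ) (tr N)
    logDeriv-det = det-constant-1 Δ Δ-constant , λ l → K.trans
      (Determinant.Jacobi.θ-det-trace seriesRing θ-derivation Δ N θΔ l)
      (⊛-cong {f = SemiringSum.sum S.semiring (λ i → N i i)} {tr N} {det Δ} {det Δ} (S.sym {tr N} (tr-sum N)) (λ _ → K.refl) l)
      where
      Δ-constant : ∀ i j → Δ i j 0 K.≈ KM.δ i j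
      Δ-constant i j = K.trans (entry Δ-expand i j 0) (K.trans (⊞-entry _ _ i j 0) (K.trans (K.+-identityʳ _)
        (K.trans (⊞-entry _ _ i j 0) (K.trans (K.+-identityʳ _) (I-coeff-0 i j)))))
      θΔ : ∀ i j → θ (Δ i j) ≈ SemiringSum.sum S.semiring (λ k → N i k * Δ k j)
      θΔ i j l = K.trans (K.sym (θᴹ-entry θ-derivation Δ i j l)) (K.trans (K.sym (entry NΔ≈θΔ i j l)) (∙-entry N Δ i j l))

    -- Bass's trace identity solved for tr E⁻¹.
    closedWalks≈cycles-trN : closedWalkSeries ≈ cycleSeries - tr N
    closedWalks≈cycles-trN l = balance l (K.trans (K.sym (bass-trace l)) (K.+-comm _ _))
      where
      balance : ∀ l → tr (θ′ U ∙ H) l K.+ tr M⁻¹ l K.≈ tr E⁻¹ l K.+ tr N l →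
        closedWalkSeries l K.≈ cycleSeries l K.+ (K.- tr N l)
      -- In degree 0 both series are 0 by definition, so what has to be shown is that the constant
      -- term of tr N vanishes.
      balance zero    e = K.sym (K.trans (K.+-identityˡ _) (K.trans (K.-‿cong trN≈0) KP.-0#≈0#))
        where
        trN≈0 : tr N 0 K.≈ K.0#
        trN≈0 = KP.+-cancelˡ (tr E⁻¹ 0) _ _ (K.trans (K.sym e)
          (K.trans (K.+-cong (tr-θU∙H-low 0 (s≤s z≤n)) (K.sym tr-E⁻¹≈tr-M⁻¹)) (K.+-comm _ _)))
      balance (suc n) e = K.sym (K.trans (K.+-congʳ (K.trans (K.sym (K.+-cong (tr-θU∙H-coeff n) (tr-M⁻¹-coeff (suc n)))) e))
        (K.trans (K.+-assoc _ _ _) (K.trans (K.+-congˡ (K.-‿inverseʳ _)) (K.trans (K.+-identityʳ _) (tr-E⁻¹-coeff n)))))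

theorem4p12 : ∀ {a b c ℓ} (R : CommutativeRing c ℓ) → TorsionFree R →
    (Γ : AbstractIsogenyGraph a b) (fin : Finite Γ) →
    let open Setting R Γ fin in
    𝐃 ∘ₒ 𝐋 ≈ₒ 𝐋 ∘ₒ 𝐃 →
    ζ Γ fin ≈
    (1# - u ^ 2) ^ C enumX L 1 * (1# + u) ⁻¹ ^ C enumY J 1
    * ∏≥ 2 (λ k → (1# - u ^ (2 ℕ.* k)) ^ C enumX L k
    * (1# - (- 1#) ^ k * u ^ k) ⁻¹ ^ C enumY J k)
    * detₒ (idₒ -ₒ u ·ₒ ⟪ 𝐀 ⟫ +ₒ u ^ 2 ·ₒ ⟪ 𝐐 ∘ₒ 𝐋 ⟫) ⁻¹
theorem4p12 R torsionFree Γ fin commutes =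
  logDeriv-unique torsionFree {ζ Γ fin} {cycles * det Δ ⁻¹} {closedWalkSeries} {cycleSeries - tr (N commutes)}
    (closedWalks≈cycles-trN commutes) logDeriv-ζ
    (logDeriv-* {cycles} {det Δ ⁻¹} {cycleSeries} { - tr (N commutes)}
      (logDeriv-cycles (C enumX L) (C enumY J) (count-fixed L̂) (count-fixed Ĵ))
      (logDeriv-⁻¹ {det Δ} {tr (N commutes)} (logDeriv-det commutes)))
  where
  open Setting R Γ fin using (J; L; enumX; enumY)
  open LogDerivative R
  open LogDerivatives R torsionFree Γ fin
  open IndexMaps Γ fin using (L̂; Ĵ)
  open IharaDeterminant R torsionFree Γ fin
  open IharaMatrices R Γ fin using (Δ)
  open MonomialMatrices R using (tr)
  open Series (CommutativeRing.rawRing R)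
  cycles = cycleProduct (C enumX L) (C enumY J)
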